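{- There is an absolute constant $c>0$ such that for every $n \ge 2$ and every graph $H$ on $n$ vertices with at least one edge, \[ Q(f_H) \ge c\sqrt{\alpha_H \cdot n}. \]
   Context: Graphs are simple and undirected. For a fixed graph $H$ on vertex set $[n]=\{1,\dots,n\}$ (isolated vertices allowed), $f_H:\{0,1\}^{\binom{n}{2}}\to\{0,1\}$ takes as input a graph $G$ on vertex set $[n]$, given by its $\binom n2$ edge-indicator bits, and $f_H(G)=1$ iff $H$ is isomorphic to a (not necessarily induced) subgraph of $G$. $Q(f)$ denotes the bounded-error (success probability at least $2/3$ on every input) quantum query complexity of a Boolean function $f$, where a query to the input $x$ reveals one bit $x_i$ (standard phase/oracle query model). $\alpha_H$ denotes the size of a maximum independent set of $H$. -}

module Defs where

open import Data.Bool.Base using (Bool; true; false; if_then_else_)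
import Data.Bool.Properties as Bool
open import Data.Fin.Base using (Fin; zero; suc; Fin′; inject; finToFun; funToFin)
import Data.Fin.Properties as Fin
open import Data.Fin.Permutation
  using (Permutation′; permutation; _⟨$⟩ʳ_; _⟨$⟩ˡ_; inverseˡ; inverseʳ; cast-id)
open import Data.Fin.Subset using (Subset; inside; outside; _∈_; ∣_∣)
open import Data.Fin.Subset.Properties using (_∈?_; anySubset?)
open import Data.Integer.Base as ℤ using (+_; +[1+_]; -[1+_])
import Data.Integer.Properties as ℤ
open import Data.List.Base as List using (List; []; _∷_; _++_)
open import Data.List.Extrema.Nat using (max)
open import Data.Nat.Base as ℕ using (ℕ; zero; suc)
open import Data.Nat.Combinatorics using (_C_; nC1≡n; nCk+nC[k+1]≡[n+1]C[k+1])
import Data.Nat.Properties as ℕ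
open import Data.Nat.Tactic.RingSolver using (solve-∀)
open import Data.Product.Base using (Σ; Σ-syntax; ∃-syntax; _×_; _,_; proj₁)
open import Data.Product.Properties using (≡-dec)
open import Data.Rational.Base as ℚ using (ℚ; mkℚ; 0ℚ; 1ℚ; ½; _/_; toℚᵘ)
import Data.Rational.Properties as ℚ
open import Data.Rational.Solver using (module +-*-Solver)
open import Data.Rational.Unnormalised.Base as ℚᵘ using (mkℚᵘ; *<*)
import Data.Rational.Unnormalised.Properties as ℚᵘ
open import Data.Sum.Base using (_⊎_; inj₁; inj₂)
open import Data.Sum.Function.Propositional using (_⊎-↔_)
open import Data.Vec.Base as Vec using (Vec; []; _∷_; lookup)
import Data.Vec.Functional as Vector
open import Function.Bundles using (_↔_; mk↔ₛ′; Inverse; _⇔_; mk⇔; Equivalence)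
open import Function.Construct.Composition using (_↔-∘_)
open import Function.Construct.Identity using (↔-id)
open import Relation.Binary.Definitions using (DecidableEquality)
open import Relation.Binary.PropositionalEquality
  using (_≡_; refl; sym; trans; cong; cong₂; subst; subst₂)
open import Relation.Nullary using (¬_; Dec; yes; no; ¬?; does; map′; _×-dec_; _⊎-dec_; _→-dec_)

------------------------------------------------------------------------
-- Real numbers: Cauchy sequences of rationals, up to _≈ᵣ_

IsCauchy : (ℕ → ℚ) → Set
IsCauchy x = ∀ ε → 0ℚ ℚ.< ε →
  ∃[ N ] ∀ m n → N ℕ.≤ m → N ℕ.≤ n → ℚ.∣ x m ℚ.- x n ∣ ℚ.< ε

record ℝ : Set where
  no-eta-equality
  constructor mkℝ
  field
    seq    : ℕ → ℚ
    cauchy : IsCauchy seq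
open ℝ public

infix 4 _≈ᵣ_ _≤ᵣ_ _<ᵣ_

_≈ᵣ_ _≤ᵣ_ _<ᵣ_ : ℝ → ℝ → Set
x ≈ᵣ y = ∀ ε → 0ℚ ℚ.< ε → ∃[ N ] ∀ k → N ℕ.≤ k → ℚ.∣ seq x k ℚ.- seq y k ∣ ℚ.< ε
x ≤ᵣ y = ∀ ε → 0ℚ ℚ.< ε → ∃[ N ] ∀ k → N ℕ.≤ k → seq x k ℚ.≤ seq y k ℚ.+ ε
x <ᵣ y = ∃[ ε ] 0ℚ ℚ.< ε × ∃[ N ] ∀ k → N ℕ.≤ k → seq x k ℚ.+ ε ℚ.≤ seq y k

-- Opaque, so that moduli of convergence are never normalised.
abstract
  half-pos : ∀ {ε} → 0ℚ ℚ.< ε → 0ℚ ℚ.< ½ ℚ.* ε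
  half-pos {ε} 0<ε = ℚ.*-monoʳ-<-pos ½ 0<ε

  half+half : ∀ ε → ½ ℚ.* ε ℚ.+ ½ ℚ.* ε ≡ ε
  half+half ε = trans (sym (ℚ.*-distribʳ-+ ε ½ ½)) (ℚ.*-identityˡ ε)

  +-cauchy : ∀ {x y} → IsCauchy x → IsCauchy y → IsCauchy (λ k → x k ℚ.+ y k)
  +-cauchy {x} {y} cx cy ε 0<ε with cx (½ ℚ.* ε) (half-pos 0<ε) | cy (½ ℚ.* ε) (half-pos 0<ε)
  ... | M , p | N , q = M ℕ.⊔ N , λ m n m≥ n≥ → begin-strict
    ℚ.∣ (x m ℚ.+ y m) ℚ.- (x n ℚ.+ y n) ∣
      ≡⟨ cong ℚ.∣_∣ (regroup (x m) (y m) (x n) (y n)) ⟩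
    ℚ.∣ (x m ℚ.- x n) ℚ.+ (y m ℚ.- y n) ∣
      ≤⟨ ℚ.∣p+q∣≤∣p∣+∣q∣ (x m ℚ.- x n) (y m ℚ.- y n) ⟩
    ℚ.∣ x m ℚ.- x n ∣ ℚ.+ ℚ.∣ y m ℚ.- y n ∣
      <⟨ ℚ.+-mono-< (p m n (ℕ.m⊔n≤o⇒m≤o M N m≥) (ℕ.m⊔n≤o⇒m≤o M N n≥))
                    (q m n (ℕ.m⊔n≤o⇒n≤o M N m≥) (ℕ.m⊔n≤o⇒n≤o M N n≥)) ⟩
    ½ ℚ.* ε ℚ.+ ½ ℚ.* ε
      ≡⟨ half+half ε ⟩
    ε ∎
    where
    open ℚ.≤-Reasoning
    open +-*-Solver
    regroup : ∀ a b c d → (a ℚ.+ b) ℚ.- (c ℚ.+ d) ≡ (a ℚ.- c) ℚ.+ (b ℚ.- d)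
    regroup = solve 4 (λ a b c d → (a :+ b) :- (c :+ d) := (a :- c) :+ (b :- d)) refl

  neg-cauchy : ∀ {x} → IsCauchy x → IsCauchy (λ k → ℚ.- x k)
  neg-cauchy {x} cx ε 0<ε with cx ε 0<ε
  ... | N , p = N , λ m n m≥ n≥ →
    subst (ℚ._< ε) (trans (sym (ℚ.∣-p∣≡∣p∣ (x m ℚ.- x n)))
                          (cong ℚ.∣_∣ (ℚ.neg-distrib-+ (x m) (ℚ.- x n))))
      (p m n m≥ n≥)

  -- Every Cauchy sequence is eventually bounded.
  bounded : ∀ {x} → IsCauchy x →
            ∃[ B ] ℚ.Positive B × ∃[ N ] ∀ k → N ℕ.≤ k → ℚ.∣ x k ∣ ℚ.≤ B
  bounded {x} cx with cx 1ℚ (ℚ.positive⁻¹ 1ℚ)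
  ... | N , p = 1ℚ ℚ.+ ℚ.∣ x N ∣
              , ℚ.positive (ℚ.+-mono-<-≤ (ℚ.positive⁻¹ 1ℚ) (ℚ.0≤∣p∣ (x N)))
              , N , λ k k≥ → begin
    ℚ.∣ x k ∣                          ≡⟨ cong ℚ.∣_∣ (split (x k) (x N)) ⟩
    ℚ.∣ (x k ℚ.- x N) ℚ.+ x N ∣        ≤⟨ ℚ.∣p+q∣≤∣p∣+∣q∣ (x k ℚ.- x N) (x N) ⟩
    ℚ.∣ x k ℚ.- x N ∣ ℚ.+ ℚ.∣ x N ∣    ≤⟨ ℚ.+-monoˡ-≤ ℚ.∣ x N ∣ (ℚ.<⇒≤ (p k N k≥ ℕ.≤-refl)) ⟩
    1ℚ ℚ.+ ℚ.∣ x N ∣                   ∎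
    where
    open ℚ.≤-Reasoning
    open +-*-Solver
    split : ∀ a b → a ≡ (a ℚ.- b) ℚ.+ b
    split = solve 2 (λ a b → a := (a :- b) :+ b) refl

  -- A bounded factor times a small one.
  scale : ∀ B .{{_ : ℚ.Positive B}} {ε} → 0ℚ ℚ.< ε →
          ∃[ δ ] 0ℚ ℚ.< δ × (∀ {a b} → ℚ.∣ a ∣ ℚ.≤ B → ℚ.∣ b ∣ ℚ.< δ → ℚ.∣ a ℚ.* b ∣ ℚ.< ε)
  scale B {ε} 0<ε = δ , 0<δ , λ {a} {b} a≤ b< → begin-strict
    ℚ.∣ a ℚ.* b ∣          ≡⟨ ℚ.∣p*q∣≡∣p∣*∣q∣ a b ⟩
    ℚ.∣ a ∣ ℚ.* ℚ.∣ b ∣    ≤⟨ ℚ.*-monoʳ-≤-nonNeg ℚ.∣ b ∣ {{ℚ.∣-∣-nonNeg b}} a≤ ⟩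
    B ℚ.* ℚ.∣ b ∣          <⟨ ℚ.*-monoʳ-<-pos B b< ⟩
    B ℚ.* δ                ≡⟨ ℚ.*-assoc B B⁻¹ ε ⟨
    (B ℚ.* B⁻¹) ℚ.* ε      ≡⟨ cong (ℚ._* ε) (ℚ.*-inverseʳ B {{ℚ.pos⇒nonZero B}}) ⟩
    1ℚ ℚ.* ε               ≡⟨ ℚ.*-identityˡ ε ⟩
    ε                      ∎
    where
    open ℚ.≤-Reasoning
    B⁻¹ δ : ℚ
    B⁻¹ = ℚ.1/_ B {{ℚ.pos⇒nonZero B}}
    δ = B⁻¹ ℚ.* ε
    0<δ : 0ℚ ℚ.< δ
    0<δ = subst (ℚ._< δ) (ℚ.*-zeroʳ B⁻¹) (ℚ.*-monoʳ-<-pos B⁻¹ {{ℚ.1/pos⇒pos B}} 0<ε)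

  *-close : ∀ ε a b c d →
            ℚ.∣ a ℚ.* (b ℚ.- d) ∣ ℚ.< ½ ℚ.* ε → ℚ.∣ d ℚ.* (a ℚ.- c) ∣ ℚ.< ½ ℚ.* ε →
            ℚ.∣ a ℚ.* b ℚ.- c ℚ.* d ∣ ℚ.< ε
  *-close ε a b c d p q = begin-strict
    ℚ.∣ a ℚ.* b ℚ.- c ℚ.* d ∣                          ≡⟨ cong ℚ.∣_∣ (regroup a b c d) ⟩
    ℚ.∣ a ℚ.* (b ℚ.- d) ℚ.+ d ℚ.* (a ℚ.- c) ∣          ≤⟨ ℚ.∣p+q∣≤∣p∣+∣q∣ (a ℚ.* (b ℚ.- d)) (d ℚ.* (a ℚ.- c)) ⟩
    ℚ.∣ a ℚ.* (b ℚ.- d) ∣ ℚ.+ ℚ.∣ d ℚ.* (a ℚ.- c) ∣    <⟨ ℚ.+-mono-< p q ⟩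
    ½ ℚ.* ε ℚ.+ ½ ℚ.* ε                                ≡⟨ half+half ε ⟩
    ε                                                  ∎
    where
    open ℚ.≤-Reasoning
    open +-*-Solver
    regroup : ∀ a b c d →
              a ℚ.* b ℚ.- c ℚ.* d ≡ a ℚ.* (b ℚ.- d) ℚ.+ d ℚ.* (a ℚ.- c)
    regroup = solve 4 (λ a b c d →
      a :* b :- c :* d := a :* (b :- d) :+ d :* (a :- c)) refl

  *-cauchy : ∀ {x y} → IsCauchy x → IsCauchy y → IsCauchy (λ k → x k ℚ.* y k)
  *-cauchy {x} {y} cx cy ε 0<ε =
    let A , A>0 , K , x≤A = bounded cx
        B , B>0 , L , y≤B = bounded cy
        δ , 0<δ , small   = scale A {{A>0}} (half-pos 0<ε)
        η , 0<η , small′  = scale B {{B>0}} (half-pos 0<ε)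
        M , p             = cy δ 0<δ
        N , q             = cx η 0<η
    in (K ℕ.⊔ L) ℕ.⊔ (M ℕ.⊔ N) , λ m n m≥ n≥ →
    let m≥KL = ℕ.m⊔n≤o⇒m≤o (K ℕ.⊔ L) (M ℕ.⊔ N) m≥
        n≥KL = ℕ.m⊔n≤o⇒m≤o (K ℕ.⊔ L) (M ℕ.⊔ N) n≥
        m≥MN = ℕ.m⊔n≤o⇒n≤o (K ℕ.⊔ L) (M ℕ.⊔ N) m≥
        n≥MN = ℕ.m⊔n≤o⇒n≤o (K ℕ.⊔ L) (M ℕ.⊔ N) n≥
    in *-close ε (x m) (y m) (x n) (y n)
         (small {x m} {y m ℚ.- y n} (x≤A m (ℕ.m⊔n≤o⇒m≤o K L m≥KL))
           (p m n (ℕ.m⊔n≤o⇒m≤o M N m≥MN) (ℕ.m⊔n≤o⇒m≤o M N n≥MN)))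
         (small′ {y n} {x m ℚ.- x n} (y≤B n (ℕ.m⊔n≤o⇒n≤o K L n≥KL))
           (q m n (ℕ.m⊔n≤o⇒n≤o M N m≥MN) (ℕ.m⊔n≤o⇒n≤o M N n≥MN)))

fromℚ : ℚ → ℝ
fromℚ q = mkℝ (λ _ → q) λ ε 0<ε →
  0 , λ _ _ _ _ → subst (ℚ._< ε) (cong ℚ.∣_∣ (sym (ℚ.+-inverseʳ q))) 0<ε

fromℕ : ℕ → ℝ
fromℕ n = fromℚ (+ n / 1)

0ᵣ 1ᵣ : ℝ
0ᵣ = fromℚ 0ℚ
1ᵣ = fromℚ 1ℚ

infixl 6 _+ᵣ_ _-ᵣ_
infixl 7 _*ᵣ_
infix  8 -ᵣ_

_+ᵣ_ _*ᵣ_ : ℝ → ℝ → ℝ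
x +ᵣ y = mkℝ (λ k → seq x k ℚ.+ seq y k) (+-cauchy {seq x} {seq y} (cauchy x) (cauchy y))
x *ᵣ y = mkℝ (λ k → seq x k ℚ.* seq y k) (*-cauchy {seq x} {seq y} (cauchy x) (cauchy y))

-ᵣ_ : ℝ → ℝ
-ᵣ x = mkℝ (λ k → ℚ.- seq x k) (neg-cauchy {seq x} (cauchy x))

_-ᵣ_ : ℝ → ℝ → ℝ
x -ᵣ y = x +ᵣ (-ᵣ y)

------------------------------------------------------------------------
-- Square roots of natural numbers

-- ⌊√ m ⌋
isqrt : ℕ → ℕ
isqrt zero = 0
isqrt (suc m) with suc (isqrt m) ℕ.* suc (isqrt m) ℕ.≤? suc m
... | yes _ = suc (isqrt m)
... | no  _ = isqrt m

isqrt-lower : ∀ m → isqrt m ℕ.* isqrt m ℕ.≤ m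
isqrt-lower zero = ℕ.z≤n
isqrt-lower (suc m) with suc (isqrt m) ℕ.* suc (isqrt m) ℕ.≤? suc m
... | yes p = p
... | no  _ = ℕ.m≤n⇒m≤1+n (isqrt-lower m)

isqrt-upper : ∀ m → m ℕ.< suc (isqrt m) ℕ.* suc (isqrt m)
isqrt-upper zero = ℕ.s≤s ℕ.z≤n
isqrt-upper (suc m) with suc (isqrt m) ℕ.* suc (isqrt m) ℕ.≤? suc m
... | no ¬p = ℕ.≰⇒> ¬p
... | yes _ = ℕ.≤-<-trans (isqrt-upper m)
                (ℕ.*-mono-< (ℕ.n<1+n (suc (isqrt m))) (ℕ.n<1+n (suc (isqrt m))))

-- ⌊√(m d²)⌋ / d with d = k + 1, which is within 1/d of √m.
√-seq : ℕ → ℕ → ℚ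
√-seq m k = + isqrt (m ℕ.* (suc k ℕ.* suc k)) / suc k

abstract
  √-cross : ∀ m d e →
    isqrt (m ℕ.* (suc d ℕ.* suc d)) ℕ.* suc e ℕ.<
    suc (isqrt (m ℕ.* (suc e ℕ.* suc e))) ℕ.* suc d
  √-cross m d e = ℕ.≰⇒> λ le → ℕ.<⇒≱ sq-< (ℕ.*-mono-≤ le le)
    where
    open ℕ.≤-Reasoning
    d² e² r s : ℕ
    d² = suc d ℕ.* suc d
    e² = suc e ℕ.* suc e
    r = isqrt (m ℕ.* d²)
    s = isqrt (m ℕ.* e²)
    sq : ∀ a b → (a ℕ.* b) ℕ.* (a ℕ.* b) ≡ (a ℕ.* a) ℕ.* (b ℕ.* b)
    sq = solve-∀
    swap : ∀ a b c → (a ℕ.* b) ℕ.* c ≡ (a ℕ.* c) ℕ.* b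
    swap = solve-∀
    sq-< : (r ℕ.* suc e) ℕ.* (r ℕ.* suc e) ℕ.< (suc s ℕ.* suc d) ℕ.* (suc s ℕ.* suc d)
    sq-< = begin-strict
      (r ℕ.* suc e) ℕ.* (r ℕ.* suc e)          ≡⟨ sq r (suc e) ⟩
      (r ℕ.* r) ℕ.* e²                         ≤⟨ ℕ.*-monoˡ-≤ e² (isqrt-lower (m ℕ.* d²)) ⟩
      (m ℕ.* d²) ℕ.* e²                        ≡⟨ swap m d² e² ⟩
      (m ℕ.* e²) ℕ.* d²                        <⟨ ℕ.*-monoˡ-< d² (isqrt-upper (m ℕ.* e²)) ⟩
      (suc s ℕ.* suc s) ℕ.* d²                 ≡⟨ sq (suc s) (suc d) ⟨
      (suc s ℕ.* suc d) ℕ.* (suc s ℕ.* suc d)  ∎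

  frac-< : ∀ r d s e p q → r ℕ.* suc e ℕ.< suc s ℕ.* suc d → q ℕ.≤ e →
    mkℚᵘ (+ r) d ℚᵘ.< mkℚᵘ (+ s) e ℚᵘ.+ mkℚᵘ +[1+ p ] q
  frac-< r d s e p q cross q≤e = *<* (subst₂ ℤ._<_ lhs rhs (ℤ.+<+ nat))
    where
    open ℕ.≤-Reasoning
    e′ q′ p′ d′ : ℕ
    e′ = suc e
    q′ = suc q
    p′ = suc p
    d′ = suc d
    lhs : + (r ℕ.* (e′ ℕ.* q′)) ≡ + r ℤ.* + (e′ ℕ.* q′)
    lhs = ℤ.pos-* r (e′ ℕ.* q′)
    rhs : + ((s ℕ.* q′ ℕ.+ p′ ℕ.* e′) ℕ.* d′) ≡
          (+ s ℤ.* + q′ ℤ.+ + p′ ℤ.* + e′) ℤ.* + d′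
    rhs = trans (ℤ.pos-* (s ℕ.* q′ ℕ.+ p′ ℕ.* e′) d′)
                (cong (ℤ._* + d′) (cong₂ ℤ._+_ (ℤ.pos-* s q′) (ℤ.pos-* p′ e′)))
    assoc : ∀ a b c → a ℕ.* (b ℕ.* c) ≡ (a ℕ.* b) ℕ.* c
    assoc = solve-∀
    swap : ∀ a b c → (a ℕ.* b) ℕ.* c ≡ (a ℕ.* c) ℕ.* b
    swap = solve-∀
    nat : r ℕ.* (e′ ℕ.* q′) ℕ.< (s ℕ.* q′ ℕ.+ p′ ℕ.* e′) ℕ.* d′
    nat = begin-strict
      r ℕ.* (e′ ℕ.* q′)                     ≡⟨ assoc r e′ q′ ⟩
      (r ℕ.* e′) ℕ.* q′                     <⟨ ℕ.*-monoˡ-< q′ cross ⟩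
      (suc s ℕ.* d′) ℕ.* q′                 ≡⟨ swap (suc s) d′ q′ ⟩
      (q′ ℕ.+ s ℕ.* q′) ℕ.* d′              ≡⟨ cong (ℕ._* d′) (ℕ.+-comm q′ (s ℕ.* q′)) ⟩
      (s ℕ.* q′ ℕ.+ q′) ℕ.* d′
        ≤⟨ ℕ.*-monoˡ-≤ d′ (ℕ.+-monoʳ-≤ (s ℕ.* q′)
             (ℕ.≤-trans (ℕ.s≤s q≤e) (ℕ.m≤n*m e′ p′))) ⟩
      (s ℕ.* q′ ℕ.+ p′ ℕ.* e′) ℕ.* d′       ∎

  √-close : ∀ m ε → 0ℚ ℚ.< ε → ∀ {d e} → ℚ.ℚ.denominator-1 ε ℕ.≤ e →
    √-seq m d ℚ.< √-seq m e ℚ.+ ε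
  √-close m (mkℚ (+ 0) q c) (ℚ.*<* (ℤ.+<+ ()))
  √-close m (mkℚ -[1+ p ] q c) (ℚ.*<* ())
  √-close m ε@(mkℚ +[1+ p ] q c) _ {d} {e} q≤e = ℚ.toℚᵘ-cancel-< (begin-strict
    toℚᵘ (√-seq m d)               ≃⟨ ℚ.toℚᵘ-fromℚᵘ (mkℚᵘ (+ r) d) ⟩
    mkℚᵘ (+ r) d                   <⟨ frac-< r d s e p q (√-cross m d e) q≤e ⟩
    mkℚᵘ (+ s) e ℚᵘ.+ toℚᵘ ε       ≃⟨ ℚᵘ.+-congˡ (toℚᵘ ε) (ℚ.toℚᵘ-fromℚᵘ (mkℚᵘ (+ s) e)) ⟨
    toℚᵘ (√-seq m e) ℚᵘ.+ toℚᵘ ε   ≃⟨ ℚ.toℚᵘ-homo-+ (√-seq m e) ε ⟨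
    toℚᵘ (√-seq m e ℚ.+ ε)         ∎)
    where
    open ℚᵘ.≤-Reasoning
    r s : ℕ
    r = isqrt (m ℕ.* (suc d ℕ.* suc d))
    s = isqrt (m ℕ.* (suc e ℕ.* suc e))

  ∣-∣-< : ∀ {a b ε} → a ℚ.< b ℚ.+ ε → b ℚ.< a ℚ.+ ε → ℚ.∣ a ℚ.- b ∣ ℚ.< ε
  ∣-∣-< {a} {b} {ε} a< b< with ℚ.∣p∣≡p∨∣p∣≡-p (a ℚ.- b)
  ... | inj₁ eq = subst₂ ℚ._<_ (sym eq) (cancel b ε) (ℚ.+-monoˡ-< (ℚ.- b) a<)
    where
    open +-*-Solver
    cancel : ∀ b ε → (b ℚ.+ ε) ℚ.- b ≡ ε
    cancel = solve 2 (λ b ε → (b :+ ε) :- b := ε) refl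
  ... | inj₂ eq = subst₂ ℚ._<_ (trans (flip a b) (sym eq)) (cancel a ε) (ℚ.+-monoˡ-< (ℚ.- a) b<)
    where
    open +-*-Solver
    flip : ∀ a b → b ℚ.- a ≡ ℚ.- (a ℚ.- b)
    flip = solve 2 (λ a b → b :- a := :- (a :- b)) refl
    cancel : ∀ b ε → (b ℚ.+ ε) ℚ.- b ≡ ε
    cancel = solve 2 (λ b ε → (b :+ ε) :- b := ε) refl

  √-cauchy : ∀ m → IsCauchy (√-seq m)
  √-cauchy m ε 0<ε = ℚ.ℚ.denominator-1 ε , λ k l k≥ l≥ →
    ∣-∣-< (√-close m ε 0<ε l≥) (√-close m ε 0<ε k≥)

√ : ℕ → ℝ
√ m = mkℝ (√-seq m) (√-cauchy m)

------------------------------------------------------------------------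
-- Complex numbers

record ℂ : Set where
  constructor _+i_
  field
    re im : ℝ
open ℂ public

0ᶜ 1ᶜ : ℂ
0ᶜ = 0ᵣ +i 0ᵣ
1ᶜ = 1ᵣ +i 0ᵣ

infix  4 _≈ᶜ_
infixl 6 _+ᶜ_
infixl 7 _*ᶜ_

_≈ᶜ_ : ℂ → ℂ → Set
z ≈ᶜ w = re z ≈ᵣ re w × im z ≈ᵣ im w

_+ᶜ_ _*ᶜ_ : ℂ → ℂ → ℂ
z +ᶜ w = (re z +ᵣ re w) +i (im z +ᵣ im w)
z *ᶜ w = (re z *ᵣ re w -ᵣ im z *ᵣ im w) +i (re z *ᵣ im w +ᵣ im z *ᵣ re w)

negᶜ conj : ℂ → ℂ
negᶜ z = (-ᵣ re z) +i (-ᵣ im z)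
conj z = re z +i (-ᵣ im z)

abs² : ℂ → ℝ
abs² z = re z *ᵣ re z +ᵣ im z *ᵣ im z

------------------------------------------------------------------------
-- Quantum query algorithms on inputs x ∈ {0,1}ᴺ

-- |i, w⟩ with i ∈ {0,…,N} the query register and w a basis state of a
-- W-dimensional workspace.  Index suc j asks for the j-th bit; index zero
-- asks for nothing, without which the phase oracle could not tell x from
-- its complement.
Basis : ℕ → ℕ → Set
Basis N W = Fin (suc N) × Fin W

State Matrix : ℕ → ℕ → Set
State  N W = Basis N W → ℂ
Matrix N W = Basis N W → Basis N W → ℂ

module _ {N W : ℕ} where

  infix 4 _≟_
  _≟_ : DecidableEquality (Basis N W)
  _≟_ = ≡-dec Fin._≟_ Fin._≟_

  ∑ᵣ : (Basis N W → ℝ) → ℝ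
  ∑ᵣ g = Vector.foldr _+ᵣ_ 0ᵣ λ i → Vector.foldr _+ᵣ_ 0ᵣ λ w → g (i , w)

  ∑ᶜ : (Basis N W → ℂ) → ℂ
  ∑ᶜ g = Vector.foldr _+ᶜ_ 0ᶜ λ i → Vector.foldr _+ᶜ_ 0ᶜ λ w → g (i , w)

  identity : Matrix N W
  identity a b = if does (a ≟ b) then 1ᶜ else 0ᶜ

  ket : Basis N W → State N W
  ket b a = identity a b

  _† : Matrix N W → Matrix N W
  (U †) a b = conj (U b a)

  _⊗_ : Matrix N W → Matrix N W → Matrix N W
  (U ⊗ V) a b = ∑ᶜ λ c → U a c *ᶜ V c b

  _·_ : Matrix N W → State N W → State N W
  (U · ψ) a = ∑ᶜ λ b → U a b *ᶜ ψ b

  IsUnitary : Matrix N W → Set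
  IsUnitary U = (∀ a b → ((U †) ⊗ U) a b ≈ᶜ identity a b)
              × (∀ a b → (U ⊗ (U †)) a b ≈ᶜ identity a b)

  -- |0, w⟩ ↦ |0, w⟩ and |suc j, w⟩ ↦ (-1)^(x_j) |suc j, w⟩
  oracle : Vec Bool N → State N W → State N W
  oracle x ψ (i , w) = if lookup (false ∷ x) i then negᶜ (ψ (i , w)) else ψ (i , w)

Unitary : ℕ → ℕ → Set
Unitary N W = Σ (Matrix N W) IsUnitary

-- T queries: U_T O_x U_{T-1} ⋯ U_1 O_x U_0 |start⟩, then a measurement in
-- the computational basis whose outcome determines the output bit.
record Algorithm (N T : ℕ) : Set where
  field
    workspace : ℕ
    start     : Basis N workspace
    U₀        : Unitary N workspace
    U         : Vec (Unitary N workspace) T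
    output    : Basis N workspace → Bool

  final : Vec Bool N → State N workspace
  final x = Vec.foldl (λ _ → State N workspace)
              (λ ψ V → proj₁ V · oracle x ψ) (proj₁ U₀ · ket start) U

  Pr[_outputs_] : Vec Bool N → Bool → ℝ
  Pr[ x outputs b ] = ∑ᵣ λ a →
    if does (output a Bool.≟ b) then abs² (final x a) else 0ᵣ

open Algorithm public using (Pr[_outputs_])

_Computes_ : ∀ {N T} → Algorithm N T → (Vec Bool N → Bool) → Set
A Computes f = ∀ x → fromℚ (+ 2 / 3) ≤ᵣ Pr[_outputs_] A x (f x)

-- Q f is the least T for which some T-query algorithm computes f with
-- bounded error, so it is at least r iff every such T is.
infix 4 Q_≥_
Q_≥_ : ∀ {N} → (Vec Bool N → Bool) → ℝ → Set
Q_≥_ {N} f r = ∀ T (A : Algorithm N T) → A Computes f → r ≤ᵣ fromℕ T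

------------------------------------------------------------------------
-- Graphs

-- The slots {u,v} with u < v are enumerated as pairs of v and u : Fin′ v.
slots : ∀ n → Fin (n C 2) ↔ Σ (Fin n) Fin′
slots zero = mk↔ₛ′ (λ ()) (λ ()) (λ ()) (λ ())
slots (suc n) =
  merge ↔-∘ ((↔-id (Fin n) ⊎-↔ slots n) ↔-∘ (Fin.+↔⊎ ↔-∘ cast-id pascal))
  where
  to : Fin n ⊎ Σ (Fin n) Fin′ → Σ (Fin (suc n)) Fin′
  to (inj₁ v)       = suc v , zero
  to (inj₂ (v , u)) = suc v , suc u
  from : Σ (Fin (suc n)) Fin′ → Fin n ⊎ Σ (Fin n) Fin′
  from (suc v , zero)  = inj₁ v
  from (suc v , suc u) = inj₂ (v , u)
  to∘from : ∀ s → to (from s) ≡ s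
  to∘from (suc v , zero)  = refl
  to∘from (suc v , suc u) = refl
  from∘to : ∀ s → from (to s) ≡ s
  from∘to (inj₁ v)       = refl
  from∘to (inj₂ (v , u)) = refl
  pascal : suc n C 2 ≡ n ℕ.+ n C 2
  pascal = trans (sym (nCk+nC[k+1]≡[n+1]C[k+1] n 1)) (cong (ℕ._+ n C 2) (nC1≡n n))
  merge : (Fin n ⊎ Σ (Fin n) Fin′) ↔ Σ (Fin (suc n)) Fin′
  merge = mk↔ₛ′ to from to∘from from∘to

endpoints : ∀ {n} → Fin (n C 2) → Fin n × Fin n
endpoints {n} k = let (v , u) = Inverse.to (slots n) k in inject u , v

-- A simple graph on [n], as its edge-indicator bits.
record Graph (n : ℕ) : Set where
  constructor graph
  field
    bits : Vec Bool (n C 2)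
open Graph public

module _ {n : ℕ} where

  Adj : Graph n → Fin n → Fin n → Set
  Adj G u v = ∃[ k ] lookup (bits G) k ≡ true × (endpoints {n} k ≡ (u , v) ⊎ endpoints {n} k ≡ (v , u))

  adj? : ∀ G u v → Dec (Adj G u v)
  adj? G u v = Fin.any? λ k →
    (lookup (bits G) k Bool.≟ true) ×-dec
    (≡-dec Fin._≟_ Fin._≟_ (endpoints {n} k) (u , v) ⊎-dec
     ≡-dec Fin._≟_ Fin._≟_ (endpoints {n} k) (v , u))

  HasEdge : Graph n → Set
  HasEdge G = ∃[ u ] ∃[ v ] Adj G u v

  infix 4 _⊆_ _≅_ _⊑_

  _⊆_ : Graph n → Graph n → Set
  S ⊆ G = ∀ u v → Adj S u v → Adj G u v

  _≅_ : Graph n → Graph n → Set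
  H ≅ S = Σ[ π ∈ Permutation′ n ]
    (∀ u v → Adj H u v ⇔ Adj S (π ⟨$⟩ʳ u) (π ⟨$⟩ʳ v))

  -- H is isomorphic to a subgraph of G.  A subgraph isomorphic to H has n
  -- vertices, so it is spanning.
  _⊑_ : Graph n → Graph n → Set
  H ⊑ G = ∃[ S ] H ≅ S × S ⊆ G

  private
    all²? : {P : Fin n → Fin n → Set} → (∀ u v → Dec (P u v)) → Dec (∀ u v → P u v)
    all²? P? = Fin.all? λ u → Fin.all? λ v → P? u v

    _⇔?_ : ∀ {A B : Set} → Dec A → Dec B → Dec (A ⇔ B)
    a? ⇔? b? = map′ (λ (f , g) → mk⇔ f g) (λ e → Equivalence.to e , Equivalence.from e)
                    ((a? →-dec b?) ×-dec (b? →-dec a?))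

    ≅-via : Graph n → Graph n → (Fin n → Fin n) → (Fin n → Fin n) → Set
    ≅-via H S f g = (∀ u → f (g u) ≡ u) × (∀ u → g (f u) ≡ u) ×
                    (∀ u v → Adj H u v ⇔ Adj S (f u) (f v))

    ≅-via? : ∀ H S f g → Dec (≅-via H S f g)
    ≅-via? H S f g = Fin.all? (λ u → f (g u) Fin.≟ u) ×-dec
                     (Fin.all? (λ u → g (f u) Fin.≟ u) ×-dec
                      all²? (λ u v → adj? H u v ⇔? adj? S (f u) (f v)))

    ≅-via-resp : ∀ {H S} {f f′ g g′ : Fin n → Fin n} → (∀ u → f u ≡ f′ u) → (∀ u → g u ≡ g′ u) →
                 ≅-via H S f g → ≅-via H S f′ g′
    ≅-via-resp {H} {S} {f} {f′} {g} {g′} f≗ g≗ (fg , gf , iso) =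
        (λ u → trans (sym (trans (cong f (g≗ u)) (f≗ (g′ u)))) (fg u))
      , (λ u → trans (sym (trans (cong g (f≗ u)) (g≗ (f′ u)))) (gf u))
      , (λ u v → subst₂ (λ a b → Adj H u v ⇔ Adj S a b) (f≗ u) (f≗ v) (iso u v))

  _≅?_ : ∀ H S → Dec (H ≅ S)
  H ≅? S = map′ to from
    (Fin.any? λ a → Fin.any? λ b → ≅-via? H S (finToFun a) (finToFun b))
    where
    to : (∃[ a ] ∃[ b ] ≅-via H S (finToFun a) (finToFun b)) → H ≅ S
    to (a , b , fg , gf , iso) =
      permutation (finToFun a) (finToFun b) fg gf , iso
    from : H ≅ S → ∃[ a ] ∃[ b ] ≅-via H S (finToFun a) (finToFun b)
    from (π , iso) = funToFin (π ⟨$⟩ʳ_) , funToFin (π ⟨$⟩ˡ_) ,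
      ≅-via-resp {H} {S} (λ u → sym (Fin.finToFun-funToFin (π ⟨$⟩ʳ_) u))
                         (λ u → sym (Fin.finToFun-funToFin (π ⟨$⟩ˡ_) u))
                         ((λ _ → inverseʳ π) , (λ _ → inverseˡ π) , iso)

  _⊑?_ : ∀ H G → Dec (H ⊑ G)
  H ⊑? G = map′ (λ (s , p) → graph s , p) (λ (S , p) → bits S , p)
    (anySubset? λ s → (H ≅? graph s) ×-dec
                      all²? (λ u v → adj? (graph s) u v →-dec adj? G u v))

  f[_] : Graph n → Vec Bool (n C 2) → Bool
  f[ H ] x = does (H ⊑? graph x)

  Independent : Graph n → Subset n → Set
  Independent H S = ∀ u v → u ∈ S → v ∈ S → ¬ Adj H u v

  independent? : ∀ H S → Dec (Independent H S)
  independent? H S = all²? λ u v → (u ∈? S) →-dec ((v ∈? S) →-dec ¬? (adj? H u v))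

subsets : ∀ n → List (Subset n)
subsets zero    = [] ∷ []
subsets (suc n) = List.map (outside ∷_) (subsets n) ++ List.map (inside ∷_) (subsets n)

α : ∀ {n} → Graph n → ℕ
α {n} H = max 0 (List.map ∣_∣ (List.filter (independent? H) (subsets n)))

-- The real part of the inner product of the states reached on two inputs x, y
-- with f x ≠ f y must fall from 1 to at most 17/18, and by AM-GM one query
-- changes it by no more than a weighted sum of the probabilities of querying a
-- bit in which x and y differ.  Averaged over the edges between 0-inputs and
-- 1-inputs of a reparametrised Boolean cube, this gives m m′ ≤ (72 T)² when
-- every 0-input has m neighbours that are 1-inputs and every 1-input has m′
-- neighbours that are 0-inputs.
--
-- Let I be a maximum independent set of H, α = |I|, c = n − α, and let v₁ ∉ I
-- have the fewest neighbours in I, say d = α − s of them.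
--   * If α ≤ 8 c, delete all edges inside a vertex set of variable size: H
--     survives iff that set has at most α elements, so m = α + 1 and m′ = c.
--   * Otherwise put q = ⌊α / 16⌋ and let sets B, A of sizes q + 1, α − q host
--     the edges inside I ∪ {v₁}; all edges outside B ∪ A are present, and the
--     B-A edges vary.  H appears once some vertex of B has d neighbours in
--     B ∪ A.
--       If s ≥ 2 q, keep B independent and add edges to a maximal 0-input: every
--       vertex of B still misses more than q vertices of A, so m ≥ (q + 1)².
--       If s < 2 q, make B a clique.  When each vertex of B misses exactly
--       s + 1 vertices of A there is no room for H, because every vertex
--       outside I misses at most s vertices of I; restoring any B-A edge
--       creates H.  Here m = (q + 1)(s + 1) and m′ = α − q − s ≥ q + 1.

module Submission where

open import Defs
open import Data.Nat using (ℕ; _≤_; _*_)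
open import Data.Product using (Σ-syntax; _×_)
open import Algebra.Bundles using (CommutativeMonoid; CommutativeRing)
import Algebra.Properties.CommutativeMonoid.Sum as Sum
import Algebra.Properties.CommutativeSemigroup as CommutativeSemigroup
import Algebra.Properties.Semiring.Sum as SemiringSum
open import Algebra.Structures using (IsCommutativeRing)
open import Data.Bool.Base using (Bool; true; false; if_then_else_; not; _xor_; _∧_; _∨_)
import Data.Bool.Properties as Bool
open import Data.Empty using (⊥)
open import Data.Fin.Base using (Fin; zero; suc; toℕ; inject; Fin′; punchIn; combine; remQuot; splitAt; _↑ˡ_; _↑ʳ_)
open import Data.Fin.Permutation using (Permutation′; _⟨$⟩ʳ_; _⟨$⟩ˡ_; inverseˡ; inverseʳ; insert; insert-punchIn)
import Data.Fin.Permutation as Perm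
import Data.Fin.Properties as Fin
open import Data.Fin.Subset using (Subset; inside; outside; _∈_; ∣_∣)
open import Data.Integer.Base as ℤ using (+_)
import Data.Integer.Properties as ℤ
import Data.List.Base as List
import Data.List.Extrema.Nat as Extrema
import Data.List.Membership.Propositional as List
import Data.List.Membership.Propositional.Properties as List
import Data.List.Relation.Unary.All as All
import Data.List.Relation.Unary.Any as Any
open import Data.Nat.Base as ℕ using (zero; suc; _⊓_; z≤n; s≤s)
open import Data.Nat.Combinatorics using (_C_)
open import Data.Nat.DivMod using (m≡m%n+[m/n]*n; m%n<n; m/n*n≤m)
import Data.Nat.Properties as ℕ
open import Data.Nat.Tactic.RingSolver using (solve-∀)
open import Data.Product using (_,_; proj₁; proj₂; ∃-syntax; Σ)
open import Data.Rational.Base as ℚ using (ℚ; 0ℚ; 1ℚ; ½; _/_)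
import Data.Rational.Properties as ℚ
open import Data.Rational.Solver using (module +-*-Solver)
import Data.Rational.Unnormalised.Base as ℚᵘ
import Data.Rational.Unnormalised.Properties as ℚᵘ
open import Data.Sum using (_⊎_; inj₁; inj₂)
open import Data.Vec.Base as Vec using (Vec; []; _∷_; lookup; updateAt; tabulate)
import Data.Vec.Properties as Vec
open import Function.Base using (_∘_)
open import Function.Bundles using (Inverse; mk⇔; Equivalence)
open import Level using (0ℓ)
open import Relation.Binary.Bundles using (Preorder)
open import Relation.Binary.Core using (Rel)
open import Relation.Binary.Definitions using (DecidableEquality; tri<; tri≈; tri>)
open import Relation.Binary.PropositionalEquality using (_≡_; refl; sym; trans; cong; cong₂; subst; subst₂; module ≡-Reasoning; _≢_)
open import Relation.Binary.Structures using (IsEquivalence; IsPreorder)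
open import Relation.Nullary using (¬_; Dec; yes; no; does; contradiction; _×-dec_)
open import Relation.Nullary.Decidable using (dec-true; dec-false)

-- Real numbers

-- The vertex cube yields only α c up to constants. For a star c = 1, so it gives T of order √n
-- where order n is needed. When c is small the hardness must therefore come from edges: `B` offers
-- q + 1 possible images of v₁, so that of the order of α² edges matter instead of the α edges at
-- one centre.
--
-- The gap s decides which 0-inputs are useful. If s is large, a centre can miss many vertices, and
-- a single 0-input already has quadratically many 1-neighbours. If s is small, a centre lacks only
-- about s edges, so the 0-inputs must vary to make m′ of order α; moreover, with `B` independent
-- its vertices would have at most α - q neighbours in B ∪ A, fewer than d as soon as s < q, hence
-- the clique. Taking v₁ with fewest neighbours in I makes s a bound for every vertex outside I.
--
-- The AM-GM weights are natural numbers, so the averaged inequality can be settled in ℕ; the square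
-- root enters only at the end. The factor 72 is 2 · 36: 36 clears the gap 1 - 17/18 = 2/36, and 2
-- allows a bit of the input to depend on two cube variables.

pointwise-≈ : ∀ {x y} → (∀ k → seq x k ≡ seq y k) → x ≈ᵣ y
pointwise-≈ {x} {y} eq ε 0<ε = 0 , λ k _ →
  subst (ℚ._< ε) (cong ℚ.∣_∣ (trans (sym (ℚ.+-inverseʳ (seq y k)))
                                    (cong (ℚ._- seq y k) (sym (eq k))))) 0<ε

p≤p+ε : ∀ p {ε} → 0ℚ ℚ.< ε → p ℚ.≤ p ℚ.+ ε
p≤p+ε p {ε} 0<ε = subst (ℚ._≤ p ℚ.+ ε) (ℚ.+-identityʳ p) (ℚ.+-monoʳ-≤ p (ℚ.<⇒≤ 0<ε))

pointwise-≤ : ∀ {x y} → (∀ k → seq x k ℚ.≤ seq y k) → x ≤ᵣ y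
pointwise-≤ {x} {y} le ε 0<ε = 0 , λ k _ → ℚ.≤-trans (le k) (p≤p+ε (seq y k) 0<ε)

∣-∣-bound : ∀ {a b ε} → ℚ.∣ a ℚ.- b ∣ ℚ.< ε → a ℚ.≤ b ℚ.+ ε
∣-∣-bound {a} {b} {ε} lt = begin
  a                       ≡⟨ split a b ⟩
  b ℚ.+ (a ℚ.- b)         ≤⟨ ℚ.+-monoʳ-≤ b (p≤∣p∣ (a ℚ.- b)) ⟩
  b ℚ.+ ℚ.∣ a ℚ.- b ∣     ≤⟨ ℚ.+-monoʳ-≤ b (ℚ.<⇒≤ lt) ⟩
  b ℚ.+ ε                 ∎
  where
  open ℚ.≤-Reasoning
  open +-*-Solver
  split : ∀ a b → a ≡ b ℚ.+ (a ℚ.- b)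
  split = solve 2 (λ a b → a := b :+ (a :- b)) refl
  p≤∣p∣ : ∀ p → p ℚ.≤ ℚ.∣ p ∣
  p≤∣p∣ p with ℚ.≤-total 0ℚ p
  ... | inj₁ 0≤p = ℚ.≤-reflexive (sym (ℚ.0≤p⇒∣p∣≡p 0≤p))
  ... | inj₂ p≤0 = ℚ.≤-trans p≤0 (ℚ.0≤∣p∣ p)

≈ᵣ-sym : ∀ {x y} → x ≈ᵣ y → y ≈ᵣ x
≈ᵣ-sym {x} {y} x≈y ε 0<ε with x≈y ε 0<ε
... | N , p = N , λ k k≥ → subst (ℚ._< ε) (flip (seq x k) (seq y k)) (p k k≥)
  where
  flip : ∀ a b → ℚ.∣ a ℚ.- b ∣ ≡ ℚ.∣ b ℚ.- a ∣
  flip a b = trans (sym (ℚ.∣-p∣≡∣p∣ (a ℚ.- b))) (cong ℚ.∣_∣ (neg a b))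
    where
    open +-*-Solver
    neg : ∀ a b → ℚ.- (a ℚ.- b) ≡ b ℚ.- a
    neg = solve 2 (λ a b → :- (a :- b) := b :- a) refl

+-cong-lt : ∀ {ε} a b c d → ℚ.∣ a ℚ.- b ∣ ℚ.< ½ ℚ.* ε → ℚ.∣ c ℚ.- d ∣ ℚ.< ½ ℚ.* ε →
            ℚ.∣ (a ℚ.+ c) ℚ.- (b ℚ.+ d) ∣ ℚ.< ε
+-cong-lt {ε} a b c d p q = begin-strict
  ℚ.∣ (a ℚ.+ c) ℚ.- (b ℚ.+ d) ∣          ≡⟨ cong ℚ.∣_∣ (regroup a b c d) ⟩
  ℚ.∣ (a ℚ.- b) ℚ.+ (c ℚ.- d) ∣          ≤⟨ ℚ.∣p+q∣≤∣p∣+∣q∣ (a ℚ.- b) (c ℚ.- d) ⟩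
  ℚ.∣ a ℚ.- b ∣ ℚ.+ ℚ.∣ c ℚ.- d ∣        <⟨ ℚ.+-mono-< p q ⟩
  ½ ℚ.* ε ℚ.+ ½ ℚ.* ε                    ≡⟨ half+half ε ⟩
  ε                                      ∎
  where
  open ℚ.≤-Reasoning
  open +-*-Solver
  regroup : ∀ a b c d → (a ℚ.+ c) ℚ.- (b ℚ.+ d) ≡ (a ℚ.- b) ℚ.+ (c ℚ.- d)
  regroup = solve 4 (λ a b c d → (a :+ c) :- (b :+ d) := (a :- b) :+ (c :- d)) refl

≈ᵣ-trans : ∀ {x y z} → x ≈ᵣ y → y ≈ᵣ z → x ≈ᵣ z
≈ᵣ-trans {x} {y} {z} x≈y y≈z ε 0<ε
  with x≈y (½ ℚ.* ε) (half-pos 0<ε) | y≈z (½ ℚ.* ε) (half-pos 0<ε)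
... | M , p | N , q = M ℕ.⊔ N , λ k k≥ →
  subst (ℚ._< ε) (cong ℚ.∣_∣ (cancel (seq x k) (seq y k) (seq z k)))
    (+-cong-lt (seq x k) (seq y k) (seq y k) (seq z k)
      (p k (ℕ.m⊔n≤o⇒m≤o M N k≥)) (q k (ℕ.m⊔n≤o⇒n≤o M N k≥)))
  where
  open +-*-Solver
  cancel : ∀ a b c → (a ℚ.+ b) ℚ.- (b ℚ.+ c) ≡ a ℚ.- c
  cancel = solve 3 (λ a b c → (a :+ b) :- (b :+ c) := a :- c) refl

+ᵣ-cong : ∀ {x x′ y y′} → x ≈ᵣ x′ → y ≈ᵣ y′ → x +ᵣ y ≈ᵣ x′ +ᵣ y′
+ᵣ-cong {x} {x′} {y} {y′} p q ε 0<ε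
  with p (½ ℚ.* ε) (half-pos 0<ε) | q (½ ℚ.* ε) (half-pos 0<ε)
... | M , p′ | N , q′ = M ℕ.⊔ N , λ k k≥ →
  +-cong-lt (seq x k) (seq x′ k) (seq y k) (seq y′ k)
    (p′ k (ℕ.m⊔n≤o⇒m≤o M N k≥)) (q′ k (ℕ.m⊔n≤o⇒n≤o M N k≥))

neg-lt : ∀ {ε} a b → ℚ.∣ a ℚ.- b ∣ ℚ.< ε → ℚ.∣ ℚ.- a ℚ.- ℚ.- b ∣ ℚ.< ε
neg-lt {ε} a b = subst (ℚ._< ε)
  (trans (sym (ℚ.∣-p∣≡∣p∣ (a ℚ.- b))) (cong ℚ.∣_∣ (ℚ.neg-distrib-+ a (ℚ.- b))))

-ᵣ-cong : ∀ {x y} → x ≈ᵣ y → -ᵣ x ≈ᵣ -ᵣ y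
-ᵣ-cong {x} {y} x≈y ε 0<ε =
  let N , p = x≈y ε 0<ε in N , λ k k≥ → neg-lt (seq x k) (seq y k) (p k k≥)

*ᵣ-cong : ∀ {x x′ y y′} → x ≈ᵣ x′ → y ≈ᵣ y′ → x *ᵣ y ≈ᵣ x′ *ᵣ y′
*ᵣ-cong {x} {x′} {y} {y′} p q ε 0<ε =
  let A , A>0 , K , x≤A = bounded {seq x} (cauchy x)
      B , B>0 , L , y≤B = bounded {seq y′} (cauchy y′)
      δ , 0<δ , small   = scale A {{A>0}} (half-pos 0<ε)
      η , 0<η , small′  = scale B {{B>0}} (half-pos 0<ε)
      M , q′            = q δ 0<δ
      N , p′            = p η 0<η
  in (K ℕ.⊔ L) ℕ.⊔ (M ℕ.⊔ N) , λ k k≥ →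
  let k≥KL = ℕ.m⊔n≤o⇒m≤o (K ℕ.⊔ L) (M ℕ.⊔ N) k≥
      k≥MN = ℕ.m⊔n≤o⇒n≤o (K ℕ.⊔ L) (M ℕ.⊔ N) k≥
  in *-close ε (seq x k) (seq y k) (seq x′ k) (seq y′ k)
       (small {seq x k} {seq y k ℚ.- seq y′ k} (x≤A k (ℕ.m⊔n≤o⇒m≤o K L k≥KL))
         (q′ k (ℕ.m⊔n≤o⇒m≤o M N k≥MN)))
       (small′ {seq y′ k} {seq x k ℚ.- seq x′ k} (y≤B k (ℕ.m⊔n≤o⇒n≤o K L k≥KL))
         (p′ k (ℕ.m⊔n≤o⇒n≤o M N k≥MN)))

-- Wrapping the relations in records lets Agda infer the related numbers.
infix 4 _≃_ _≲_

record _≃_ (x y : ℝ) : Set where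
  constructor mk≃
  field
    unwrap-≃ : x ≈ᵣ y
open _≃_ public

record _≲_ (x y : ℝ) : Set where
  constructor mk≲
  field
    unwrap-≲ : x ≤ᵣ y
open _≲_ public

pointwise-≃ : ∀ {x y} → (∀ k → seq x k ≡ seq y k) → x ≃ y
pointwise-≃ {x} {y} p = mk≃ (pointwise-≈ {x} {y} p)

pointwise-≲ : ∀ {x y} → (∀ k → seq x k ℚ.≤ seq y k) → x ≲ y
pointwise-≲ {x} {y} p = mk≲ (pointwise-≤ {x} {y} p)

≃-refl : ∀ {x} → x ≃ x
≃-refl {x} = pointwise-≃ λ _ → refl

≃-isEquivalence : IsEquivalence _≃_
≃-isEquivalence = record
  { refl  = ≃-refl
  ; sym   = λ { {x} {y} (mk≃ p) → mk≃ (≈ᵣ-sym {x} {y} p) }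
  ; trans = λ { {x} {y} {z} (mk≃ p) (mk≃ q) → mk≃ (≈ᵣ-trans {x} {y} {z} p q) }
  }

+ᵣ-cong-≃ : ∀ {x x′ y y′} → x ≃ x′ → y ≃ y′ → x +ᵣ y ≃ x′ +ᵣ y′
+ᵣ-cong-≃ {x} {x′} {y} {y′} (mk≃ p) (mk≃ q) = mk≃ (+ᵣ-cong {x} {x′} {y} {y′} p q)

*ᵣ-cong-≃ : ∀ {x x′ y y′} → x ≃ x′ → y ≃ y′ → x *ᵣ y ≃ x′ *ᵣ y′
*ᵣ-cong-≃ {x} {x′} {y} {y′} (mk≃ p) (mk≃ q) = mk≃ (*ᵣ-cong {x} {x′} {y} {y′} p q)

-ᵣ-cong-≃ : ∀ {x y} → x ≃ y → -ᵣ x ≃ -ᵣ y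
-ᵣ-cong-≃ {x} {y} (mk≃ p) = mk≃ (-ᵣ-cong {x} {y} p)

ℝ-isCommutativeRing : IsCommutativeRing _≃_ _+ᵣ_ _*ᵣ_ -ᵣ_ 0ᵣ 1ᵣ
ℝ-isCommutativeRing = record
  { isRing = record
    { +-isAbelianGroup = record
      { isGroup = record
        { isMonoid = record
          { isSemigroup = record
            { isMagma = record { isEquivalence = ≃-isEquivalence ; ∙-cong = +ᵣ-cong-≃ }
            ; assoc = λ x y z → pointwise-≃ λ k → ℚ.+-assoc (seq x k) (seq y k) (seq z k)
            }
          ; identity = (λ x → pointwise-≃ λ k → ℚ.+-identityˡ (seq x k))
                     , (λ x → pointwise-≃ λ k → ℚ.+-identityʳ (seq x k))
          }
        ; inverse = (λ x → pointwise-≃ λ k → ℚ.+-inverseˡ (seq x k))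
                  , (λ x → pointwise-≃ λ k → ℚ.+-inverseʳ (seq x k))
        ; ⁻¹-cong = -ᵣ-cong-≃
        }
      ; comm = λ x y → pointwise-≃ λ k → ℚ.+-comm (seq x k) (seq y k)
      }
    ; *-cong = *ᵣ-cong-≃
    ; *-assoc = λ x y z → pointwise-≃ λ k → ℚ.*-assoc (seq x k) (seq y k) (seq z k)
    ; *-identity = (λ x → pointwise-≃ λ k → ℚ.*-identityˡ (seq x k))
                 , (λ x → pointwise-≃ λ k → ℚ.*-identityʳ (seq x k))
    ; distrib = (λ x y z → pointwise-≃ λ k → ℚ.*-distribˡ-+ (seq x k) (seq y k) (seq z k))
              , (λ x y z → pointwise-≃ λ k → ℚ.*-distribʳ-+ (seq x k) (seq y k) (seq z k))
    }
  ; *-comm = λ x y → pointwise-≃ λ k → ℚ.*-comm (seq x k) (seq y k)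
  }

ℝ-commutativeRing : CommutativeRing 0ℓ 0ℓ
ℝ-commutativeRing = record { isCommutativeRing = ℝ-isCommutativeRing }

module Real = CommutativeRing ℝ-commutativeRing

≈ᵣ⇒≤ᵣ : ∀ {x y} → x ≈ᵣ y → x ≤ᵣ y
≈ᵣ⇒≤ᵣ {x} {y} x≈y ε 0<ε with x≈y ε 0<ε
... | N , p = N , λ k k≥ → ∣-∣-bound (p k k≥)

≤-half : ∀ {ε a b c} → a ℚ.≤ b ℚ.+ ½ ℚ.* ε → b ℚ.≤ c ℚ.+ ½ ℚ.* ε → a ℚ.≤ c ℚ.+ ε
≤-half {ε} {a} {b} {c} p q = begin
  a                                ≤⟨ p ⟩
  b ℚ.+ ½ ℚ.* ε                    ≤⟨ ℚ.+-monoˡ-≤ (½ ℚ.* ε) q ⟩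
  c ℚ.+ ½ ℚ.* ε ℚ.+ ½ ℚ.* ε        ≡⟨ ℚ.+-assoc c (½ ℚ.* ε) (½ ℚ.* ε) ⟩
  c ℚ.+ (½ ℚ.* ε ℚ.+ ½ ℚ.* ε)      ≡⟨ cong (c ℚ.+_) (half+half ε) ⟩
  c ℚ.+ ε                          ∎
  where open ℚ.≤-Reasoning

≤ᵣ-trans : ∀ {x y z} → x ≤ᵣ y → y ≤ᵣ z → x ≤ᵣ z
≤ᵣ-trans {x} {y} {z} x≤y y≤z ε 0<ε
  with x≤y (½ ℚ.* ε) (half-pos 0<ε) | y≤z (½ ℚ.* ε) (half-pos 0<ε)
... | M , p | N , q = M ℕ.⊔ N , λ k k≥ →
  ≤-half {ε} {seq x k} {seq y k} {seq z k} (p k (ℕ.m⊔n≤o⇒m≤o M N k≥)) (q k (ℕ.m⊔n≤o⇒n≤o M N k≥))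

+ᵣ-mono-≤ : ∀ {x x′ y y′} → x ≤ᵣ x′ → y ≤ᵣ y′ → x +ᵣ y ≤ᵣ x′ +ᵣ y′
+ᵣ-mono-≤ {x} {x′} {y} {y′} p q ε 0<ε
  with p (½ ℚ.* ε) (half-pos 0<ε) | q (½ ℚ.* ε) (half-pos 0<ε)
... | M , p′ | N , q′ = M ℕ.⊔ N , λ k k≥ → begin
  seq x k ℚ.+ seq y k
    ≤⟨ ℚ.+-mono-≤ (p′ k (ℕ.m⊔n≤o⇒m≤o M N k≥)) (q′ k (ℕ.m⊔n≤o⇒n≤o M N k≥)) ⟩
  (seq x′ k ℚ.+ ½ ℚ.* ε) ℚ.+ (seq y′ k ℚ.+ ½ ℚ.* ε)
    ≡⟨ regroup (seq x′ k) (seq y′ k) (½ ℚ.* ε) ⟩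
  seq x′ k ℚ.+ seq y′ k ℚ.+ (½ ℚ.* ε ℚ.+ ½ ℚ.* ε)
    ≡⟨ cong (seq x′ k ℚ.+ seq y′ k ℚ.+_) (half+half ε) ⟩
  seq x′ k ℚ.+ seq y′ k ℚ.+ ε
    ∎
  where
  open ℚ.≤-Reasoning
  open +-*-Solver
  regroup : ∀ a b h → (a ℚ.+ h) ℚ.+ (b ℚ.+ h) ≡ a ℚ.+ b ℚ.+ (h ℚ.+ h)
  regroup = solve 3 (λ a b h → (a :+ h) :+ (b :+ h) := a :+ b :+ (h :+ h)) refl

≲-isPreorder : IsPreorder _≃_ _≲_
≲-isPreorder = record
  { isEquivalence = ≃-isEquivalence
  ; reflexive     = λ { {x} {y} (mk≃ p) → mk≲ (≈ᵣ⇒≤ᵣ {x} {y} p) }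
  ; trans         = λ { {x} {y} {z} (mk≲ p) (mk≲ q) → mk≲ (≤ᵣ-trans {x} {y} {z} p q) }
  }

module ≲ = IsPreorder ≲-isPreorder

+ᵣ-mono : ∀ {x x′ y y′} → x ≲ x′ → y ≲ y′ → x +ᵣ y ≲ x′ +ᵣ y′
+ᵣ-mono {x} {x′} {y} {y′} (mk≲ p) (mk≲ q) = mk≲ (+ᵣ-mono-≤ {x} {x′} {y} {y′} p q)

≲-preorder : Preorder 0ℓ 0ℓ 0ℓ
≲-preorder = record { isPreorder = ≲-isPreorder }

module ≲-Reasoning where
  open import Relation.Binary.Reasoning.Preorder ≲-preorder public

-- Natural numbers among the rationals and reals

_/1 : ℕ → ℚ
n /1 = + n / 1

/1-homo-+ : ∀ m n → (m ℕ.+ n) /1 ≡ m /1 ℚ.+ n /1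
/1-homo-+ m n = ℚ.toℚᵘ-injective (begin
  ℚ.toℚᵘ ((m ℕ.+ n) /1)                   ≈⟨ ℚ.toℚᵘ-fromℚᵘ (ℚᵘ.mkℚᵘ (+ (m ℕ.+ n)) 0) ⟩
  ℚᵘ.mkℚᵘ (+ (m ℕ.+ n)) 0                 ≈⟨ ℚᵘ.*≡* (cong (ℤ._* (+ 1)) (cong₂ ℤ._+_ (sym (ℤ.*-identityʳ (+ m))) (sym (ℤ.*-identityʳ (+ n))))) ⟩
  ℚᵘ.mkℚᵘ (+ m) 0 ℚᵘ.+ ℚᵘ.mkℚᵘ (+ n) 0    ≈⟨ ℚᵘ.+-cong (ℚ.toℚᵘ-fromℚᵘ (ℚᵘ.mkℚᵘ (+ m) 0)) (ℚ.toℚᵘ-fromℚᵘ (ℚᵘ.mkℚᵘ (+ n) 0)) ⟨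
  ℚ.toℚᵘ (m /1) ℚᵘ.+ ℚ.toℚᵘ (n /1)        ≈⟨ ℚ.toℚᵘ-homo-+ (m /1) (n /1) ⟨
  ℚ.toℚᵘ (m /1 ℚ.+ n /1)                  ∎)
  where open import Relation.Binary.Reasoning.Setoid ℚᵘ.≃-setoid

/1-mono-≤ : ∀ {m n} → m ≤ n → m /1 ℚ.≤ n /1
/1-mono-≤ {m} {n} m≤n = ℚ.toℚᵘ-cancel-≤ (begin
  ℚ.toℚᵘ (m /1)     ≃⟨ ℚ.toℚᵘ-fromℚᵘ (ℚᵘ.mkℚᵘ (+ m) 0) ⟩
  ℚᵘ.mkℚᵘ (+ m) 0   ≤⟨ ℚᵘ.*≤* (ℤ.*-monoʳ-≤-nonNeg (+ 1) (ℤ.+≤+ m≤n)) ⟩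
  ℚᵘ.mkℚᵘ (+ n) 0   ≃⟨ ℚ.toℚᵘ-fromℚᵘ (ℚᵘ.mkℚᵘ (+ n) 0) ⟨
  ℚ.toℚᵘ (n /1)     ∎)
  where open ℚᵘ.≤-Reasoning

/1-homo-* : ∀ m n → (m * n) /1 ≡ m /1 ℚ.* n /1
/1-homo-* zero    n = sym (ℚ.*-zeroˡ (n /1))
/1-homo-* (suc m) n = begin
  (n ℕ.+ m * n) /1                      ≡⟨ /1-homo-+ n (m * n) ⟩
  n /1 ℚ.+ (m * n) /1                   ≡⟨ cong (n /1 ℚ.+_) (/1-homo-* m n) ⟩
  n /1 ℚ.+ m /1 ℚ.* n /1                ≡⟨ cong (ℚ._+ m /1 ℚ.* n /1) (ℚ.*-identityˡ (n /1)) ⟨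
  1ℚ ℚ.* n /1 ℚ.+ m /1 ℚ.* n /1         ≡⟨ ℚ.*-distribʳ-+ (n /1) 1ℚ (m /1) ⟨
  (1ℚ ℚ.+ m /1) ℚ.* n /1                ≡⟨ cong (ℚ._* n /1) (/1-homo-+ 1 m) ⟨
  suc m /1 ℚ.* n /1                     ∎
  where open ≡-Reasoning

-- An error of `½` decides it: if `m` exceeded `n`, it would do so by at least 1. This brings the
-- averaged inequality back from ℝ to ℕ.
fromℕ-cancel-≤ : ∀ {m n} → fromℕ m ≲ fromℕ n → m ≤ n
fromℕ-cancel-≤ {m} {n} (mk≲ m≲n) with m ℕ.≤? n
... | yes m≤n = m≤n
... | no  m≰n = contradiction (begin-strict
  m /1            ≤⟨ proj₂ (m≲n ½ (ℚ.positive⁻¹ ½)) _ ℕ.≤-refl ⟩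
  n /1 ℚ.+ ½      <⟨ ℚ.+-monoʳ-< (n /1) (ℚ.*<* (ℤ.+<+ (ℕ.s≤s (ℕ.s≤s ℕ.z≤n)))) ⟩
  n /1 ℚ.+ 1ℚ     ≡⟨ /1-homo-+ n 1 ⟨
  (n ℕ.+ 1) /1    ≤⟨ /1-mono-≤ (subst (_≤ m) (ℕ.+-comm 1 n) (ℕ.≰⇒> m≰n)) ⟩
  m /1            ∎) (ℚ.<-irrefl refl)
  where open ℚ.≤-Reasoning

fromℕ-homo-+ : ∀ m n → fromℕ (m ℕ.+ n) ≃ fromℕ m +ᵣ fromℕ n
fromℕ-homo-+ m n = pointwise-≃ λ _ → /1-homo-+ m n

fromℕ-homo-* : ∀ m n → fromℕ (m * n) ≃ fromℕ m *ᵣ fromℕ n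
fromℕ-homo-* m n = pointwise-≃ λ _ → /1-homo-* m n

fromℕ-suc-* : ∀ n x → fromℕ (suc n) *ᵣ x ≃ x +ᵣ fromℕ n *ᵣ x
fromℕ-suc-* n x = pointwise-≃ λ k →
  trans (cong (ℚ._* seq x k) (/1-homo-+ 1 n))
    (trans (ℚ.*-distribʳ-+ (seq x k) 1ℚ (n /1))
           (cong (ℚ._+ n /1 ℚ.* seq x k) (ℚ.*-identityˡ (seq x k))))

-- Induction on `n` turns scaling into repeated addition, so `ε` need not be rescaled.
fromℕ*-mono : ∀ n {x y} → x ≲ y → fromℕ n *ᵣ x ≲ fromℕ n *ᵣ y
fromℕ*-mono zero {x} {y} _ = pointwise-≲ λ k →
  ℚ.≤-reflexive (trans (ℚ.*-zeroˡ (seq x k)) (sym (ℚ.*-zeroˡ (seq y k))))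
fromℕ*-mono (suc n) {x} {y} x≲y = begin
  fromℕ (suc n) *ᵣ x     ≈⟨ fromℕ-suc-* n x ⟩
  x +ᵣ fromℕ n *ᵣ x      ≲⟨ +ᵣ-mono x≲y (fromℕ*-mono n x≲y) ⟩
  y +ᵣ fromℕ n *ᵣ y      ≈⟨ fromℕ-suc-* n y ⟨
  fromℕ (suc n) *ᵣ y     ∎
  where open ≲-Reasoning

-- Complex numbers

infix 4 _≃ᶜ_

record _≃ᶜ_ (z w : ℂ) : Set where
  constructor _+i_
  field
    re-≃ : re z ≃ re w
    im-≃ : im z ≃ im w
open _≃ᶜ_ public

pointwise-≃ᶜ : ∀ {z w} → (∀ k → seq (re z) k ≡ seq (re w) k) →
               (∀ k → seq (im z) k ≡ seq (im w) k) → z ≃ᶜ w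
pointwise-≃ᶜ p q = pointwise-≃ p +i pointwise-≃ q

module _ where
  open +-*-Solver

  private
    mul-re mul-im : ∀ {m} → Polynomial m → Polynomial m → Polynomial m → Polynomial m → Polynomial m
    mul-re a b c d = a :* c :- b :* d
    mul-im a b c d = a :* d :+ b :* c

  *ᶜ-assoc : ∀ x y z → (x *ᶜ y) *ᶜ z ≃ᶜ x *ᶜ (y *ᶜ z)
  *ᶜ-assoc x y z = pointwise-≃ᶜ
    (λ k → solve 6 (λ a b c d e f →
       mul-re (mul-re a b c d) (mul-im a b c d) e f := mul-re a b (mul-re c d e f) (mul-im c d e f)) refl
       (seq (re x) k) (seq (im x) k) (seq (re y) k) (seq (im y) k) (seq (re z) k) (seq (im z) k))
    (λ k → solve 6 (λ a b c d e f →
       mul-im (mul-re a b c d) (mul-im a b c d) e f := mul-im a b (mul-re c d e f) (mul-im c d e f)) refl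
       (seq (re x) k) (seq (im x) k) (seq (re y) k) (seq (im y) k) (seq (re z) k) (seq (im z) k))

  *ᶜ-comm : ∀ x y → x *ᶜ y ≃ᶜ y *ᶜ x
  *ᶜ-comm x y = pointwise-≃ᶜ
    (λ k → solve 4 (λ a b c d → mul-re a b c d := mul-re c d a b) refl
       (seq (re x) k) (seq (im x) k) (seq (re y) k) (seq (im y) k))
    (λ k → solve 4 (λ a b c d → mul-im a b c d := mul-im c d a b) refl
       (seq (re x) k) (seq (im x) k) (seq (re y) k) (seq (im y) k))

  *ᶜ-distribʳ-+ᶜ : ∀ x y z → (y +ᶜ z) *ᶜ x ≃ᶜ y *ᶜ x +ᶜ z *ᶜ x
  *ᶜ-distribʳ-+ᶜ x y z = pointwise-≃ᶜ
    (λ k → solve 6 (λ e f a b c d → mul-re (a :+ c) (b :+ d) e f := mul-re a b e f :+ mul-re c d e f) refl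
       (seq (re x) k) (seq (im x) k) (seq (re y) k) (seq (im y) k) (seq (re z) k) (seq (im z) k))
    (λ k → solve 6 (λ e f a b c d → mul-im (a :+ c) (b :+ d) e f := mul-im a b e f :+ mul-im c d e f) refl
       (seq (re x) k) (seq (im x) k) (seq (re y) k) (seq (im y) k) (seq (re z) k) (seq (im z) k))

  *ᶜ-identityˡ : ∀ x → 1ᶜ *ᶜ x ≃ᶜ x
  *ᶜ-identityˡ x = pointwise-≃ᶜ
    (λ k → solve 2 (λ a b → mul-re (con 1ℚ) (con 0ℚ) a b := a) refl (seq (re x) k) (seq (im x) k))
    (λ k → solve 2 (λ a b → mul-im (con 1ℚ) (con 0ℚ) a b := b) refl (seq (re x) k) (seq (im x) k))

  conj-*ᶜ : ∀ x y → conj (x *ᶜ y) ≃ᶜ conj x *ᶜ conj y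
  conj-*ᶜ x y = pointwise-≃ᶜ
    (λ k → solve 4 (λ a b c d → mul-re a b c d := mul-re a (:- b) c (:- d)) refl
       (seq (re x) k) (seq (im x) k) (seq (re y) k) (seq (im y) k))
    (λ k → solve 4 (λ a b c d → :- mul-im a b c d := mul-im a (:- b) c (:- d)) refl
       (seq (re x) k) (seq (im x) k) (seq (re y) k) (seq (im y) k))

  conj-+ᶜ : ∀ x y → conj (x +ᶜ y) ≃ᶜ conj x +ᶜ conj y
  conj-+ᶜ x y = pointwise-≃ᶜ (λ _ → refl) (λ k → ℚ.neg-distrib-+ (seq (im x) k) (seq (im y) k))

≃ᶜ-refl : ∀ {z} → z ≃ᶜ z
≃ᶜ-refl = ≃-refl +i ≃-refl

≃ᶜ-trans : ∀ {x y z} → x ≃ᶜ y → y ≃ᶜ z → x ≃ᶜ z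
≃ᶜ-trans (p +i q) (p′ +i q′) = Real.trans p p′ +i Real.trans q q′

ℂ-isCommutativeRing : IsCommutativeRing _≃ᶜ_ _+ᶜ_ _*ᶜ_ negᶜ 0ᶜ 1ᶜ
ℂ-isCommutativeRing = record
  { isRing = record
    { +-isAbelianGroup = record
      { isGroup = record
        { isMonoid = record
          { isSemigroup = record
            { isMagma = record
              { isEquivalence = record
                { refl  = ≃ᶜ-refl
                ; sym   = λ (p +i q) → Real.sym p +i Real.sym q
                ; trans = ≃ᶜ-trans
                }
              ; ∙-cong = λ (p +i q) (p′ +i q′) → Real.+-cong p p′ +i Real.+-cong q q′
              }
            ; assoc = λ x y z → Real.+-assoc (re x) (re y) (re z) +i Real.+-assoc (im x) (im y) (im z)
            }
          ; identity = (λ x → Real.+-identityˡ (re x) +i Real.+-identityˡ (im x))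
                     , (λ x → Real.+-identityʳ (re x) +i Real.+-identityʳ (im x))
          }
        ; inverse = (λ x → Real.-‿inverseˡ (re x) +i Real.-‿inverseˡ (im x))
                  , (λ x → Real.-‿inverseʳ (re x) +i Real.-‿inverseʳ (im x))
        ; ⁻¹-cong = λ (p +i q) → Real.-‿cong p +i Real.-‿cong q
        }
      ; comm = λ x y → Real.+-comm (re x) (re y) +i Real.+-comm (im x) (im y)
      }
    ; *-cong = λ (p +i q) (p′ +i q′) →
        Real.+-cong (Real.*-cong p p′) (Real.-‿cong (Real.*-cong q q′)) +i Real.+-cong (Real.*-cong p q′) (Real.*-cong q p′)
    ; *-assoc = *ᶜ-assoc
    ; *-identity = *ᶜ-identityˡ
                 , λ x → ≃ᶜ-trans (*ᶜ-comm x 1ᶜ) (*ᶜ-identityˡ x)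
    ; distrib = (λ x y z → ≃ᶜ-trans (*ᶜ-comm x (y +ᶜ z))
                   (≃ᶜ-trans (*ᶜ-distribʳ-+ᶜ x y z) (+-cong′ (*ᶜ-comm y x) (*ᶜ-comm z x))))
              , *ᶜ-distribʳ-+ᶜ
    }
  ; *-comm = *ᶜ-comm
  }
  where
  +-cong′ : ∀ {x x′ y y′} → x ≃ᶜ x′ → y ≃ᶜ y′ → x +ᶜ y ≃ᶜ x′ +ᶜ y′
  +-cong′ (p +i q) (p′ +i q′) = Real.+-cong p p′ +i Real.+-cong q q′

ℂ-commutativeRing : CommutativeRing 0ℓ 0ℓ
ℂ-commutativeRing = record { isCommutativeRing = ℂ-isCommutativeRing }

module Complex = CommutativeRing ℂ-commutativeRing

conj-cong : ∀ {z w} → z ≃ᶜ w → conj z ≃ᶜ conj w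
conj-cong (p +i q) = p +i -ᵣ-cong-≃ q

-- Sums over basis states in a commutative ring

module BasisSum (R : CommutativeRing 0ℓ 0ℓ) {N W : ℕ} where
  open CommutativeRing R hiding (refl; sym; trans; zero) renaming (_*_ to infixl 7 _∗_)
  private module ≈ = CommutativeRing R
  open SemiringSum semiring
  open import Relation.Binary.Reasoning.Setoid setoid

  -- Over ℝ and ℂ this unfolds to `∑ᵣ` and `∑ᶜ`, so each rule proved here serves both.
  ∑ : (Basis N W → Carrier) → Carrier
  ∑ g = sum λ i → sum λ w → g (i , w)

  ∑-cong : ∀ {f g} → (∀ a → f a ≈ g a) → ∑ f ≈ ∑ g
  ∑-cong f≈g = sum-cong-≋ λ i → sum-cong-≋ λ w → f≈g (i , w)

  ∑-+ : ∀ f g → ∑ (λ a → f a + g a) ≈ ∑ f + ∑ g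
  ∑-+ f g = ≈.trans (sum-cong-≋ λ i → ∑-distrib-+ (λ w → f (i , w)) (λ w → g (i , w)))
                    (∑-distrib-+ (λ i → sum λ w → f (i , w)) (λ i → sum λ w → g (i , w)))

  *-∑ : ∀ x f → x ∗ ∑ f ≈ ∑ (λ a → x ∗ f a)
  *-∑ x f = ≈.trans (*-distribˡ-sum x (λ i → sum λ w → f (i , w)))
                    (sum-cong-≋ λ i → *-distribˡ-sum x (λ w → f (i , w)))

  ∑-* : ∀ x f → ∑ f ∗ x ≈ ∑ (λ a → f a ∗ x)
  ∑-* x f = ≈.trans (*-distribʳ-sum x (λ i → sum λ w → f (i , w)))
                    (sum-cong-≋ λ i → *-distribʳ-sum x (λ w → f (i , w)))

  ∑-sum : ∀ {n} (f : Basis N W → Fin n → Carrier) →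
          ∑ (λ a → sum (f a)) ≈ sum λ k → ∑ λ a → f a k
  ∑-sum f = ≈.trans (sum-cong-≋ λ i → ∑-comm (λ w → f (i , w)))
                    (∑-comm λ i k → sum λ w → f (i , w) k)

  ∑-swap : (f : Basis N W → Basis N W → Carrier) →
           (∑ λ a → ∑ λ b → f a b) ≈ (∑ λ b → ∑ λ a → f a b)
  ∑-swap f = ≈.trans (∑-sum λ a i → sum λ w → f a (i , w))
                     (sum-cong-≋ λ i → ∑-sum λ a w → f a (i , w))

  sum-zero : ∀ {n} (f : Fin n → Carrier) → (∀ j → f j ≈ 0#) → sum f ≈ 0#
  sum-zero {zero}  f f≈0 = ≈.refl
  sum-zero {suc n} f f≈0 = ≈.trans (+-cong (f≈0 zero) (sum-zero (f ∘ suc) (f≈0 ∘ suc))) (+-identityˡ 0#)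

  sum-single : ∀ {n} (i : Fin n) f → (∀ j → i ≢ j → f j ≈ 0#) → sum f ≈ f i
  sum-single zero f f≈0 = ≈.trans
    (+-congˡ (sum-zero (f ∘ suc) λ j → f≈0 (suc j) λ ())) (+-identityʳ (f zero))
  sum-single (suc i) f f≈0 = ≈.trans
    (+-cong (f≈0 zero λ ()) (sum-single i (f ∘ suc) λ j i≢j → f≈0 (suc j) λ { refl → i≢j refl }))
    (+-identityˡ (f (suc i)))

  ∑-single : ∀ a f → (∀ b → a ≢ b → f b ≈ 0#) → ∑ f ≈ f a
  ∑-single (i , w) f f≈0 = ≈.trans
    (sum-single i (λ j → sum λ v → f (j , v)) λ j i≢j →
      sum-zero (λ v → f (j , v)) λ v → f≈0 (j , v) λ { refl → i≢j refl })
    (sum-single w (λ v → f (i , v)) λ v w≢v → f≈0 (i , v) λ { refl → w≢v refl })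

-- Unitary matrices preserve inner products

module IsometryOver (R : CommutativeRing 0ℓ 0ℓ) where

  open CommutativeRing R
    using (Carrier; _≈_; _+_; 0#; setoid; semiring; *-congʳ; +-congˡ; *-commutativeSemigroup)
    renaming (_*_ to infixl 7 _∗_)
  private module ≈ = CommutativeRing R
  open SemiringSum semiring using (sum; sum-cong-≋)
  open CommutativeSemigroup *-commutativeSemigroup using (interchange)

  module Conjugation (conj : Carrier → Carrier)
    (conj-cong : ∀ {x y} → x ≈ y → conj x ≈ conj y)
    (conj-0 : conj 0# ≈ 0#)
    (conj-+ : ∀ x y → conj (x + y) ≈ conj x + conj y)
    (conj-∗ : ∀ x y → conj (x ∗ y) ≈ conj x ∗ conj y)
    {N W : ℕ} where

    open BasisSum R {N} {W}
    open import Relation.Binary.Reasoning.Setoid setoid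

    conj-sum : ∀ {n} (f : Fin n → Carrier) → conj (sum f) ≈ sum (conj ∘ f)
    conj-sum {zero}  f = conj-0
    conj-sum {suc n} f = ≈.trans (conj-+ (f zero) (sum (f ∘ suc))) (+-congˡ (conj-sum (f ∘ suc)))

    conj-∑ : ∀ f → conj (∑ f) ≈ ∑ (conj ∘ f)
    conj-∑ f = ≈.trans (conj-sum λ i → sum λ w → f (i , w)) (sum-cong-≋ λ i → conj-sum λ w → f (i , w))

    inner : (ψ φ : Basis N W → Carrier) → Carrier
    inner ψ φ = ∑ λ a → conj (ψ a) ∗ φ a

    apply : (Basis N W → Basis N W → Carrier) → (Basis N W → Carrier) → Basis N W → Carrier
    apply U ψ a = ∑ λ b → U a b ∗ ψ b

    -- Expanding gives a triple sum over `a`, `b`, `c`. Once the sum over `a` is innermost, it is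
    -- the entry of U†U at (b, c) and collapses to `I`, which is known here only through its action
    -- on vectors.
    inner-isometry : ∀ U I → (∀ b c → (∑ λ a → conj (U a b) ∗ U a c) ≈ I b c) →
                     (∀ f b → apply I f b ≈ f b) →
                     ∀ ψ φ → inner (apply U ψ) (apply U φ) ≈ inner ψ φ
    inner-isometry U I U†U≈I I-id ψ φ = begin
      (∑ λ a → conj (apply U ψ a) ∗ apply U φ a)
        ≈⟨ (∑-cong λ a → *-congʳ {x = apply U φ a} (≈.trans (conj-∑ λ b → U a b ∗ ψ b) (∑-cong λ b → conj-∗ (U a b) (ψ b)))) ⟩
      (∑ λ a → (∑ λ b → conj (U a b) ∗ conj (ψ b)) ∗ apply U φ a)
        ≈⟨ (∑-cong λ a → ≈.trans (∑-* (apply U φ a) λ b → conj (U a b) ∗ conj (ψ b))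
              (∑-cong λ b → *-∑ (conj (U a b) ∗ conj (ψ b)) λ c → U a c ∗ φ c)) ⟩
      (∑ λ a → ∑ λ b → ∑ λ c → (conj (U a b) ∗ conj (ψ b)) ∗ (U a c ∗ φ c))
        ≈⟨ ∑-swap (λ a b → ∑ λ c → (conj (U a b) ∗ conj (ψ b)) ∗ (U a c ∗ φ c)) ⟩
      (∑ λ b → ∑ λ a → ∑ λ c → (conj (U a b) ∗ conj (ψ b)) ∗ (U a c ∗ φ c))
        ≈⟨ (∑-cong λ b → ∑-swap λ a c → (conj (U a b) ∗ conj (ψ b)) ∗ (U a c ∗ φ c)) ⟩
      (∑ λ b → ∑ λ c → ∑ λ a → (conj (U a b) ∗ conj (ψ b)) ∗ (U a c ∗ φ c))
        ≈⟨ (∑-cong λ b → ∑-cong λ c → ≈.trans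
              (∑-cong λ a → interchange (conj (U a b)) (conj (ψ b)) (U a c) (φ c))
              (≈.sym (∑-* (conj (ψ b) ∗ φ c) λ a → conj (U a b) ∗ U a c))) ⟩
      (∑ λ b → ∑ λ c → (∑ λ a → conj (U a b) ∗ U a c) ∗ (conj (ψ b) ∗ φ c))
        ≈⟨ (∑-cong λ b → ∑-cong λ c → *-congʳ {x = conj (ψ b) ∗ φ c} (U†U≈I b c)) ⟩
      (∑ λ b → apply I (λ c → conj (ψ b) ∗ φ c) b)
        ≈⟨ (∑-cong λ b → I-id (λ c → conj (ψ b) ∗ φ c) b) ⟩
      (∑ λ b → conj (ψ b) ∗ φ b)
        ∎

conj-0ᶜ : conj 0ᶜ ≃ᶜ 0ᶜ
conj-0ᶜ = pointwise-≃ᶜ (λ _ → refl) (λ _ → refl)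

dot : ℂ → ℂ → ℝ
dot z w = re z *ᵣ re w +ᵣ im z *ᵣ im w

re-conj-* : ∀ z w → re (conj z *ᶜ w) ≃ dot z w
re-conj-* z w = pointwise-≃ λ k → neg-neg (seq (re z) k) (seq (im z) k) (seq (re w) k) (seq (im w) k)
  where
  open +-*-Solver
  neg-neg : ∀ a b c d → a ℚ.* c ℚ.- (ℚ.- b) ℚ.* d ≡ a ℚ.* c ℚ.+ b ℚ.* d
  neg-neg = solve 4 (λ a b c d → a :* c :- (:- b) :* d := a :* c :+ b :* d) refl

re-sum : ∀ {n} (f : Fin n → ℂ) →
         re (SemiringSum.sum Complex.semiring f) ≡ SemiringSum.sum Real.semiring (re ∘ f)
re-sum {zero}  f = refl
re-sum {suc n} f = cong (re (f zero) +ᵣ_) (re-sum (f ∘ suc))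

module _ {N W : ℕ} where

  private
    module Σᶜ = BasisSum ℂ-commutativeRing {N} {W}
    module Σᵣ = BasisSum ℝ-commutativeRing {N} {W}
    open IsometryOver.Conjugation ℂ-commutativeRing conj conj-cong conj-0ᶜ conj-+ᶜ conj-*ᶜ {N} {W}

  Re⟨_,_⟩ : State N W → State N W → ℝ
  Re⟨ ψ , φ ⟩ = ∑ᵣ {N} {W} λ a → dot (ψ a) (φ a)

  re-∑ : ∀ f → re (Σᶜ.∑ f) ≃ Σᵣ.∑ (re ∘ f)
  re-∑ f = Real.trans
    (Real.reflexive (re-sum λ i → SemiringSum.sum Complex.semiring λ w → f (i , w)))
    (SemiringSum.sum-cong-≋ Real.semiring λ i → Real.reflexive (re-sum λ w → f (i , w)))

  re-inner : ∀ ψ φ → re (inner ψ φ) ≃ Re⟨ ψ , φ ⟩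
  re-inner ψ φ = Real.trans (re-∑ λ a → conj (ψ a) *ᶜ φ a) (Σᵣ.∑-cong λ a → re-conj-* (ψ a) (φ a))

  identity-id : ∀ f b → apply (identity {N} {W}) f b ≃ᶜ f b
  identity-id f b = Complex.trans (Σᶜ.∑-single b (λ c → identity b c *ᶜ f c) off) (diag b refl)
    where
    off : ∀ c → b ≢ c → identity b c *ᶜ f c ≃ᶜ 0ᶜ
    off c b≢c with b ≟ c
    ... | yes b≡c = contradiction b≡c b≢c
    ... | no  _   = Complex.zeroˡ (f c)
    diag : ∀ c → b ≡ c → identity b c *ᶜ f c ≃ᶜ f c
    diag c b≡c with b ≟ c
    ... | yes refl = Complex.*-identityˡ (f c)
    ... | no  b≢c = contradiction b≡c b≢c

  Re-unitary : ∀ U → IsUnitary {N} {W} U → ∀ ψ φ → Re⟨ U · ψ , U · φ ⟩ ≃ Re⟨ ψ , φ ⟩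
  Re-unitary U (U†U≈I , _) ψ φ = Real.trans (Real.sym (re-inner (U · ψ) (U · φ)))
    (Real.trans (re-≃ (inner-isometry U identity
        (λ b c → mk≃ (proj₁ (U†U≈I b c)) +i mk≃ (proj₂ (U†U≈I b c))) identity-id ψ φ))
      (re-inner ψ φ))

  Re-ket : ∀ b → Re⟨ ket b , ket b ⟩ ≃ 1ᵣ
  Re-ket b = Real.trans (Σᵣ.∑-single b (λ a → dot (ket b a) (ket b a)) off) diag
    where
    off : ∀ c → b ≢ c → dot (ket b c) (ket b c) ≃ 0ᵣ
    off c b≢c with c ≟ b
    ... | yes c≡b = contradiction (sym c≡b) b≢c
    ... | no  _   = pointwise-≃ λ _ → refl
    diag : dot (ket b b) (ket b b) ≃ 1ᵣ
    diag with b ≟ b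
    ... | yes _   = pointwise-≃ λ _ → refl
    ... | no  b≢b = contradiction refl b≢b

-- Sums in ordered commutative monoids, shared by ℝ and ℕ

record OrderedMonoid : Set₁ where
  field
    commutativeMonoid : CommutativeMonoid 0ℓ 0ℓ
  open CommutativeMonoid commutativeMonoid public
    renaming (_∙_ to infixl 6 _+_; ε to 0#; ∙-cong to +-cong; identityˡ to +-identityˡ; identityʳ to +-identityʳ)
  field
    _≼_        : Rel Carrier 0ℓ
    isPreorder : IsPreorder _≈_ _≼_
    +-mono     : ∀ {x x′ y y′} → x ≼ x′ → y ≼ y′ → (x + y) ≼ (x′ + y′)

module OrderedSum (M : OrderedMonoid) where
  open OrderedMonoid M hiding (refl; sym; trans)
  private
    module ≈ = OrderedMonoid M
    module ≼ = IsPreorder isPreorder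
  open Sum commutativeMonoid public using (sum; sum-cong-≋; ∑-distrib-+; ∑-comm)

  sum-mono : ∀ {n} {f g : Fin n → Carrier} → (∀ i → f i ≼ g i) → sum f ≼ sum g
  sum-mono {zero}  f≼g = ≼.refl
  sum-mono {suc n} f≼g = +-mono (f≼g zero) (sum-mono (f≼g ∘ suc))

  sum-cong : ∀ {n} {f g : Fin n → Carrier} → (∀ i → f i ≈ g i) → sum f ≈ sum g
  sum-cong f≈g = sum-cong-≋ f≈g

  sum-0 : ∀ n → sum {n} (λ _ → 0#) ≈ 0#
  sum-0 zero    = ≈.refl
  sum-0 (suc n) = ≈.trans (+-identityˡ _) (sum-0 n)

  sum-nonneg : ∀ {n} {f : Fin n → Carrier} → (∀ i → 0# ≼ f i) → 0# ≼ sum f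
  sum-nonneg {n} 0≼f = ≼.trans (≼.reflexive (≈.sym (sum-0 n))) (sum-mono 0≼f)

ℝ-ordered : OrderedMonoid
ℝ-ordered = record
  { commutativeMonoid = Real.+-commutativeMonoid
  ; isPreorder        = ≲-isPreorder
  ; +-mono            = +ᵣ-mono
  }

module ℝΣ where
  open OrderedSum ℝ-ordered public
  open SemiringSum Real.semiring public using (*-distribˡ-sum)

0≤p² : ∀ p → 0ℚ ℚ.≤ p ℚ.* p
0≤p² p with ℚ.≤-total 0ℚ p
... | inj₁ 0≤p = subst (ℚ._≤ p ℚ.* p) (ℚ.*-zeroˡ p) (ℚ.*-monoʳ-≤-nonNeg p {{ℚ.nonNegative 0≤p}} 0≤p)
... | inj₂ p≤0 = subst (ℚ._≤ p ℚ.* p) (ℚ.*-zeroˡ p) (ℚ.*-monoʳ-≤-nonPos p {{ℚ.nonPositive p≤0}} p≤0)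

-- Two squares are what is needed below: each inequality there amounts to |a z - b w|² ≥ 0, and the
-- real and imaginary parts contribute one square each.
≤-by-squares : ∀ {p q} s t → q ≡ p ℚ.+ (s ℚ.* s ℚ.+ t ℚ.* t) → p ℚ.≤ q
≤-by-squares {p} s t q≡ = subst₂ ℚ._≤_ (ℚ.+-identityʳ p) (sym q≡)
  (ℚ.+-monoʳ-≤ p (ℚ.+-mono-≤ (0≤p² s) (0≤p² t)))

infixr 7 _·ᵣ_
_·ᵣ_ : ℕ → ℝ → ℝ
n ·ᵣ x = fromℕ n *ᵣ x

abs²-nonneg : ∀ z → 0ᵣ ≲ abs² z
abs²-nonneg z = pointwise-≲ λ k → ℚ.+-mono-≤ (0≤p² (seq (re z) k)) (0≤p² (seq (im z) k))

dot-neg-neg : ∀ z w → dot (negᶜ z) (negᶜ w) ≃ dot z w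
dot-neg-neg z w = pointwise-≃ λ k →
  lemma (seq (re z) k) (seq (im z) k) (seq (re w) k) (seq (im w) k)
  where
  open +-*-Solver
  lemma : ∀ p q r s → (ℚ.- p) ℚ.* (ℚ.- r) ℚ.+ (ℚ.- q) ℚ.* (ℚ.- s) ≡ p ℚ.* r ℚ.+ q ℚ.* s
  lemma = solve 4 (λ p q r s → (:- p) :* (:- r) :+ (:- q) :* (:- s) := p :* r :+ q :* s) refl

dot-negˡ-negʳ : ∀ z w → dot z (negᶜ w) ≃ dot (negᶜ z) w
dot-negˡ-negʳ z w = pointwise-≃ λ k →
  lemma (seq (re z) k) (seq (im z) k) (seq (re w) k) (seq (im w) k)
  where
  open +-*-Solver
  lemma : ∀ p q r s → p ℚ.* (ℚ.- r) ℚ.+ q ℚ.* (ℚ.- s) ≡ (ℚ.- p) ℚ.* r ℚ.+ (ℚ.- q) ℚ.* s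
  lemma = solve 4 (λ p q r s → p :* (:- r) :+ q :* (:- s) := (:- p) :* r :+ (:- q) :* s) refl

-- a² |z|² + b² |w|² − 2 a b Re (z̄ w) = |a z − b w|²
dot-flip : ∀ a b z w → (a * b) ·ᵣ dot z w ≲ (a * b) ·ᵣ dot (negᶜ z) w +ᵣ ((a * a) ·ᵣ abs² z +ᵣ (b * b) ·ᵣ abs² w)
dot-flip a b z w = pointwise-≲ λ k →
  let p = seq (re z) k ; q = seq (im z) k ; r = seq (re w) k ; s = seq (im w) k
      A = a /1 ; B = b /1
  in ≤-by-squares (A ℚ.* p ℚ.- B ℚ.* r) (A ℚ.* q ℚ.- B ℚ.* s)
       (lemma {a /1} {b /1} (/1-homo-* a b) (/1-homo-* a a) (/1-homo-* b b) p q r s)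
  where
  open +-*-Solver
  lemma : ∀ {A B AB AA BB} → AB ≡ A ℚ.* B → AA ≡ A ℚ.* A → BB ≡ B ℚ.* B → ∀ p q r s →
    AB ℚ.* ((ℚ.- p) ℚ.* r ℚ.+ (ℚ.- q) ℚ.* s) ℚ.+ (AA ℚ.* (p ℚ.* p ℚ.+ q ℚ.* q) ℚ.+ BB ℚ.* (r ℚ.* r ℚ.+ s ℚ.* s))
    ≡ AB ℚ.* (p ℚ.* r ℚ.+ q ℚ.* s) ℚ.+ ((A ℚ.* p ℚ.- B ℚ.* r) ℚ.* (A ℚ.* p ℚ.- B ℚ.* r) ℚ.+ (A ℚ.* q ℚ.- B ℚ.* s) ℚ.* (A ℚ.* q ℚ.- B ℚ.* s))
  lemma {A} {B} refl refl refl p q r s = solve 6 (λ A B p q r s →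
    A :* B :* ((:- p) :* r :+ (:- q) :* s) :+ (A :* A :* (p :* p :+ q :* q) :+ B :* B :* (r :* r :+ s :* s))
    := A :* B :* (p :* r :+ q :* s) :+ ((A :* p :- B :* r) :* (A :* p :- B :* r) :+ (A :* q :- B :* s) :* (A :* q :- B :* s)))
    refl A B p q r s

-- 4 |z|² + 9 |w|² − 12 Re (z̄ w) = |2 z − 3 w|²
dot-bound : ∀ (o p q : Bool) → p ≢ q → ∀ z w →
  12 ·ᵣ dot z w +ᵣ (5 ·ᵣ (if does (o Bool.≟ p) then abs² z else 0ᵣ) +ᵣ 5 ·ᵣ (if does (o Bool.≟ q) then abs² w else 0ᵣ))
  ≲ 9 ·ᵣ (abs² z +ᵣ abs² w)
dot-bound o p q p≢q z w = cases o p q p≢q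
  where
  open +-*-Solver
  n : ∀ {m} → ℕ → Polynomial m
  n k = con (k /1)
  left : 12 ·ᵣ dot z w +ᵣ (5 ·ᵣ abs² z +ᵣ 5 ·ᵣ 0ᵣ) ≲ 9 ·ᵣ (abs² z +ᵣ abs² w)
  left = pointwise-≲ λ k →
    let a = seq (re z) k ; b = seq (im z) k ; c = seq (re w) k ; d = seq (im w) k
    in ≤-by-squares (2 /1 ℚ.* a ℚ.- 3 /1 ℚ.* c) (2 /1 ℚ.* b ℚ.- 3 /1 ℚ.* d)
         (solve 4 (λ a b c d → n 9 :* (a :* a :+ b :* b :+ (c :* c :+ d :* d))
           := n 12 :* (a :* c :+ b :* d) :+ (n 5 :* (a :* a :+ b :* b) :+ n 5 :* n 0)
              :+ ((n 2 :* a :- n 3 :* c) :* (n 2 :* a :- n 3 :* c) :+ (n 2 :* b :- n 3 :* d) :* (n 2 :* b :- n 3 :* d)))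
           refl a b c d)
  right : 12 ·ᵣ dot z w +ᵣ (5 ·ᵣ 0ᵣ +ᵣ 5 ·ᵣ abs² w) ≲ 9 ·ᵣ (abs² z +ᵣ abs² w)
  right = pointwise-≲ λ k →
    let a = seq (re z) k ; b = seq (im z) k ; c = seq (re w) k ; d = seq (im w) k
    in ≤-by-squares (3 /1 ℚ.* a ℚ.- 2 /1 ℚ.* c) (3 /1 ℚ.* b ℚ.- 2 /1 ℚ.* d)
         (solve 4 (λ a b c d → n 9 :* (a :* a :+ b :* b :+ (c :* c :+ d :* d))
           := n 12 :* (a :* c :+ b :* d) :+ (n 5 :* n 0 :+ n 5 :* (c :* c :+ d :* d))
              :+ ((n 3 :* a :- n 2 :* c) :* (n 3 :* a :- n 2 :* c) :+ (n 3 :* b :- n 2 :* d) :* (n 3 :* b :- n 2 :* d)))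
           refl a b c d)
  cases : ∀ (o p q : Bool) → p ≢ q →
    12 ·ᵣ dot z w +ᵣ (5 ·ᵣ (if does (o Bool.≟ p) then abs² z else 0ᵣ) +ᵣ 5 ·ᵣ (if does (o Bool.≟ q) then abs² w else 0ᵣ))
    ≲ 9 ·ᵣ (abs² z +ᵣ abs² w)
  cases _     true  true  p≢q = contradiction refl p≢q
  cases _     false false p≢q = contradiction refl p≢q
  cases true  true  false _   = left
  cases false true  false _   = right
  cases true  false true  _   = right
  cases false false true  _   = left

0≲fromℕ· : ∀ n {x} → 0ᵣ ≲ x → 0ᵣ ≲ n ·ᵣ x
0≲fromℕ· n 0≲x = ≲.trans (≲.reflexive (Real.sym (Real.zeroʳ (fromℕ n)))) (fromℕ*-mono n 0≲x)

x≲x+y : ∀ {x y} → 0ᵣ ≲ y → x ≲ x +ᵣ y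
x≲x+y {x} 0≲y = ≲.trans (≲.reflexive (Real.sym (Real.+-identityʳ x))) (+ᵣ-mono (≲.refl {x}) 0≲y)

y≲x+y : ∀ {x y} → 0ᵣ ≲ x → y ≲ x +ᵣ y
y≲x+y {x} {y} 0≲x = ≲.trans (≲.reflexive (Real.sym (Real.+-identityˡ y))) (+ᵣ-mono 0≲x (≲.refl {y}))

-- The progress of one query

-- The AM-GM price of flipping the sign of exactly one of two amplitudes with squared moduli `x` and
-- `y`. The ratio of `a` to `b` stays free until `optimise`.
weigh : ℕ → ℕ → Bool → ℝ → ℝ → ℝ
weigh a b c x y = if c then (a * a) ·ᵣ x +ᵣ (b * b) ·ᵣ y else 0ᵣ

weigh-+ : ∀ a b c {x y x′ y′} → weigh a b c x y +ᵣ weigh a b c x′ y′ ≃ weigh a b c (x +ᵣ x′) (y +ᵣ y′)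
weigh-+ a b false = Real.+-identityˡ 0ᵣ
weigh-+ a b true {x} {y} {x′} {y′} = pointwise-≃ λ k →
  lemma ((a * a) /1) ((b * b) /1) (seq x k) (seq y k) (seq x′ k) (seq y′ k)
  where
  open +-*-Solver
  lemma : ∀ p q x y x′ y′ → p ℚ.* x ℚ.+ q ℚ.* y ℚ.+ (p ℚ.* x′ ℚ.+ q ℚ.* y′) ≡ p ℚ.* (x ℚ.+ x′) ℚ.+ q ℚ.* (y ℚ.+ y′)
  lemma = solve 6 (λ p q x y x′ y′ →
    p :* x :+ q :* y :+ (p :* x′ :+ q :* y′) := p :* (x :+ x′) :+ q :* (y :+ y′)) refl

sum-weigh : ∀ a b c {n} (f g : Fin n → ℝ) →
            (ℝΣ.sum λ i → weigh a b c (f i) (g i)) ≃ weigh a b c (ℝΣ.sum f) (ℝΣ.sum g)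
sum-weigh a b false {n} f g = ℝΣ.sum-0 n
sum-weigh a b true {zero} f g = Real.sym (Real.trans (Real.+-cong (Real.zeroʳ (fromℕ (a * a))) (Real.zeroʳ (fromℕ (b * b)))) (Real.+-identityˡ 0ᵣ))
sum-weigh a b true {suc n} f g = Real.trans
  (Real.+-congˡ {weigh a b true (f zero) (g zero)} (sum-weigh a b true (f ∘ suc) (g ∘ suc)))
  (weigh-+ a b true {f zero} {g zero} {ℝΣ.sum (f ∘ suc)} {ℝΣ.sum (g ∘ suc)})

flipIf : Bool → ℂ → ℂ
flipIf c z = if c then negᶜ z else z

-- Equal signs leave `dot` unchanged and cost nothing. If the signs differ, `dot` is negated,
-- whichever side is flipped, and `dot-flip` pays for it.
dot-query : ∀ a b c d z w → (a * b) ·ᵣ dot z w ≲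
            (a * b) ·ᵣ dot (flipIf c z) (flipIf d w) +ᵣ weigh a b (c xor d) (abs² z) (abs² w)
dot-query a b false false z w = ≲.reflexive (Real.sym (Real.+-identityʳ ((a * b) ·ᵣ dot z w)))
dot-query a b true  true  z w = ≲.reflexive (Real.sym
  (Real.trans (Real.+-identityʳ ((a * b) ·ᵣ dot (negᶜ z) (negᶜ w)))
              (Real.*-congˡ {fromℕ (a * b)} (dot-neg-neg z w))))
dot-query a b true  false z w = dot-flip a b z w
dot-query a b false true  z w = ≲.trans (dot-flip a b z w)
  (≲.reflexive (Real.+-congʳ {(a * a) ·ᵣ abs² z +ᵣ (b * b) ·ᵣ abs² w}
    (Real.*-congˡ {fromℕ (a * b)} (Real.sym (dot-negˡ-negʳ z w)))))

module _ {N W : ℕ} where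

  mass : State N W → Fin N → ℝ
  mass ψ i = ℝΣ.sum λ w → abs² (ψ (suc i , w))

  mass-nonneg : ∀ ψ i → 0ᵣ ≲ mass ψ i
  mass-nonneg ψ i = ℝΣ.sum-nonneg λ w → abs²-nonneg (ψ (suc i , w))

  sum-mass≲norm : ∀ ψ → ℝΣ.sum (mass ψ) ≲ Re⟨ ψ , ψ ⟩
  sum-mass≲norm ψ = y≲x+y (ℝΣ.sum-nonneg λ w → abs²-nonneg (ψ (zero , w)))

  module _ (x y : Vec Bool N) (a b : ℕ) where

    differ : Fin N → Bool
    differ i = lookup x i xor lookup y i

    Re-oracle-row : ∀ ψ φ i → (a * b) ·ᵣ (ℝΣ.sum λ w → dot (ψ (i , w)) (φ (i , w))) ≲
      (a * b) ·ᵣ (ℝΣ.sum λ w → dot (oracle x ψ (i , w)) (oracle y φ (i , w)))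
        +ᵣ weigh a b (lookup (false ∷ x) i xor lookup (false ∷ y) i)
             (ℝΣ.sum λ w → abs² (ψ (i , w))) (ℝΣ.sum λ w → abs² (φ (i , w)))
    Re-oracle-row ψ φ i = begin
      (a * b) ·ᵣ (ℝΣ.sum λ w → dot (ψ (i , w)) (φ (i , w)))
        ≈⟨ ℝΣ.*-distribˡ-sum (fromℕ (a * b)) (λ w → dot (ψ (i , w)) (φ (i , w))) ⟩
      (ℝΣ.sum λ w → (a * b) ·ᵣ dot (ψ (i , w)) (φ (i , w)))
        ≲⟨ (ℝΣ.sum-mono λ w → dot-query a b (lookup (false ∷ x) i) (lookup (false ∷ y) i) (ψ (i , w)) (φ (i , w))) ⟩
      (ℝΣ.sum λ w → (a * b) ·ᵣ D w +ᵣ E w)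
        ≈⟨ ℝΣ.∑-distrib-+ (λ w → (a * b) ·ᵣ D w) E ⟩
      (ℝΣ.sum λ w → (a * b) ·ᵣ D w) +ᵣ ℝΣ.sum E
        ≈⟨ Real.+-cong (Real.sym (ℝΣ.*-distribˡ-sum (fromℕ (a * b)) D)) (sum-weigh a b _ (λ w → abs² (ψ (i , w))) (λ w → abs² (φ (i , w)))) ⟩
      _ ∎
      where
      open ≲-Reasoning
      D E : Fin W → ℝ
      D w = dot (oracle x ψ (i , w)) (oracle y φ (i , w))
      E w = weigh a b (lookup (false ∷ x) i xor lookup (false ∷ y) i) (abs² (ψ (i , w))) (abs² (φ (i , w)))

    Re-oracle : ∀ ψ φ → (a * b) ·ᵣ Re⟨ ψ , φ ⟩ ≲
      (a * b) ·ᵣ Re⟨ oracle x ψ , oracle y φ ⟩ +ᵣ ℝΣ.sum λ i → weigh a b (differ i) (mass ψ i) (mass φ i)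
    Re-oracle ψ φ = begin
      (a * b) ·ᵣ Re⟨ ψ , φ ⟩
        ≈⟨ ℝΣ.*-distribˡ-sum (fromℕ (a * b)) (λ i → ℝΣ.sum λ w → dot (ψ (i , w)) (φ (i , w))) ⟩
      (ℝΣ.sum λ i → (a * b) ·ᵣ (ℝΣ.sum λ w → dot (ψ (i , w)) (φ (i , w))))
        ≲⟨ ℝΣ.sum-mono (Re-oracle-row ψ φ) ⟩
      (ℝΣ.sum λ i → (a * b) ·ᵣ D i +ᵣ E i)
        ≈⟨ ℝΣ.∑-distrib-+ (λ i → (a * b) ·ᵣ D i) E ⟩
      -- Row `zero` asks for nothing: both lookups there are `false`, so its `weigh` reduces to `0ᵣ`
      -- and only genuine bits remain.
      (ℝΣ.sum λ i → (a * b) ·ᵣ D i) +ᵣ (0ᵣ +ᵣ ℝΣ.sum (E ∘ suc))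
        ≈⟨ Real.+-cong (Real.sym (ℝΣ.*-distribˡ-sum (fromℕ (a * b)) D)) (Real.+-identityˡ (ℝΣ.sum (E ∘ suc))) ⟩
      (a * b) ·ᵣ Re⟨ oracle x ψ , oracle y φ ⟩ +ᵣ ℝΣ.sum (E ∘ suc) ∎
      where
      open ≲-Reasoning
      D E : Fin (suc N) → ℝ
      D i = ℝΣ.sum λ w → dot (oracle x ψ (i , w)) (oracle y φ (i , w))
      E i = weigh a b (lookup (false ∷ x) i xor lookup (false ∷ y) i)
              (ℝΣ.sum λ w → abs² (ψ (i , w))) (ℝΣ.sum λ w → abs² (φ (i , w)))

  run : ∀ {T} → Vec Bool N → Vec (Unitary N W) T → State N W → State N W
  run x Us ψ = Vec.foldl (λ _ → State N W) (λ ψ V → proj₁ V · oracle x ψ) ψ Us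

  queryMass : ∀ {T} → Vec Bool N → Vec (Unitary N W) T → State N W → Fin N → ℝ
  queryMass x []       ψ i = 0ᵣ
  queryMass x (V ∷ Us) ψ i = mass ψ i +ᵣ queryMass x Us (proj₁ V · oracle x ψ) i

  Re-step : ∀ (V : Unitary N W) ψ φ → Re⟨ proj₁ V · ψ , proj₁ V · φ ⟩ ≃ Re⟨ ψ , φ ⟩
  Re-step (V , unitary) = Re-unitary V unitary

  norm-oracle : ∀ x (ψ : State N W) → Re⟨ oracle x ψ , oracle x ψ ⟩ ≃ Re⟨ ψ , ψ ⟩
  norm-oracle x ψ = ℝΣ.sum-cong λ i → ℝΣ.sum-cong λ w → flip-flip (lookup (false ∷ x) i) (ψ (i , w))
    where
    flip-flip : ∀ c z → dot (flipIf c z) (flipIf c z) ≃ dot z z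
    flip-flip true  z = dot-neg-neg z z
    flip-flip false z = Real.refl

  norm-step : ∀ x (V : Unitary N W) ψ {r} → Re⟨ ψ , ψ ⟩ ≃ r →
              Re⟨ proj₁ V · oracle x ψ , proj₁ V · oracle x ψ ⟩ ≃ r
  norm-step x V ψ norm = Real.trans (Re-step V (oracle x ψ) (oracle x ψ)) (Real.trans (norm-oracle x ψ) norm)

  queryMass-nonneg : ∀ {T} x (Us : Vec (Unitary N W) T) ψ i → 0ᵣ ≲ queryMass x Us ψ i
  queryMass-nonneg x []       ψ i = ≲.refl
  queryMass-nonneg x (V ∷ Us) ψ i = ≲.trans (mass-nonneg ψ i) (x≲x+y (queryMass-nonneg x Us _ i))

  -- The state before each oracle call is normalised, so every call adds at most 1; the mass at
  -- index `zero` is merely discarded.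
  sum-queryMass : ∀ {T} x (Us : Vec (Unitary N W) T) ψ → Re⟨ ψ , ψ ⟩ ≃ 1ᵣ →
                  ℝΣ.sum (queryMass x Us ψ) ≲ fromℕ T
  sum-queryMass x [] ψ norm = ≲.reflexive (ℝΣ.sum-0 N)
  sum-queryMass {suc T} x (V ∷ Us) ψ norm = begin
    (ℝΣ.sum λ i → mass ψ i +ᵣ queryMass x Us ψ′ i)       ≈⟨ ℝΣ.∑-distrib-+ (mass ψ) (queryMass x Us ψ′) ⟩
    ℝΣ.sum (mass ψ) +ᵣ ℝΣ.sum (queryMass x Us ψ′)
      ≲⟨ +ᵣ-mono (≲.trans (sum-mass≲norm ψ) (≲.reflexive norm))
                 (sum-queryMass x Us ψ′ (norm-step x V ψ norm)) ⟩
    fromℕ 1 +ᵣ fromℕ T                                   ≈⟨ fromℕ-homo-+ 1 T ⟨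
    fromℕ (suc T)                                        ∎
    where
    open ≲-Reasoning
    ψ′ = proj₁ V · oracle x ψ

  norm-run : ∀ {T} x (Us : Vec (Unitary N W) T) ψ → Re⟨ ψ , ψ ⟩ ≃ 1ᵣ → Re⟨ run x Us ψ , run x Us ψ ⟩ ≃ 1ᵣ
  norm-run x []       ψ norm = norm
  norm-run x (V ∷ Us) ψ norm = norm-run x Us (proj₁ V · oracle x ψ) (norm-step x V ψ norm)

  -- The two runs share their unitaries, which preserve the inner product, so only the oracle calls
  -- change it. Their costs accumulate because `weigh` is additive.
  progress : ∀ {T} x y a b (Us : Vec (Unitary N W) T) ψ φ →
    (a * b) ·ᵣ Re⟨ ψ , φ ⟩ ≲ (a * b) ·ᵣ Re⟨ run x Us ψ , run y Us φ ⟩ +ᵣ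
      ℝΣ.sum λ i → weigh a b (lookup x i xor lookup y i) (queryMass x Us ψ i) (queryMass y Us φ i)
  progress x y a b [] ψ φ = x≲x+y (ℝΣ.sum-nonneg λ i → ≲.reflexive (0-weigh (lookup x i xor lookup y i)))
    where
    0-weigh : ∀ c → 0ᵣ ≃ weigh a b c 0ᵣ 0ᵣ
    0-weigh true  = Real.sym (Real.trans (Real.+-cong (Real.zeroʳ (fromℕ (a * a))) (Real.zeroʳ (fromℕ (b * b)))) (Real.+-identityˡ 0ᵣ))
    0-weigh false = Real.refl
  progress x y a b (V ∷ Us) ψ φ = begin
    (a * b) ·ᵣ Re⟨ ψ , φ ⟩
      ≲⟨ Re-oracle x y a b ψ φ ⟩
    (a * b) ·ᵣ Re⟨ oracle x ψ , oracle y φ ⟩ +ᵣ ℝΣ.sum now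
      ≈⟨ Real.+-congʳ {ℝΣ.sum now} (Real.*-congˡ {fromℕ (a * b)} (Re-step V (oracle x ψ) (oracle y φ))) ⟨
    (a * b) ·ᵣ Re⟨ ψ′ , φ′ ⟩ +ᵣ ℝΣ.sum now
      ≲⟨ +ᵣ-mono (progress x y a b Us ψ′ φ′) (≲.refl {ℝΣ.sum now}) ⟩
    (a * b) ·ᵣ R +ᵣ ℝΣ.sum later +ᵣ ℝΣ.sum now
      ≈⟨ Real.+-assoc ((a * b) ·ᵣ R) (ℝΣ.sum later) (ℝΣ.sum now) ⟩
    (a * b) ·ᵣ R +ᵣ (ℝΣ.sum later +ᵣ ℝΣ.sum now)
      ≈⟨ Real.+-congˡ {(a * b) ·ᵣ R} (Real.trans (Real.+-comm (ℝΣ.sum later) (ℝΣ.sum now))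
                                                 (Real.sym (ℝΣ.∑-distrib-+ now later))) ⟩
    (a * b) ·ᵣ R +ᵣ (ℝΣ.sum λ i → now i +ᵣ later i)
      ≈⟨ Real.+-congˡ {(a * b) ·ᵣ R} (ℝΣ.sum-cong λ i → weigh-+ a b (lookup x i xor lookup y i)
           {mass ψ i} {mass φ i} {queryMass x Us ψ′ i} {queryMass y Us φ′ i}) ⟩
    _ ∎
    where
    open ≲-Reasoning
    ψ′ = proj₁ V · oracle x ψ
    φ′ = proj₁ V · oracle y φ
    R = Re⟨ run x Us ψ′ , run y Us φ′ ⟩
    now later : Fin N → ℝ
    now i   = weigh a b (lookup x i xor lookup y i) (mass ψ i) (mass φ i)
    later i = weigh a b (lookup x i xor lookup y i) (queryMass x Us ψ′ i) (queryMass y Us φ′ i)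

  -- Every outcome is counted as correct for exactly one of the two inputs, so `dot-bound` applies
  -- at each basis state. Summing gives 12 R + 5 (2/3 + 2/3) ≤ 18, that is R ≤ 17/18. The sharp
  -- value is 2√2/3, attained at amplitude ratio √2; the ratio 3/2 used in `dot-bound` is a rational
  -- substitute for it.
  final-bound : ∀ (output : Basis N W → Bool) p q → p ≢ q → ∀ ψ φ →
    Re⟨ ψ , ψ ⟩ ≃ 1ᵣ → Re⟨ φ , φ ⟩ ≃ 1ᵣ →
    fromℚ (+ 2 / 3) ≲ (∑ᵣ {N} {W} λ a → if does (output a Bool.≟ p) then abs² (ψ a) else 0ᵣ) →
    fromℚ (+ 2 / 3) ≲ (∑ᵣ {N} {W} λ a → if does (output a Bool.≟ q) then abs² (φ a) else 0ᵣ) →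
    36 ·ᵣ Re⟨ ψ , φ ⟩ ≲ fromℕ 34
  final-bound output p q p≢q ψ φ norm-ψ norm-φ Pr-ψ Pr-φ = begin
    36 ·ᵣ R
      ≈⟨ (pointwise-≃ λ k → lemma₁ (seq R k)) ⟩
    3 ·ᵣ (12 ·ᵣ R +ᵣ (5 ·ᵣ fromℚ (+ 2 / 3) +ᵣ 5 ·ᵣ fromℚ (+ 2 / 3))) +ᵣ c
      ≲⟨ +ᵣ-mono (fromℕ*-mono 3 (+ᵣ-mono (≲.refl {12 ·ᵣ R}) (+ᵣ-mono (fromℕ*-mono 5 Pr-ψ) (fromℕ*-mono 5 Pr-φ)))) (≲.refl {c}) ⟩
    3 ·ᵣ (12 ·ᵣ R +ᵣ (5 ·ᵣ Σᵣ.∑ X +ᵣ 5 ·ᵣ Σᵣ.∑ Y)) +ᵣ c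
      ≲⟨ +ᵣ-mono (fromℕ*-mono 3 sums) (≲.refl {c}) ⟩
    3 ·ᵣ (9 ·ᵣ (Re⟨ ψ , ψ ⟩ +ᵣ Re⟨ φ , φ ⟩)) +ᵣ c
      ≈⟨ Real.+-congʳ {c} (Real.*-congˡ {fromℕ 3} (Real.*-congˡ {fromℕ 9} (Real.+-cong norm-ψ norm-φ))) ⟩
    3 ·ᵣ (9 ·ᵣ (1ᵣ +ᵣ 1ᵣ)) +ᵣ c
      ≈⟨ (pointwise-≃ λ _ → refl) ⟩
    fromℕ 34
      ∎
    where
    open ≲-Reasoning
    module Σᵣ = BasisSum ℝ-commutativeRing {N} {W}
    R c : ℝ
    R = Re⟨ ψ , φ ⟩
    c = -ᵣ fromℕ 20
    D X Y : Basis N W → ℝ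
    D a = dot (ψ a) (φ a)
    X a = if does (output a Bool.≟ p) then abs² (ψ a) else 0ᵣ
    Y a = if does (output a Bool.≟ q) then abs² (φ a) else 0ᵣ
    lemma₁ : ∀ r → 36 /1 ℚ.* r ≡ 3 /1 ℚ.* (12 /1 ℚ.* r ℚ.+ (5 /1 ℚ.* (+ 2 / 3) ℚ.+ 5 /1 ℚ.* (+ 2 / 3))) ℚ.+ ℚ.- (20 /1)
    lemma₁ = solve 1 (λ r → con (36 /1) :* r := con (3 /1) :* (con (12 /1) :* r :+ (con (5 /1) :* con (+ 2 / 3) :+ con (5 /1) :* con (+ 2 / 3))) :+ :- con (20 /1)) refl
      where open +-*-Solver
    sums : 12 ·ᵣ R +ᵣ (5 ·ᵣ Σᵣ.∑ X +ᵣ 5 ·ᵣ Σᵣ.∑ Y) ≲ 9 ·ᵣ (Re⟨ ψ , ψ ⟩ +ᵣ Re⟨ φ , φ ⟩)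
    sums = begin
      12 ·ᵣ R +ᵣ (5 ·ᵣ Σᵣ.∑ X +ᵣ 5 ·ᵣ Σᵣ.∑ Y)
        ≈⟨ Real.+-cong (Σᵣ.*-∑ (fromℕ 12) D) (Real.trans
             (Real.+-cong (Σᵣ.*-∑ (fromℕ 5) X) (Σᵣ.*-∑ (fromℕ 5) Y))
             (Real.sym (Σᵣ.∑-+ (λ a → 5 ·ᵣ X a) (λ a → 5 ·ᵣ Y a)))) ⟩
      Σᵣ.∑ (λ a → 12 ·ᵣ D a) +ᵣ Σᵣ.∑ (λ a → 5 ·ᵣ X a +ᵣ 5 ·ᵣ Y a)
        ≈⟨ Σᵣ.∑-+ (λ a → 12 ·ᵣ D a) (λ a → 5 ·ᵣ X a +ᵣ 5 ·ᵣ Y a) ⟨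
      Σᵣ.∑ (λ a → 12 ·ᵣ D a +ᵣ (5 ·ᵣ X a +ᵣ 5 ·ᵣ Y a))
        ≲⟨ (ℝΣ.sum-mono λ i → ℝΣ.sum-mono λ w → dot-bound (output (i , w)) p q p≢q (ψ (i , w)) (φ (i , w))) ⟩
      Σᵣ.∑ (λ a → 9 ·ᵣ (abs² (ψ a) +ᵣ abs² (φ a)))
        ≈⟨ Σᵣ.*-∑ (fromℕ 9) (λ a → abs² (ψ a) +ᵣ abs² (φ a)) ⟨
      9 ·ᵣ Σᵣ.∑ (λ a → abs² (ψ a) +ᵣ abs² (φ a))
        ≈⟨ Real.*-congˡ {fromℕ 9} (Σᵣ.∑-+ (λ a → abs² (ψ a)) (λ a → abs² (φ a))) ⟩
      9 ·ᵣ (Re⟨ ψ , ψ ⟩ +ᵣ Re⟨ φ , φ ⟩)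
        ∎

-- P x i is the total probability of querying bit i over the whole run on x.
query-weights : ∀ {N T} (A : Algorithm N T) (f : Vec Bool N → Bool) → A Computes f →
  Σ[ P ∈ (Vec Bool N → Fin N → ℝ) ]
    (∀ x i → 0ᵣ ≲ P x i) × (∀ x → ℝΣ.sum (P x) ≲ fromℕ T) ×
    (∀ x y → f x ≢ f y → ∀ a b → fromℕ (2 * (a * b)) ≲
      36 ·ᵣ ℝΣ.sum λ i → weigh a b (lookup x i xor lookup y i) (P x i) (P y i))
query-weights {N} {T} A f computes = P
  , (λ x → queryMass-nonneg x U ψ₀)
  , (λ x → sum-queryMass x U ψ₀ norm₀)
  , bound
  where
  open Algorithm A
  ψ₀ : State N workspace
  ψ₀ = proj₁ U₀ · ket start
  norm₀ : Re⟨ ψ₀ , ψ₀ ⟩ ≃ 1ᵣ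
  norm₀ = Real.trans (Re-step U₀ (ket start) (ket start)) (Re-ket start)
  P : Vec Bool N → Fin N → ℝ
  P x = queryMass x U ψ₀
  bound : ∀ x y → f x ≢ f y → ∀ a b → fromℕ (2 * (a * b)) ≲
    36 ·ᵣ ℝΣ.sum λ i → weigh a b (lookup x i xor lookup y i) (P x i) (P y i)
  -- Both runs start in the same unit vector, so the inner product starts at 1 and ends at no more
  -- than 34/36. Multiplied by `36 * (a * b)`, the drop is at least `2 * (a * b)`; the term `c`
  -- subtracts the final value.
  bound x y fx≢fy a b = begin
    fromℕ (2 * (a * b))
      ≈⟨ (pointwise-≃ λ _ → trans (/1-homo-* 2 (a * b)) (lemma₁ ((a * b) /1))) ⟩
    36 ·ᵣ ((a * b) ·ᵣ 1ᵣ) +ᵣ c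
      ≈⟨ Real.+-congʳ {c} (Real.*-congˡ {fromℕ 36} (Real.*-congˡ {fromℕ (a * b)} norm₀)) ⟨
    36 ·ᵣ ((a * b) ·ᵣ Re⟨ ψ₀ , ψ₀ ⟩) +ᵣ c
      ≲⟨ +ᵣ-mono (fromℕ*-mono 36 (progress x y a b U ψ₀ ψ₀)) (≲.refl {c}) ⟩
    36 ·ᵣ ((a * b) ·ᵣ R +ᵣ D) +ᵣ c
      ≈⟨ (pointwise-≃ λ k → lemma₂ ((a * b) /1) (seq R k) (seq D k)) ⟩
    (a * b) ·ᵣ (36 ·ᵣ R) +ᵣ (36 ·ᵣ D +ᵣ c)
      ≲⟨ +ᵣ-mono (fromℕ*-mono (a * b) (final-bound output (f x) (f y) fx≢fy
           (run x U ψ₀) (run y U ψ₀) (norm-run x U ψ₀ norm₀) (norm-run y U ψ₀ norm₀)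
           (mk≲ (computes x)) (mk≲ (computes y))))
         (≲.refl {36 ·ᵣ D +ᵣ c}) ⟩
    (a * b) ·ᵣ fromℕ 34 +ᵣ (36 ·ᵣ D +ᵣ c)
      ≈⟨ (pointwise-≃ λ k → lemma₃ ((a * b) /1) (seq D k)) ⟩
    36 ·ᵣ D
      ∎
    where
    open ≲-Reasoning
    R D c : ℝ
    R = Re⟨ run x U ψ₀ , run y U ψ₀ ⟩
    D = ℝΣ.sum λ i → weigh a b (lookup x i xor lookup y i) (P x i) (P y i)
    c = -ᵣ (34 ·ᵣ fromℕ (a * b))
    open +-*-Solver
    lemma₁ : ∀ p → 2 /1 ℚ.* p ≡ 36 /1 ℚ.* (p ℚ.* 1ℚ) ℚ.+ ℚ.- (34 /1 ℚ.* p)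
    lemma₁ = solve 1 (λ p → con (2 /1) :* p := con (36 /1) :* (p :* con 1ℚ) :+ :- (con (34 /1) :* p)) refl
    lemma₂ : ∀ p r d → 36 /1 ℚ.* (p ℚ.* r ℚ.+ d) ℚ.+ ℚ.- (34 /1 ℚ.* p) ≡ p ℚ.* (36 /1 ℚ.* r) ℚ.+ (36 /1 ℚ.* d ℚ.+ ℚ.- (34 /1 ℚ.* p))
    lemma₂ = solve 3 (λ p r d → con (36 /1) :* (p :* r :+ d) :+ :- (con (34 /1) :* p) := p :* (con (36 /1) :* r) :+ (con (36 /1) :* d :+ :- (con (34 /1) :* p))) refl
    lemma₃ : ∀ p d → p ℚ.* 34 /1 ℚ.+ (36 /1 ℚ.* d ℚ.+ ℚ.- (34 /1 ℚ.* p)) ≡ 36 /1 ℚ.* d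
    lemma₃ = solve 2 (λ p d → p :* con (34 /1) :+ (con (36 /1) :* d :+ :- (con (34 /1) :* p)) := con (36 /1) :* d) refl

-- Sums over the Boolean cube

toggle : ∀ {M} → Vec Bool M → Fin M → Vec Bool M
toggle z w = updateAt z w not

toggle-toggle : ∀ {M} (z : Vec Bool M) w → toggle (toggle z w) w ≡ z
toggle-toggle z w = trans (Vec.updateAt-updateAt w z)
  (Vec.updateAt-id-local w z (Bool.not-involutive (lookup z w)))

lookup-toggle : ∀ {M} (z : Vec Bool M) w → lookup (toggle z w) w ≡ not (lookup z w)
lookup-toggle z w = Vec.lookup∘updateAt w z

module CubeSum (M : OrderedMonoid) where
  open OrderedMonoid M hiding (refl; sym; trans)
  open OrderedSum M
  private
    module ≈ = OrderedMonoid M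
    module ≼ = IsPreorder isPreorder

  cubeSum : ∀ {d} → (Vec Bool d → Carrier) → Carrier
  cubeSum {zero}  F = F []
  cubeSum {suc d} F = cubeSum (F ∘ (false ∷_)) + cubeSum (F ∘ (true ∷_))

  cubeSum-mono : ∀ {d} {F G : Vec Bool d → Carrier} → (∀ z → F z ≼ G z) → cubeSum F ≼ cubeSum G
  cubeSum-mono {zero}  F≼G = F≼G []
  cubeSum-mono {suc d} F≼G = +-mono (cubeSum-mono (F≼G ∘ (false ∷_))) (cubeSum-mono (F≼G ∘ (true ∷_)))

  cubeSum-cong : ∀ {d} {F G : Vec Bool d → Carrier} → (∀ z → F z ≈ G z) → cubeSum F ≈ cubeSum G
  cubeSum-cong {zero}  F≈G = F≈G []
  cubeSum-cong {suc d} F≈G = +-cong (cubeSum-cong (F≈G ∘ (false ∷_))) (cubeSum-cong (F≈G ∘ (true ∷_)))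

  cubeSum-sum : ∀ {d n} (F : Vec Bool d → Fin n → Carrier) →
                (cubeSum λ z → sum (F z)) ≈ (sum λ w → cubeSum λ z → F z w)
  cubeSum-sum {zero}  F = ≈.refl
  cubeSum-sum {suc d} F = ≈.trans
    (+-cong (cubeSum-sum (F ∘ (false ∷_))) (cubeSum-sum (F ∘ (true ∷_))))
    (≈.sym (∑-distrib-+ (λ w → cubeSum λ z → F (false ∷ z) w) (λ w → cubeSum λ z → F (true ∷ z) w)))

  cubeSum-toggle : ∀ {d} (w : Fin d) F → cubeSum F ≈ cubeSum (λ z → F (toggle z w))
  cubeSum-toggle zero    F = comm _ _
  cubeSum-toggle (suc w) F = +-cong (cubeSum-toggle w (F ∘ (false ∷_))) (cubeSum-toggle w (F ∘ (true ∷_)))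

  cubeSum-+ : ∀ {d} (F G : Vec Bool d → Carrier) → (cubeSum λ z → F z + G z) ≈ cubeSum F + cubeSum G
  cubeSum-+ {zero}  F G = ≈.refl
  cubeSum-+ {suc d} F G = ≈.trans
    (+-cong (cubeSum-+ (F ∘ (false ∷_)) (G ∘ (false ∷_))) (cubeSum-+ (F ∘ (true ∷_)) (G ∘ (true ∷_))))
    (interchange _ _ _ _)
    where open import Algebra.Properties.CommutativeSemigroup commutativeSemigroup using (interchange)

  -- A pair of a point and a direction is a directed edge of the cube, and toggling the point in
  -- that direction reverses the edge. Edge sums can thus be organised by either endpoint.
  cube-toggle-sum : ∀ {d} (F : Vec Bool d → Fin d → Carrier) →
                    (cubeSum λ z → sum (F z)) ≈ (cubeSum λ z → sum λ w → F (toggle z w) w)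
  cube-toggle-sum F = ≈.trans (cubeSum-sum F)
    (≈.trans (sum-cong λ w → cubeSum-toggle w λ z → F z w) (≈.sym (cubeSum-sum λ z w → F (toggle z w) w)))

ℕ-ordered : OrderedMonoid
ℕ-ordered = record
  { commutativeMonoid = ℕ.+-0-commutativeMonoid
  ; isPreorder        = ℕ.≤-isPreorder
  ; +-mono            = ℕ.+-mono-≤
  }

module ℕΣ where
  open OrderedSum ℕ-ordered public
  open CubeSum ℕ-ordered public
  open SemiringSum ℕ.+-*-semiring public using (*-distribˡ-sum; *-distribʳ-sum)

module ℝ□ = CubeSum ℝ-ordered

ind : Bool → ℕ
ind c = if c then 1 else 0

count : ∀ {n} → (Fin n → Bool) → ℕ
count p = ℕΣ.sum (ind ∘ p)

mask : Bool → ℝ → ℝ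
mask c x = if c then x else 0ᵣ

fromℕ-0-* : ∀ x → 0 ·ᵣ x ≃ 0ᵣ
fromℕ-0-* x = Real.zeroˡ x

fromℕ-1-* : ∀ x → 1 ·ᵣ x ≃ x
fromℕ-1-* x = Real.*-identityˡ x

·ᵣ-distribʳ-+ : ∀ m n x → (m ℕ.+ n) ·ᵣ x ≃ m ·ᵣ x +ᵣ n ·ᵣ x
·ᵣ-distribʳ-+ m n x = Real.trans (Real.*-congʳ {x} (fromℕ-homo-+ m n)) (Real.distribʳ x (fromℕ m) (fromℕ n))

mask-ind : ∀ c x → mask c x ≃ ind c ·ᵣ x
mask-ind true  x = Real.sym (fromℕ-1-* x)
mask-ind false x = Real.sym (fromℕ-0-* x)

sum-mask : ∀ {n} (p : Fin n → Bool) x → (ℝΣ.sum λ i → mask (p i) x) ≃ count p ·ᵣ x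
sum-mask {zero}  p x = Real.sym (fromℕ-0-* x)
sum-mask {suc n} p x = Real.trans (Real.+-cong (mask-ind (p zero) x) (sum-mask (p ∘ suc) x))
  (Real.sym (·ᵣ-distribʳ-+ (ind (p zero)) (count (p ∘ suc)) x))

cubeSum-·ᵣ : ∀ {d} (h : Vec Bool d → ℕ) x → (ℝ□.cubeSum λ z → h z ·ᵣ x) ≃ ℕΣ.cubeSum h ·ᵣ x
cubeSum-·ᵣ {zero}  h x = Real.refl {h [] ·ᵣ x}
cubeSum-·ᵣ {suc d} h x = Real.trans (Real.+-cong (cubeSum-·ᵣ (h ∘ (false ∷_)) x) (cubeSum-·ᵣ (h ∘ (true ∷_)) x))
  (Real.sym (·ᵣ-distribʳ-+ (ℕΣ.cubeSum (h ∘ (false ∷_))) (ℕΣ.cubeSum (h ∘ (true ∷_))) x))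

mask-mono : ∀ c {x y} → (c ≡ true → x ≲ y) → mask c x ≲ mask c y
mask-mono true  x≲y = x≲y refl
mask-mono false _   = ≲.refl {0ᵣ}

mask-nonneg : ∀ c {x} → 0ᵣ ≲ x → 0ᵣ ≲ mask c x
mask-nonneg true  0≲x = 0≲x
mask-nonneg false _   = ≲.refl {0ᵣ}

mask-≲ : ∀ c {x} → 0ᵣ ≲ x → mask c x ≲ x
mask-≲ true  {x} _ = ≲.refl {x}
mask-≲ false 0≲x   = 0≲x

mask-implies : ∀ c d {x} → (c ≡ true → d ≡ true) → 0ᵣ ≲ x → mask c x ≲ mask d x
mask-implies true  true  {x} _ _   = ≲.refl {x}
mask-implies true  false c⇒d _     = contradiction (c⇒d refl) λ ()
mask-implies false d     _   0≲x   = mask-nonneg d 0≲x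

mask-+ : ∀ c x y → mask c (x +ᵣ y) ≃ mask c x +ᵣ mask c y
mask-+ true  x y = Real.refl {x +ᵣ y}
mask-+ false x y = Real.sym (Real.+-identityˡ 0ᵣ)

count≡0 : ∀ {n} (p : Fin n → Bool) → count p ≡ 0 → ∀ i → p i ≡ false
count≡0 {suc n} p eq i with p zero in p0
count≡0 {suc n} p () i       | true
count≡0 {suc n} p eq zero    | false = p0
count≡0 {suc n} p eq (suc i) | false = count≡0 (p ∘ suc) eq i

-- The factor `1 ⊓ count p` is 1 if some `p i` holds and 0 otherwise. Summed over the cube it will
-- count only the points that lie on an edge of the relation.
mask-sum : ∀ {n} (p : Fin n → Bool) {Q : Fin n → ℝ} {B} → (∀ i → 0ᵣ ≲ Q i) → ℝΣ.sum Q ≲ B →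
           (ℝΣ.sum λ i → mask (p i) (Q i)) ≲ (1 ⊓ count p) ·ᵣ B
mask-sum {n} p {Q} {B} 0≲Q ΣQ≲B = cases (count p) refl
  where
  cases : ∀ k → count p ≡ k → (ℝΣ.sum λ i → mask (p i) (Q i)) ≲ (1 ⊓ k) ·ᵣ B
  cases (suc _) _ = ≲.trans (ℝΣ.sum-mono λ i → mask-≲ (p i) (0≲Q i))
    (≲.trans ΣQ≲B (≲.reflexive (Real.sym (fromℕ-1-* B))))
  cases zero eq = ≲.reflexive (Real.trans
    (ℝΣ.sum-cong λ i → Real.reflexive (cong (λ c → mask c (Q i)) (count≡0 p eq i)))
    (Real.trans (ℝΣ.sum-0 n) (Real.sym (fromℕ-0-* B))))

-- The adversary bound along the edges of a cube

cubeSum-≥ : ∀ {d} (F : Vec Bool d → ℕ) z → F z ≤ ℕΣ.cubeSum F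
cubeSum-≥ F []          = ℕ.≤-refl
cubeSum-≥ F (false ∷ z) = ℕ.≤-trans (cubeSum-≥ (F ∘ (false ∷_)) z) (ℕ.m≤m+n _ _)
cubeSum-≥ F (true  ∷ z) = ℕ.≤-trans (cubeSum-≥ (F ∘ (true ∷_)) z) (ℕ.m≤n+m _ _)

cubeSum-*ʳ : ∀ {d} (F : Vec Bool d → ℕ) c → (ℕΣ.cubeSum λ z → F z * c) ≡ ℕΣ.cubeSum F * c
cubeSum-*ʳ {zero}  F c = refl
cubeSum-*ʳ {suc d} F c = trans
  (cong₂ ℕ._+_ (cubeSum-*ʳ (F ∘ (false ∷_)) c) (cubeSum-*ʳ (F ∘ (true ∷_)) c))
  (sym (ℕ.*-distribʳ-+ c (ℕΣ.cubeSum (F ∘ (false ∷_))) (ℕΣ.cubeSum (F ∘ (true ∷_)))))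

∧-true : ∀ c d → c ∧ d ≡ true → c ≡ true × d ≡ true
∧-true true d p = refl , p

not-true : ∀ {c} → not c ≡ true → c ≡ false
not-true {false} _ = refl

-- The optimal weights are a = m and b = 2 κ T.
optimise : ∀ κ T R X Y m m′ → 1 ≤ R →
  (∀ a b → R * (2 * (a * b)) ≤ κ * (a * a * (X * (2 * T)) ℕ.+ b * b * (Y * (2 * T)))) →
  X * m ≤ R → Y * m′ ≤ R → m * m′ ≤ 2 * κ * T * (2 * κ * T)
optimise zero T R X Y m m′ 1≤R total _ _ =
  contradiction (ℕ.≤-trans (ℕ.*-mono-≤ 1≤R (ℕ.≤-refl {2})) (total 1 1)) λ ()
optimise κ zero R X Y m m′ 1≤R total _ _ =
  contradiction (ℕ.≤-trans (ℕ.*-mono-≤ 1≤R (ℕ.≤-refl {2})) (subst (R * 2 ≤_) (vanish κ X Y) (total 1 1))) λ ()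
  where
  vanish : ∀ κ X Y → κ * (1 * 1 * (X * (2 * 0)) ℕ.+ 1 * 1 * (Y * (2 * 0))) ≡ 0
  vanish = solve-∀
optimise κ@(suc _) T@(suc _) R@(suc _) X Y m m′ _ total mX≤R m′Y≤R =
  ℕ.*-cancelʳ-≤ (m * m′) (2 * κ * T * (2 * κ * T)) R (begin
    m * m′ * R                               ≡⟨ exchange R m m′ ⟩
    m * R * m′                               ≤⟨ ℕ.*-monoˡ-≤ m′ mR≤ ⟩
    2 * κ * T * (2 * κ * T) * Y * m′         ≡⟨ ℕ.*-assoc (2 * κ * T * (2 * κ * T)) Y m′ ⟩
    2 * κ * T * (2 * κ * T) * (Y * m′)       ≤⟨ ℕ.*-monoʳ-≤ (2 * κ * T * (2 * κ * T)) m′Y≤R ⟩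
    2 * κ * T * (2 * κ * T) * R              ∎)
  where
  open ℕ.≤-Reasoning
  exchange : ∀ R m m′ → m * m′ * R ≡ m * R * m′
  exchange = solve-∀
  doubled : ∀ R m → 2 * (m * R) ≡ m * R ℕ.+ m * R
  doubled = solve-∀
  factor-left : ∀ κ R m t → R * (2 * (m * (2 * κ * t))) ≡ 2 * κ * t * (2 * (m * R))
  factor-left = solve-∀
  factor-right : ∀ κ X Y m b t → κ * (m * m * (X * (2 * t)) ℕ.+ b * b * (Y * (2 * t))) ≡ 2 * κ * t * (m * (X * m) ℕ.+ b * b * Y)
  factor-right = solve-∀
  -- With these weights a factor `2 * κ * T` cancels, and `m * (X * m) ≤ m * R` absorbs half of
  -- `2 * (m * R)`. What remains compares `R` with `Y` alone.
  mR≤ : m * R ≤ 2 * κ * T * (2 * κ * T) * Y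
  mR≤ = ℕ.+-cancelˡ-≤ (m * R) (m * R) _ (begin
    m * R ℕ.+ m * R                                    ≡⟨ doubled R m ⟨
    2 * (m * R)
      ≤⟨ ℕ.*-cancelˡ-≤ (2 * κ * T) (subst₂ _≤_ (factor-left κ R m T) (factor-right κ X Y m (2 * κ * T) T) (total m (2 * κ * T))) ⟩
    m * (X * m) ℕ.+ 2 * κ * T * (2 * κ * T) * Y        ≤⟨ ℕ.+-monoˡ-≤ (2 * κ * T * (2 * κ * T) * Y) (ℕ.*-monoʳ-≤ m mX≤R) ⟩
    m * R ℕ.+ 2 * κ * T * (2 * κ * T) * Y              ∎)

1⊓-*-≤ : ∀ k m → (1 ≤ k → m ≤ k) → (1 ⊓ k) * m ≤ k
1⊓-*-≤ zero    m _   = z≤n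
1⊓-*-≤ (suc k) m m≤k = subst (_≤ suc k) (sym (ℕ.*-identityˡ m)) (m≤k (s≤s z≤n))

count-positive : ∀ {n} (p : Fin n → Bool) → 1 ≤ count p → ∃[ i ] p i ≡ true
count-positive {suc n} p 1≤ with p zero in p0
... | true  = zero , p0
... | false = let i , pi = count-positive (p ∘ suc) 1≤ in suc i , pi

-- The inputs g x with x ∈ X are compared with g y for the y one step below X.
-- A bit of g z depends on at most two variables of the cube, so it tells at
-- most two of the neighbours of z apart.
module CubeAdversary
  {M N T : ℕ} (f : Vec Bool N → Bool) (P : Vec Bool N → Fin N → ℝ)
  (P-nonneg : ∀ x i → 0ᵣ ≲ P x i) (sum-P : ∀ x → ℝΣ.sum (P x) ≲ fromℕ T)
  (P-separates : ∀ x y → f x ≢ f y → ∀ a b → fromℕ (2 * (a * b)) ≲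
    36 ·ᵣ ℝΣ.sum λ i → weigh a b (lookup x i xor lookup y i) (P x i) (P y i))
  (g : Vec Bool M → Vec Bool N) (dep : Fin N → Fin M → Bool)
  (local : ∀ z w i → dep i w ≡ false → lookup (g (toggle z w)) i ≡ lookup (g z) i)
  (dep≤2 : ∀ i → count (dep i) ≤ 2)
  (X : Vec Bool M → Bool)
  (f-X : ∀ z → X z ≡ true → f (g z) ≡ false)
  (f-below : ∀ z w → X z ≡ true → lookup z w ≡ true → f (g (toggle z w)) ≡ true)
  where

  below : Vec Bool M → Fin M → Bool
  below y w = not (lookup y w) ∧ X (toggle y w)

  below-toggle : ∀ z w → below (toggle z w) w ≡ lookup z w ∧ X z
  below-toggle z w = cong₂ _∧_
    (trans (cong not (lookup-toggle z w)) (Bool.not-involutive (lookup z w)))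
    (cong X (toggle-toggle z w))

  -- `∣R∣` counts the cube edges between `X` and the points just below it; `∣Y∣` counts those lower
  -- points once each, however many edges they have.
  ∣R∣ ∣X∣ ∣Y∣ : ℕ
  ∣R∣ = ℕΣ.cubeSum λ y → count (below y)
  ∣X∣ = ℕΣ.cubeSum λ x → ind (X x)
  ∣Y∣ = ℕΣ.cubeSum λ y → 1 ⊓ count (below y)

  ∣R∣-from-X : ∣R∣ ≡ ℕΣ.cubeSum λ x → count λ w → lookup x w ∧ X x
  ∣R∣-from-X = trans (ℕΣ.cube-toggle-sum λ y w → ind (below y w))
    (ℕΣ.cubeSum-cong λ z → ℕΣ.sum-cong λ w → cong ind (below-toggle z w))

  -- The total query probability of the bits that may change when variable `w` is toggled.
  G : Fin M → Vec Bool N → ℝ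
  G w x = ℝΣ.sum λ i → mask (dep i w) (P x i)

  G-nonneg : ∀ w x → 0ᵣ ≲ G w x
  G-nonneg w x = ℝΣ.sum-nonneg λ i → mask-nonneg (dep i w) (P-nonneg x i)

  B : ℝ
  B = 2 ·ᵣ fromℕ T

  ·ᵣ-monoˡ : ∀ {m n x} → m ≤ n → 0ᵣ ≲ x → m ·ᵣ x ≲ n ·ᵣ x
  ·ᵣ-monoˡ {n = n} {x} z≤n 0≲x = ≲.trans (≲.reflexive (fromℕ-0-* x)) (0≲fromℕ· n 0≲x)
  ·ᵣ-monoˡ {suc m} {suc n} {x} (s≤s m≤n) 0≲x = begin
    suc m ·ᵣ x       ≈⟨ fromℕ-suc-* m x ⟩
    x +ᵣ m ·ᵣ x      ≲⟨ +ᵣ-mono (≲.refl {x}) (·ᵣ-monoˡ m≤n 0≲x) ⟩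
    x +ᵣ n ·ᵣ x      ≈⟨ fromℕ-suc-* n x ⟨
    suc n ·ᵣ x       ∎
    where open ≲-Reasoning

  -- After the two sums are exchanged, each bit is counted once for every variable it depends on,
  -- hence at most twice; this gives `2 * T` in place of `T`.
  sum-G : ∀ x → (ℝΣ.sum λ w → G w x) ≲ B
  sum-G x = begin
    (ℝΣ.sum λ w → ℝΣ.sum λ i → mask (dep i w) (P x i))   ≈⟨ ℝΣ.∑-comm (λ w i → mask (dep i w) (P x i)) ⟩
    (ℝΣ.sum λ i → ℝΣ.sum λ w → mask (dep i w) (P x i))   ≈⟨ (ℝΣ.sum-cong λ i → sum-mask (dep i) (P x i)) ⟩
    (ℝΣ.sum λ i → count (dep i) ·ᵣ P x i)                ≲⟨ (ℝΣ.sum-mono λ i → ·ᵣ-monoˡ (dep≤2 i) (P-nonneg x i)) ⟩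
    (ℝΣ.sum λ i → 2 ·ᵣ P x i)                            ≈⟨ ℝΣ.*-distribˡ-sum (fromℕ 2) (P x) ⟨
    2 ·ᵣ ℝΣ.sum (P x)                                    ≲⟨ fromℕ*-mono 2 (sum-P x) ⟩
    B                                                    ∎
    where open ≲-Reasoning

  weigh-mask : ∀ a b c d x y → (d ≡ true → c ≡ true) → 0ᵣ ≲ x → 0ᵣ ≲ y →
               weigh a b d x y ≲ (a * a) ·ᵣ mask c x +ᵣ (b * b) ·ᵣ mask c y
  weigh-mask a b true  true  x y _ _ _ = ≲.refl {(a * a) ·ᵣ x +ᵣ (b * b) ·ᵣ y}
  weigh-mask a b false true  x y d⇒c _ _ = contradiction (d⇒c refl) λ ()
  weigh-mask a b c     false x y _ 0≲x 0≲y = ≲.trans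
    (0≲fromℕ· (a * a) (mask-nonneg c 0≲x))
    (x≲x+y (0≲fromℕ· (b * b) (mask-nonneg c 0≲y)))

  -- By `local`, the two inputs at the ends of an edge in direction `w` differ only in bits
  -- depending on `w`, so the mass that separates them is part of `G w`.
  pair-bound : ∀ a b y w → below y w ≡ true →
               fromℕ (2 * (a * b)) ≲ 36 ·ᵣ ((a * a) ·ᵣ G w (g (toggle y w)) +ᵣ (b * b) ·ᵣ G w (g y))
  pair-bound a b y w y<x = begin
    fromℕ (2 * (a * b))
      ≲⟨ P-separates x̂ ŷ f≢ a b ⟩
    36 ·ᵣ (ℝΣ.sum λ i → weigh a b (lookup x̂ i xor lookup ŷ i) (P x̂ i) (P ŷ i))
      ≲⟨ fromℕ*-mono 36 (ℝΣ.sum-mono λ i → weigh-mask a b (dep i w) (lookup x̂ i xor lookup ŷ i) (P x̂ i) (P ŷ i)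
           (dependent i) (P-nonneg x̂ i) (P-nonneg ŷ i)) ⟩
    36 ·ᵣ (ℝΣ.sum λ i → (a * a) ·ᵣ mask (dep i w) (P x̂ i) +ᵣ (b * b) ·ᵣ mask (dep i w) (P ŷ i))
      ≈⟨ Real.*-congˡ {fromℕ 36} (Real.trans
           (ℝΣ.∑-distrib-+ (λ i → (a * a) ·ᵣ mask (dep i w) (P x̂ i)) (λ i → (b * b) ·ᵣ mask (dep i w) (P ŷ i)))
           (Real.sym (Real.+-cong (ℝΣ.*-distribˡ-sum (fromℕ (a * a)) λ i → mask (dep i w) (P x̂ i))
                                  (ℝΣ.*-distribˡ-sum (fromℕ (b * b)) λ i → mask (dep i w) (P ŷ i))))) ⟩
    36 ·ᵣ ((a * a) ·ᵣ G w x̂ +ᵣ (b * b) ·ᵣ G w ŷ)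
      ∎
    where
    open ≲-Reasoning
    x̂ ŷ : Vec Bool N
    x̂ = g (toggle y w)
    ŷ = g y
    Xx : X (toggle y w) ≡ true
    Xx = proj₂ (∧-true (not (lookup y w)) _ y<x)
    y-false : lookup y w ≡ false
    y-false = not-true (proj₁ (∧-true (not (lookup y w)) _ y<x))
    fy : f ŷ ≡ true
    fy = trans (cong (f ∘ g) (sym (toggle-toggle y w)))
      (f-below (toggle y w) w Xx (trans (lookup-toggle y w) (cong not y-false)))
    f≢ : f x̂ ≢ f ŷ
    f≢ eq with trans (sym (f-X (toggle y w) Xx)) (trans eq fy)
    ... | ()
    xor-self : ∀ c → c xor c ≢ true
    xor-self true  ()
    xor-self false ()
    dependent : ∀ i → lookup x̂ i xor lookup ŷ i ≡ true → dep i w ≡ true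
    dependent i differ with dep i w in eq
    ... | true  = refl
    ... | false = contradiction (subst (λ c → c xor lookup ŷ i ≡ true) (local y w i eq) differ) (xor-self (lookup ŷ i))

  double : (Vec Bool M → Fin M → ℝ) → ℝ
  double F = ℝ□.cubeSum λ z → ℝΣ.sum (F z)

  -- Reindexing the edges by their upper end turns the sum at `x` into one over directions `w` of
  -- `G w (g x)`, which `sum-G` bounds by `B`.
  X-side : double (λ y w → mask (below y w) (G w (g (toggle y w)))) ≲ ∣X∣ ·ᵣ B
  X-side = begin
    double (λ y w → mask (below y w) (G w (g (toggle y w))))
      ≈⟨ ℝ□.cube-toggle-sum (λ y w → mask (below y w) (G w (g (toggle y w)))) ⟩
    double (λ x w → mask (below (toggle x w) w) (G w (g (toggle (toggle x w) w))))
      ≲⟨ (ℝ□.cubeSum-mono λ x → ℝΣ.sum-mono λ w → ≲.trans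
           (≲.reflexive (Real.reflexive (cong₂ mask (below-toggle x w) (cong (G w ∘ g) (toggle-toggle x w)))))
           (mask-implies (lookup x w ∧ X x) (X x) (λ e → proj₂ (∧-true (lookup x w) (X x) e)) (G-nonneg w (g x)))) ⟩
    double (λ x w → mask (X x) (G w (g x)))
      ≲⟨ ℝ□.cubeSum-mono (λ x → row (X x) (g x)) ⟩
    (ℝ□.cubeSum λ x → ind (X x) ·ᵣ B)
      ≈⟨ cubeSum-·ᵣ (ind ∘ X) B ⟩
    ∣X∣ ·ᵣ B
      ∎
    where
    open ≲-Reasoning
    row : ∀ c x → (ℝΣ.sum λ w → mask c (G w x)) ≲ ind c ·ᵣ B
    row true  x = ≲.trans (sum-G x) (≲.reflexive (Real.sym (fromℕ-1-* B)))
    row false x = ≲.reflexive (Real.trans (ℝΣ.sum-0 M) (Real.sym (fromℕ-0-* B)))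

  Y-side : double (λ y w → mask (below y w) (G w (g y))) ≲ ∣Y∣ ·ᵣ B
  Y-side = begin
    double (λ y w → mask (below y w) (G w (g y)))
      ≲⟨ (ℝ□.cubeSum-mono λ y → mask-sum (below y) (λ w → G-nonneg w (g y)) (sum-G (g y))) ⟩
    (ℝ□.cubeSum λ y → (1 ⊓ count (below y)) ·ᵣ B)
      ≈⟨ cubeSum-·ᵣ (λ y → 1 ⊓ count (below y)) B ⟩
    ∣Y∣ ·ᵣ B
      ∎
    where open ≲-Reasoning

  double-·ᵣ : ∀ n F → double (λ y w → n ·ᵣ F y w) ≃ n ·ᵣ double F
  double-·ᵣ n F = Real.trans
    (ℝ□.cubeSum-cong λ y → Real.sym (ℝΣ.*-distribˡ-sum (fromℕ n) (F y)))
    (scale-cube λ y → ℝΣ.sum (F y))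
    where
    scale-cube : ∀ {d} (F : Vec Bool d → ℝ) → (ℝ□.cubeSum λ y → n ·ᵣ F y) ≃ n ·ᵣ ℝ□.cubeSum F
    scale-cube {zero}  F = Real.refl {n ·ᵣ F []}
    scale-cube {suc d} F = Real.trans (Real.+-cong (scale-cube (F ∘ (false ∷_))) (scale-cube (F ∘ (true ∷_))))
      (Real.sym (Real.distribˡ (fromℕ n) (ℝ□.cubeSum (F ∘ (false ∷_))) (ℝ□.cubeSum (F ∘ (true ∷_)))))

  mask-·ᵣ : ∀ c n x → mask c (n ·ᵣ x) ≃ n ·ᵣ mask c x
  mask-·ᵣ true  n x = Real.refl {n ·ᵣ x}
  mask-·ᵣ false n x = Real.sym (Real.zeroʳ (fromℕ n))

  -- `pair-bound` summed over all edges of the relation.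
  total-real : ∀ a b → ∣R∣ ·ᵣ fromℕ (2 * (a * b)) ≲ 36 ·ᵣ ((a * a) ·ᵣ (∣X∣ ·ᵣ B) +ᵣ (b * b) ·ᵣ (∣Y∣ ·ᵣ B))
  total-real a b = begin
    ∣R∣ ·ᵣ u
      ≈⟨ Real.trans (ℝ□.cubeSum-cong λ y → sum-mask (below y) u) (cubeSum-·ᵣ (λ y → count (below y)) u) ⟨
    double (λ y w → mask (below y w) u)
      ≲⟨ (ℝ□.cubeSum-mono λ y → ℝΣ.sum-mono λ w → ≲.trans (mask-mono (below y w) (pair-bound a b y w)) (≲.reflexive (distribute y w))) ⟩
    double (λ y w → 36 ·ᵣ ((a * a) ·ᵣ F₁ y w +ᵣ (b * b) ·ᵣ F₂ y w))
      ≈⟨ double-·ᵣ 36 (λ y w → (a * a) ·ᵣ F₁ y w +ᵣ (b * b) ·ᵣ F₂ y w) ⟩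
    36 ·ᵣ double (λ y w → (a * a) ·ᵣ F₁ y w +ᵣ (b * b) ·ᵣ F₂ y w)
      ≈⟨ Real.*-congˡ {fromℕ 36} (Real.trans
           (ℝ□.cubeSum-cong λ y → ℝΣ.∑-distrib-+ (λ w → (a * a) ·ᵣ F₁ y w) (λ w → (b * b) ·ᵣ F₂ y w))
           (Real.trans (ℝ□.cubeSum-+ (λ y → ℝΣ.sum λ w → (a * a) ·ᵣ F₁ y w) (λ y → ℝΣ.sum λ w → (b * b) ·ᵣ F₂ y w))
             (Real.+-cong (double-·ᵣ (a * a) F₁) (double-·ᵣ (b * b) F₂)))) ⟩
    36 ·ᵣ ((a * a) ·ᵣ double F₁ +ᵣ (b * b) ·ᵣ double F₂)
      ≲⟨ fromℕ*-mono 36 (+ᵣ-mono (fromℕ*-mono (a * a) X-side) (fromℕ*-mono (b * b) Y-side)) ⟩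
    36 ·ᵣ ((a * a) ·ᵣ (∣X∣ ·ᵣ B) +ᵣ (b * b) ·ᵣ (∣Y∣ ·ᵣ B))
      ∎
    where
    open ≲-Reasoning
    u = fromℕ (2 * (a * b))
    F₁ F₂ : Vec Bool M → Fin M → ℝ
    F₁ y w = mask (below y w) (G w (g (toggle y w)))
    F₂ y w = mask (below y w) (G w (g y))
    distribute : ∀ y w → mask (below y w) (36 ·ᵣ ((a * a) ·ᵣ G w (g (toggle y w)) +ᵣ (b * b) ·ᵣ G w (g y)))
                         ≃ 36 ·ᵣ ((a * a) ·ᵣ F₁ y w +ᵣ (b * b) ·ᵣ F₂ y w)
    distribute y w = Real.trans (mask-·ᵣ (below y w) 36 _) (Real.*-congˡ {fromℕ 36}
      (Real.trans (mask-+ (below y w) ((a * a) ·ᵣ G w (g (toggle y w))) ((b * b) ·ᵣ G w (g y)))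
        (Real.+-cong (mask-·ᵣ (below y w) (a * a) (G w (g (toggle y w)))) (mask-·ᵣ (below y w) (b * b) (G w (g y))))))

  total : ∀ a b → ∣R∣ * (2 * (a * b)) ≤ 36 * (a * a * (∣X∣ * (2 * T)) ℕ.+ b * b * (∣Y∣ * (2 * T)))
  total a b = fromℕ-cancel-≤ (≲.trans (≲.reflexive (fromℕ-homo-* ∣R∣ (2 * (a * b))))
    (≲.trans (total-real a b) (≲.reflexive (Real.sym nat))))
    where
    part : ∀ c n → fromℕ (c * (n * (2 * T))) ≃ c ·ᵣ (n ·ᵣ B)
    part c n = Real.trans (fromℕ-homo-* c (n * (2 * T))) (Real.*-congˡ {fromℕ c}
      (Real.trans (fromℕ-homo-* n (2 * T)) (Real.*-congˡ {fromℕ n} (fromℕ-homo-* 2 T))))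
    nat : fromℕ (36 * (a * a * (∣X∣ * (2 * T)) ℕ.+ b * b * (∣Y∣ * (2 * T)))) ≃ 36 ·ᵣ ((a * a) ·ᵣ (∣X∣ ·ᵣ B) +ᵣ (b * b) ·ᵣ (∣Y∣ ·ᵣ B))
    nat = Real.trans (fromℕ-homo-* 36 (a * a * (∣X∣ * (2 * T)) ℕ.+ b * b * (∣Y∣ * (2 * T))))
      (Real.*-congˡ {fromℕ 36} (Real.trans (fromℕ-homo-+ (a * a * (∣X∣ * (2 * T))) (b * b * (∣Y∣ * (2 * T))))
        (Real.+-cong (part (a * a) ∣X∣) (part (b * b) ∣Y∣))))

  -- Every `true` entry of a point in `X` leads down to a 1-input, so `count (lookup x)` is the
  -- degree of `x`. A lower point may also have upper neighbours outside `X`, so its degree is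
  -- `count (below y)`.
  module _ (x₀ : Vec Bool M) (x₀∈X : X x₀ ≡ true) (m m′ : ℕ)
    (X-degree : ∀ x → X x ≡ true → m ≤ count (lookup x))
    (Y-degree : ∀ y w → below y w ≡ true → m′ ≤ count (below y))
    where

    m∣X∣≤∣R∣ : ∣X∣ * m ≤ ∣R∣
    m∣X∣≤∣R∣ = subst₂ _≤_ (cubeSum-*ʳ (ind ∘ X) m) (sym ∣R∣-from-X) (ℕΣ.cubeSum-mono λ x → row x (X x) refl)
      where
      row : ∀ x c → X x ≡ c → ind c * m ≤ count (λ w → lookup x w ∧ c)
      row x false _  = z≤n
      row x true  Xx = subst₂ _≤_ (sym (ℕ.*-identityˡ m))
        (ℕΣ.sum-cong λ w → cong ind (sym (Bool.∧-identityʳ (lookup x w)))) (X-degree x Xx)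

    m′∣Y∣≤∣R∣ : ∣Y∣ * m′ ≤ ∣R∣
    m′∣Y∣≤∣R∣ = subst (_≤ ∣R∣) (cubeSum-*ʳ (λ y → 1 ⊓ count (below y)) m′) (ℕΣ.cubeSum-mono row)
      where
      row : ∀ y → (1 ⊓ count (below y)) * m′ ≤ count (below y)
      row y = 1⊓-*-≤ (count (below y)) m′ λ 1≤k →
        let w , y<x = count-positive (below y) 1≤k in Y-degree y w y<x

    -- If `m` is positive, the point `x₀` makes the relation nonempty, so that `∣R∣` can be
    -- cancelled in `optimise`.
    adversary-bound : m * m′ ≤ 72 * T * (72 * T)
    adversary-bound = by-cases m refl
      where
      by-cases : ∀ k → k ≡ m → m * m′ ≤ 72 * T * (72 * T)
      by-cases zero    refl = z≤n
      by-cases (suc k) refl = optimise 36 T ∣R∣ ∣X∣ ∣Y∣ m m′ ∣R∣>0 total m∣X∣≤∣R∣ m′∣Y∣≤∣R∣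
        where
        ∣R∣>0 : 1 ≤ ∣R∣
        ∣R∣>0 = ℕ.≤-trans (subst (λ c → 1 ≤ ind c * m) (sym x₀∈X) (s≤s z≤n))
          (ℕ.≤-trans (ℕ.*-monoˡ-≤ m (cubeSum-≥ (ind ∘ X) x₀)) m∣X∣≤∣R∣)

-- Counting

true⇒ : ∀ {P : Set} (P? : Dec P) → does P? ≡ true → P
true⇒ (yes p) _ = p

false⇒ : ∀ {P : Set} (P? : Dec P) → does P? ≡ false → ¬ P
false⇒ (no ¬p) _ = ¬p

ind-mono : ∀ {c d} → (c ≡ true → d ≡ true) → ind c ≤ ind d
ind-mono {false} _   = z≤n
ind-mono {true}  c⇒d = ℕ.≤-reflexive (cong ind (sym (c⇒d refl)))

count-mono : ∀ {n} {p q : Fin n → Bool} → (∀ i → p i ≡ true → q i ≡ true) → count p ≤ count q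
count-mono p⇒q = ℕΣ.sum-mono λ i → ind-mono (p⇒q i)

count-cong : ∀ {n} {p q : Fin n → Bool} → (∀ i → p i ≡ q i) → count p ≡ count q
count-cong p≗q = ℕΣ.sum-cong λ i → cong ind (p≗q i)

count-∪ : ∀ {n} {p q r : Fin n → Bool} → (∀ i → p i ≡ true → q i ≡ true ⊎ r i ≡ true) →
          count p ≤ count q ℕ.+ count r
count-∪ {p = p} {q} {r} p⇒q∨r = ℕ.≤-trans (ℕΣ.sum-mono λ i → step (p⇒q∨r i))
  (ℕ.≤-reflexive (ℕΣ.∑-distrib-+ (ind ∘ q) (ind ∘ r)))
  where
  step : ∀ {c d e} → (c ≡ true → d ≡ true ⊎ e ≡ true) → ind c ≤ ind d ℕ.+ ind e
  step {false} _ = z≤n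
  step {true} {d} {e} c⇒ with c⇒ refl
  ... | inj₁ refl = s≤s z≤n
  ... | inj₂ refl = ℕ.m≤n+m 1 (ind d)

count-split : ∀ {n} (p q : Fin n → Bool) →
              count p ≡ count (λ i → p i ∧ q i) ℕ.+ count (λ i → p i ∧ not (q i))
count-split p q = trans (ℕΣ.sum-cong λ i → step (p i) (q i))
  (ℕΣ.∑-distrib-+ (λ i → ind (p i ∧ q i)) (λ i → ind (p i ∧ not (q i))))
  where
  step : ∀ c d → ind c ≡ ind (c ∧ d) ℕ.+ ind (c ∧ not d)
  step false d     = refl
  step true  true  = refl
  step true  false = refl

count-true : ∀ n → count {n} (λ _ → true) ≡ n
count-true zero    = refl
count-true (suc n) = cong suc (count-true n)

count-false : ∀ n → count {n} (λ _ → false) ≡ 0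
count-false n = ℕΣ.sum-0 n

count-not : ∀ {n} (p : Fin n → Bool) → count p ℕ.+ count (not ∘ p) ≡ n
count-not p = trans (sym (count-split (λ _ → true) p)) (count-true _)

count-≟ : ∀ {n} (i : Fin n) → count (λ j → does (j Fin.≟ i)) ≡ 1
count-≟ {suc n} zero    = cong suc (count-false n)
count-≟ {suc n} (suc i) = trans (count-cong λ j → map-suc j) (count-≟ i)
  where
  map-suc : ∀ j → does (suc j Fin.≟ suc i) ≡ does (j Fin.≟ i)
  map-suc j = refl

count-permute : ∀ {n} (p : Fin n → Bool) (π : Permutation′ n) → count (p ∘ (π ⟨$⟩ʳ_)) ≡ count p
count-permute p π = sym (sum-permute (ind ∘ p) π)
  where open import Algebra.Properties.CommutativeMonoid.Sum ℕ.+-0-commutativeMonoid using (sum-permute)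

count-++ : ∀ m {n} (p : Fin (m ℕ.+ n) → Bool) → count p ≡ count (λ i → p (i ↑ˡ n)) ℕ.+ count (λ j → p (m ↑ʳ j))
count-++ zero    p = refl
count-++ (suc m) p = trans (cong (ind (p zero) ℕ.+_) (count-++ m (p ∘ suc)))
  (sym (ℕ.+-assoc (ind (p zero)) _ _))

count-combine : ∀ m {n} (p : Fin (m * n) → Bool) → count p ≡ ℕΣ.sum λ (i : Fin m) → count λ j → p (combine i j)
count-combine zero    p = refl
count-combine (suc m) {n} p = trans (count-++ n p)
  (cong (count (λ j → p (j ↑ˡ (m * n))) ℕ.+_) (count-combine m (λ k → p (n ↑ʳ k))))

sum-≥ : ∀ {n} (h : Fin n → ℕ) i → h i ≤ ℕΣ.sum h
sum-≥ h zero    = ℕ.m≤m+n _ _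
sum-≥ h (suc i) = ℕ.≤-trans (sum-≥ (h ∘ suc) i) (ℕ.m≤n+m _ _)

sum-const-≤ : ∀ {n} (h : Fin n → ℕ) c → (∀ i → c ≤ h i) → n * c ≤ ℕΣ.sum h
sum-const-≤ {zero}  h c c≤h = z≤n
sum-const-≤ {suc n} h c c≤h = ℕ.+-mono-≤ (c≤h zero) (sum-const-≤ (h ∘ suc) c (c≤h ∘ suc))

∣∣-count : ∀ {n} (S : Subset n) → ∣ S ∣ ≡ count (lookup S)
∣∣-count []          = refl
∣∣-count (true  ∷ S) = cong suc (∣∣-count S)
∣∣-count (false ∷ S) = ∣∣-count S

subset-of-size : ∀ {n} (p : Fin n → Bool) d → d ≤ count p →
                 Σ[ q ∈ (Fin n → Bool) ] (∀ i → q i ≡ true → p i ≡ true) × count q ≡ d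
subset-of-size {n} p zero _ = (λ _ → false) , (λ _ ()) , count-false n
subset-of-size {suc n} p (suc d) d<p with p zero in p0
... | true = let q , q⇒p , #q = subset-of-size (p ∘ suc) d (ℕ.s≤s⁻¹ d<p) in
  (λ { zero → true ; (suc i) → q i }) , (λ { zero _ → p0 ; (suc i) → q⇒p i }) , cong suc #q
... | false = let q , q⇒p , #q = subset-of-size (p ∘ suc) (suc d) d<p in
  (λ { zero → false ; (suc i) → q i }) , (λ { zero () ; (suc i) → q⇒p i }) , #q

-- The first point is sent to some point of its own colour, both are removed, and the class sizes
-- still agree. The embeddings of `H` constructed below come from this, so that building one reduces
-- to comparing class sizes.
recolour : ∀ {K : Set} (_≟ᴷ_ : DecidableEquality K) {n} (c c′ : Fin n → K) →
           (∀ k → count (λ i → does (c i ≟ᴷ k)) ≡ count (λ i → does (c′ i ≟ᴷ k))) →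
           Σ[ π ∈ Permutation′ n ] ∀ i → c′ (π ⟨$⟩ʳ i) ≡ c i
recolour _≟ᴷ_ {zero}  c c′ same = Perm.id , λ ()
recolour _≟ᴷ_ {suc n} c c′ same = insert zero j (proj₁ rest) , λ
  { zero    → c′j
  ; (suc i) → trans (cong c′ (insert-punchIn zero j (proj₁ rest) i)) (proj₂ rest i)
  }
  where
  open import Algebra.Properties.CommutativeMonoid.Sum ℕ.+-0-commutativeMonoid using (sum-remove)
  is : _ → _ → Bool
  is k k′ = does (k ≟ᴷ k′)
  found : ∃[ j ] is (c′ j) (c zero) ≡ true
  found = count-positive (λ i → is (c′ i) (c zero)) (subst (1 ≤_) (same (c zero))
    (ℕ.≤-trans (ℕ.≤-reflexive (cong ind (sym (dec-true (c zero ≟ᴷ c zero) refl)))) (ℕ.m≤m+n _ _)))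
  j : Fin (suc n)
  j = proj₁ found
  c′j : c′ j ≡ c zero
  c′j = true⇒ (c′ j ≟ᴷ c zero) (proj₂ found)
  rest : Σ[ π ∈ Permutation′ n ] ∀ i → c′ (punchIn j (π ⟨$⟩ʳ i)) ≡ c (suc i)
  rest = recolour _≟ᴷ_ (c ∘ suc) (c′ ∘ punchIn j) λ k → ℕ.+-cancelˡ-≡ (ind (is (c zero) k)) _ _
    (trans (same k) (trans (sum-remove {i = j} λ i → ind (is (c′ i) k))
      (cong (λ x → ind (is x k) ℕ.+ count (λ i → is (c′ (punchIn j i)) k)) c′j)))

-- Graphs given by Boolean adjacency functions

encode : ∀ {n} → (Fin n → Fin n → Bool) → Vec Bool (n C 2)
encode {n} E = tabulate λ k → E (proj₁ (endpoints {n} k)) (proj₂ (endpoints {n} k))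

inject-< : ∀ {n} {i : Fin n} (j : Fin′ i) → toℕ (inject j) ℕ.< toℕ i
inject-< {i = suc i} zero    = s≤s z≤n
inject-< {i = suc i} (suc j) = s≤s (inject-< j)

endpoints-≢ : ∀ {n} k → proj₁ (endpoints {n} k) ≢ proj₂ (endpoints {n} k)
endpoints-≢ {n} k eq = ℕ.<-irrefl (cong toℕ eq) (inject-< (proj₂ (Inverse.to (slots n) k)))

uninject : ∀ {n} {u v : Fin n} → toℕ u ℕ.< toℕ v → Σ[ j ∈ Fin′ v ] inject j ≡ u
uninject {u = zero}  {suc v} _         = zero , refl
uninject {u = suc u} {suc v} (s≤s u<v) = let j , eq = uninject u<v in suc j , cong suc eq

slot-< : ∀ {n} {u v : Fin n} → toℕ u ℕ.< toℕ v → ∃[ k ] endpoints {n} k ≡ (u , v)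
slot-< {n} {u} {v} u<v =
  let j , eq = uninject u<v
  in Inverse.from (slots n) (v , j) ,
     trans (cong ends (Inverse.inverseˡ (slots n) {v , j} refl)) (cong (_, v) eq)
  where
  ends : Σ (Fin n) Fin′ → Fin n × Fin n
  ends (v , u) = inject u , v

slot : ∀ {n} {u v : Fin n} → u ≢ v → ∃[ k ] (endpoints {n} k ≡ (u , v) ⊎ endpoints {n} k ≡ (v , u))
slot {n} {u} {v} u≢v with ℕ.<-cmp (toℕ u) (toℕ v)
... | tri< u<v _ _ = let k , eq = slot-< u<v in k , inj₁ eq
... | tri≈ _ u≡v _ = contradiction (Fin.toℕ-injective u≡v) u≢v
... | tri> _ _ v<u = let k , eq = slot-< v<u in k , inj₂ eq

lookup-encode : ∀ {n} E k → lookup (encode {n} E) k ≡ E (proj₁ (endpoints {n} k)) (proj₂ (endpoints {n} k))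
lookup-encode {n} E k = Vec.lookup∘tabulate (λ k → E (proj₁ (endpoints {n} k)) (proj₂ (endpoints {n} k))) k

module _ {n} (E : Fin n → Fin n → Bool) (E-sym : ∀ u v → E u v ≡ E v u) where

  Adj-encode⁺ : ∀ {u v} → u ≢ v → E u v ≡ true → Adj (graph (encode E)) u v
  Adj-encode⁺ {u} {v} u≢v Euv with slot u≢v
  ... | k , inj₁ eq = k , trans (lookup-encode E k) (trans (cong (λ (u , v) → E u v) eq) Euv) , inj₁ eq
  ... | k , inj₂ eq = k , trans (lookup-encode E k) (trans (cong (λ (u , v) → E u v) eq) (trans (E-sym v u) Euv)) , inj₂ eq

  Adj-encode⁻ : ∀ {u v} → Adj (graph (encode E)) u v → E u v ≡ true
  Adj-encode⁻ {u} {v} (k , bit , inj₁ eq) = trans (cong (λ (u , v) → E u v) (sym eq)) (trans (sym (lookup-encode E k)) bit)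
  Adj-encode⁻ {u} {v} (k , bit , inj₂ eq) = trans (E-sym u v)
    (trans (cong (λ (u , v) → E u v) (sym eq)) (trans (sym (lookup-encode E k)) bit))

module _ {n} {G : Graph n} where

  Adj-sym : ∀ {u v} → Adj G u v → Adj G v u
  Adj-sym (k , bit , inj₁ eq) = k , bit , inj₂ eq
  Adj-sym (k , bit , inj₂ eq) = k , bit , inj₁ eq

  Adj-irrefl : ∀ {u v} → Adj G u v → u ≢ v
  Adj-irrefl (k , _ , inj₁ eq) refl = endpoints-≢ {n} k (trans (cong proj₁ eq) (sym (cong proj₂ eq)))
  Adj-irrefl (k , _ , inj₂ eq) refl = endpoints-≢ {n} k (trans (cong proj₁ eq) (sym (cong proj₂ eq)))

-- The required subgraph is the image of `H` under `π`.
⊑-intro : ∀ {n} {H G : Graph n} (π : Permutation′ n) →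
          (∀ u v → Adj H u v → Adj G (π ⟨$⟩ʳ u) (π ⟨$⟩ʳ v)) → H ⊑ G
⊑-intro {n} {H} {G} π embeds = graph (encode E) , (π , λ u v → mk⇔ (to u v) (from u v)) , sub
  where
  E : Fin n → Fin n → Bool
  E u v = does (adj? H (π ⟨$⟩ˡ u) (π ⟨$⟩ˡ v))
  E-sym : ∀ u v → E u v ≡ E v u
  E-sym u v with adj? H (π ⟨$⟩ˡ u) (π ⟨$⟩ˡ v) | adj? H (π ⟨$⟩ˡ v) (π ⟨$⟩ˡ u)
  ... | yes _ | yes _ = refl
  ... | no  _ | no  _ = refl
  ... | yes p | no ¬p = contradiction (Adj-sym {G = H} p) ¬p
  ... | no ¬p | yes p = contradiction (Adj-sym {G = H} p) ¬p
  back : ∀ u v → Adj (graph (encode E)) u v → Adj H (π ⟨$⟩ˡ u) (π ⟨$⟩ˡ v)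
  back u v e = true⇒ (adj? H _ _) (Adj-encode⁻ E E-sym e)
  to : ∀ u v → Adj H u v → Adj (graph (encode E)) (π ⟨$⟩ʳ u) (π ⟨$⟩ʳ v)
  to u v e = Adj-encode⁺ E E-sym
    (λ eq → Adj-irrefl {G = H} e (trans (sym (inverseˡ π)) (trans (cong (π ⟨$⟩ˡ_) eq) (inverseˡ π))))
    (dec-true (adj? H _ _) (subst₂ (Adj H) (sym (inverseˡ π)) (sym (inverseˡ π)) e))
  from : ∀ u v → Adj (graph (encode E)) (π ⟨$⟩ʳ u) (π ⟨$⟩ʳ v) → Adj H u v
  from u v e = subst₂ (Adj H) (inverseˡ π) (inverseˡ π) (back _ _ e)
  sub : graph (encode E) ⊆ G
  sub u v e = subst₂ (Adj G) (inverseʳ π) (inverseʳ π) (embeds _ _ (back u v e))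

⊑-elim : ∀ {n} {H G : Graph n} → H ⊑ G →
         Σ[ π ∈ Permutation′ n ] ∀ u v → Adj H u v → Adj G (π ⟨$⟩ʳ u) (π ⟨$⟩ʳ v)
⊑-elim (S , (π , iso) , S⊆G) = π , λ u v e → S⊆G _ _ (Equivalence.to (iso u v) e)

f-true : ∀ {n} (H : Graph n) x → H ⊑ graph x → f[ H ] x ≡ true
f-true H x = dec-true (H ⊑? graph x)

f-false : ∀ {n} (H : Graph n) x → ¬ (H ⊑ graph x) → f[ H ] x ≡ false
f-false H x = dec-false (H ⊑? graph x)

-- Independent sets

IndependentSet : ∀ {n} → Graph n → (Fin n → Bool) → Set
IndependentSet H p = ∀ u v → p u ≡ true → p v ≡ true → ¬ Adj H u v

subsets-complete : ∀ {n} (S : Subset n) → S List.∈ subsets n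
subsets-complete []          = Any.here refl
subsets-complete {suc n} (false ∷ S) = List.∈-++⁺ˡ (List.∈-map⁺ (outside ∷_) (subsets-complete S))
subsets-complete {suc n} (true  ∷ S) = List.∈-++⁺ʳ (List.map (outside ∷_) (subsets n)) (List.∈-map⁺ (inside ∷_) (subsets-complete S))

independent≤α : ∀ {n} (H : Graph n) p → IndependentSet H p → count p ≤ α H
independent≤α {n} H p p-indep = subst (_≤ α H) size
  (All.lookup (Extrema.xs≤max 0 (List.map ∣_∣ (List.filter (independent? H) (subsets n))))
    (List.∈-map⁺ ∣_∣ (List.∈-filter⁺ (independent? H) (subsets-complete (tabulate p)) indep)))
  where
  member : ∀ {u} → u ∈ tabulate p → p u ≡ true
  member {u} u∈ = trans (sym (Vec.lookup∘tabulate p u)) (Vec.[]=⇒lookup u∈)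
  indep : Independent H (tabulate p)
  indep u v u∈ v∈ = p-indep u v (member u∈) (member v∈)
  size : ∣ tabulate p ∣ ≡ count p
  size = trans (∣∣-count (tabulate p)) (count-cong (Vec.lookup∘tabulate p))

maximum-independent : ∀ {n} (H : Graph n) → Σ[ I ∈ (Fin n → Bool) ] IndependentSet H I × count I ≡ α H
maximum-independent {n} H with Extrema.argmax-sel (λ k → k) 0 (List.map ∣_∣ (List.filter (independent? H) (subsets n)))
-- Here the maximum is its default value 0, which the empty set attains.
... | inj₁ α≡0 = (λ _ → false) , (λ _ _ ()) , trans (count-false n) (sym α≡0)
... | inj₂ α∈  with List.∈-map⁻ ∣_∣ α∈
...   | S , S∈ , α≡∣S∣ = lookup S
  , (λ u v u∈ v∈ → proj₂ (List.∈-filter⁻ (independent? H) {xs = subsets n} S∈) u v (Vec.lookup⇒[]= u S u∈) (Vec.lookup⇒[]= v S v∈))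
  , trans (sym (∣∣-count S)) (sym α≡∣S∣)

-- Pulled back along an embedding, an independent set of `G` is independent in `H` and keeps its
-- size.
large-independent : ∀ {n} (H G : Graph n) p → IndependentSet G p → α H ℕ.< count p → ¬ (H ⊑ G)
large-independent H G p p-indep α<p H⊑G =
  let π , embeds = ⊑-elim {H = H} {G} H⊑G in ℕ.<⇒≱ α<p (subst (_≤ α H) (count-permute p π)
    (independent≤α H (p ∘ (π ⟨$⟩ʳ_)) λ u v pu pv e → p-indep _ _ pu pv (embeds u v e)))

-- The interface to the quantum part: the constructions below only have to supply a family of graphs
-- over a cube, a set `X` of 0-inputs whose lower neighbours are 1-inputs, and the two degrees.
cube-adversary : ∀ {M N T} {f : Vec Bool N → Bool} (A : Algorithm N T) → A Computes f →
  (g : Vec Bool M → Vec Bool N) (dep : Fin N → Fin M → Bool) →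
  (∀ z w i → dep i w ≡ false → lookup (g (toggle z w)) i ≡ lookup (g z) i) →
  (∀ i → count (dep i) ≤ 2) →
  (X : Vec Bool M → Bool) →
  (∀ x → X x ≡ true → f (g x) ≡ false) →
  (∀ x w → X x ≡ true → lookup x w ≡ true → f (g (toggle x w)) ≡ true) →
  ∀ x₀ → X x₀ ≡ true → ∀ m m′ →
  (∀ x → X x ≡ true → m ≤ count (lookup x)) →
  (∀ y w → not (lookup y w) ∧ X (toggle y w) ≡ true → m′ ≤ count λ w′ → not (lookup y w′) ∧ X (toggle y w′)) →
  m * m′ ≤ 72 * T * (72 * T)
cube-adversary {M} {N} {T} {f} A computes g dep local dep≤2 X f-X f-below x₀ x₀∈X m m′ X-degree Y-degree =
  let P , P-nonneg , sum-P , P-separates = query-weights A f computes in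
  CubeAdversary.adversary-bound {M} {N} {T} f P P-nonneg sum-P P-separates g dep local dep≤2 X f-X f-below
    x₀ x₀∈X m m′ X-degree Y-degree

count-flip : ∀ {n} {p q : Fin n → Bool} j → p j ≡ true → q j ≡ false → (∀ i → i ≢ j → q i ≡ p i) →
             count p ≡ suc (count q)
count-flip {p = p} {q} j pj qj q≗p = trans (count-split p is-j)
  (cong₂ ℕ._+_ (trans (count-cong at-j) (count-≟ j)) (count-cong off-j))
  where
  is-j : _ → Bool
  is-j i = does (i Fin.≟ j)
  at-j : ∀ i → p i ∧ is-j i ≡ is-j i
  at-j i with i Fin.≟ j
  ... | yes refl = trans (Bool.∧-identityʳ (p j)) pj
  ... | no  _    = Bool.∧-zeroʳ (p i)
  off-j : ∀ i → p i ∧ not (is-j i) ≡ q i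
  off-j i with i Fin.≟ j
  ... | yes refl = trans (Bool.∧-zeroʳ (p j)) (sym qj)
  ... | no  i≢j  = trans (Bool.∧-identityʳ (p i)) (sym (q≗p i i≢j))

lookup-toggle-≢ : ∀ {M} (z : Vec Bool M) {w i} → i ≢ w → lookup (toggle z w) i ≡ lookup z i
lookup-toggle-≢ z {w} {i} i≢w = Vec.lookup∘updateAt′ i w i≢w z

count-toggle-true : ∀ {M} (z : Vec Bool M) w → lookup z w ≡ true → count (lookup z) ≡ suc (count (lookup (toggle z w)))
count-toggle-true z w zw = count-flip w zw (trans (lookup-toggle z w) (cong not zw)) λ i → lookup-toggle-≢ z

count-toggle-false : ∀ {M} (z : Vec Bool M) w → lookup z w ≡ false → count (lookup (toggle z w)) ≡ suc (count (lookup z))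
count-toggle-false z w zw = count-flip w (trans (lookup-toggle z w) (cong not zw)) zw λ i i≢w → sym (lookup-toggle-≢ z i≢w)

count-≥1 : ∀ {n} (p : Fin n → Bool) i → p i ≡ true → 1 ≤ count p
count-≥1 p i pi = ℕ.≤-trans (ℕ.≤-reflexive (cong ind (sym pi))) (sum-≥ (ind ∘ p) i)

count-4 : ∀ {n} (c : Fin n → Fin 4) → let # k = count (λ i → does (c i Fin.≟ k)) in
          n ≡ # zero ℕ.+ # (suc zero) ℕ.+ # (suc (suc zero)) ℕ.+ # (suc (suc (suc zero)))
count-4 {zero}  c = refl
count-4 {suc n} c = trans (cong suc (count-4 (c ∘ suc))) (shift (c zero) _ _ _ _)
  where
  at : Fin 4 → Fin 4 → ℕ
  at j k = ind (does (j Fin.≟ k))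
  shift : ∀ j x y z w → suc (x ℕ.+ y ℕ.+ z ℕ.+ w) ≡
    (at j zero ℕ.+ x) ℕ.+ (at j (suc zero) ℕ.+ y) ℕ.+ (at j (suc (suc zero)) ℕ.+ z) ℕ.+ (at j (suc (suc (suc zero))) ℕ.+ w)
  shift zero                   x y z w = refl
  shift (suc zero)             x y z w = cong (λ t → t ℕ.+ z ℕ.+ w) (sym (ℕ.+-suc x y))
  shift (suc (suc zero))       x y z w = cong (ℕ._+ w) (sym (ℕ.+-suc (x ℕ.+ y) z))
  shift (suc (suc (suc zero))) x y z w = sym (ℕ.+-suc (x ℕ.+ y ℕ.+ z) w)

∧-intro : ∀ {c d} → c ≡ true → d ≡ true → c ∧ d ≡ true
∧-intro refl refl = refl

true≢false : ∀ {c} → c ≡ true → c ≢ false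
true≢false refl ()

-- Embedding `H` around a star

module Pattern {n} (H : Graph n) (I : Fin n → Bool) (I-indep : IndependentSet H I)
  (v₁ : Fin n) (v₁∉I : I v₁ ≡ false) where

  adj : Fin n → Fin n → Bool
  adj u v = does (adj? H u v)

  degree : Fin n → ℕ
  degree u = count λ w → I w ∧ adj u w

  -- A host graph that is complete outside J contains H as soon as some
  -- v₀ ∈ J has as many neighbours in J as v₁ has in I.
  module _ (E : Fin n → Fin n → Bool) (E-sym : ∀ u v → E u v ≡ E v u)
    (J : Fin n → Bool) (#J : count J ≡ suc (count I))
    (full : ∀ u v → J u ∧ J v ≡ false → E u v ≡ true)
    (v₀ : Fin n) (v₀∈J : J v₀ ≡ true)
    (rich : degree v₁ ≤ count λ w → J w ∧ (E v₀ w ∧ not (does (w Fin.≟ v₀))))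
    where

    private
      -- Surplus neighbours of `v₀` are dropped, so that there are exactly as many leaves as `v₁`
      -- has neighbours in `I`.
      star : Σ[ D ∈ (Fin n → Bool) ] (∀ w → D w ≡ true → J w ∧ (E v₀ w ∧ not (does (w Fin.≟ v₀))) ≡ true)
               × count D ≡ degree v₁
      star = subset-of-size _ (degree v₁) rich
      D : Fin n → Bool
      D = proj₁ star
      D⊆J : ∀ w → D w ≡ true → J w ≡ true
      D⊆J w Dw = proj₁ (∧-true (J w) _ (proj₁ (proj₂ star) w Dw))
      D⊆E : ∀ w → D w ≡ true → E v₀ w ≡ true
      D⊆E w Dw = proj₁ (∧-true (E v₀ w) _ (proj₂ (∧-true (J w) _ (proj₁ (proj₂ star) w Dw))))
      v₀∉D : D v₀ ≡ false
      v₀∉D with D v₀ in eq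
      ... | false = refl
      ... | true  = contradiction (dec-true (v₀ Fin.≟ v₀) refl) (λ e → true≢false
              (proj₂ (∧-true (E v₀ v₀) _ (proj₂ (∧-true (J v₀) _ (proj₁ (proj₂ star) v₀ eq))))) (cong not e))

      centre leaf rest outer : Fin 4
      centre = zero
      leaf   = suc zero
      rest   = suc (suc zero)
      outer  = suc (suc (suc zero))

      -- In `H` the four classes are v₁, its neighbours in `I`, the rest of `I`, and all other
      -- vertices. In the host they are v₀, `D`, the rest of `J`, and the complement of `J`.
      colour : Bool → Bool → Bool → Fin 4
      colour true  _     _     = centre
      colour false true  true  = leaf
      colour false true  false = rest
      colour false false _     = outer

      module Colouring (v : Fin n) (S L : Fin n → Bool) where
        c : Fin n → Fin 4
        c w = colour (does (w Fin.≟ v)) (S w) (L w)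
        # : Fin 4 → ℕ
        # k = count λ w → does (c w Fin.≟ k)
        #centre : # centre ≡ 1
        #centre = trans (count-cong λ w → step (does (w Fin.≟ v)) (S w) (L w)) (count-≟ v)
          where
          step : ∀ x y z → does (colour x y z Fin.≟ centre) ≡ x
          step true  _     _     = refl
          step false true  true  = refl
          step false true  false = refl
          step false false _     = refl
        #leaf : L v ≡ false → (∀ w → L w ≡ true → S w ≡ true) → # leaf ≡ count L
        #leaf v∉L L⊆S = count-cong λ w → step w (w Fin.≟ v) (S w) (L w) refl (L⊆S w)
          where
          step : ∀ w (w≟v : Dec (w ≡ v)) y z → L w ≡ z → (z ≡ true → y ≡ true) → does (colour (does w≟v) y z Fin.≟ leaf) ≡ z
          step w (yes refl) _     z     Lw _   = trans (sym v∉L) Lw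
          step w (no _)     true  true  _  _   = refl
          step w (no _)     true  false _  _   = refl
          step w (no _)     false false _  _   = refl
          step w (no _)     false true  _  z⇒y = contradiction (z⇒y refl) λ ()
        #leaf+rest : ∀ s → count S ≡ s → S v ≡ false → # leaf ℕ.+ # rest ≡ s
        #leaf+rest s #S v∉S = trans (sym (ℕΣ.∑-distrib-+ (λ w → ind (does (c w Fin.≟ leaf))) (λ w → ind (does (c w Fin.≟ rest)))))
          (trans (ℕΣ.sum-cong λ w → step w (w Fin.≟ v) (S w) (L w) refl) #S)
          where
          step : ∀ w (w≟v : Dec (w ≡ v)) y z → S w ≡ y →
            ind (does (colour (does w≟v) y z Fin.≟ leaf)) ℕ.+ ind (does (colour (does w≟v) y z Fin.≟ rest)) ≡ ind y
          step w (yes refl) _     z     Sw = cong ind (trans (sym v∉S) Sw)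
          step w (no _)     true  true  _  = refl
          step w (no _)     true  false _  = refl
          step w (no _)     false _     _  = refl

      J′ : Fin n → Bool
      J′ w = J w ∧ not (does (w Fin.≟ v₀))
      v₀∉J′ : J′ v₀ ≡ false
      v₀∉J′ = trans (cong (λ x → J v₀ ∧ not x) (dec-true (v₀ Fin.≟ v₀) refl)) (Bool.∧-zeroʳ (J v₀))
      J≗J′ : ∀ w → w ≢ v₀ → J′ w ≡ J w
      J≗J′ w w≢v₀ = trans (cong (λ x → J w ∧ not x) (dec-false (w Fin.≟ v₀) w≢v₀)) (Bool.∧-identityʳ (J w))
      #J′ : count J′ ≡ count I
      #J′ = ℕ.suc-injective (trans (sym (count-flip v₀ v₀∈J v₀∉J′ J≗J′)) #J)
      D⊆J′ : ∀ w → D w ≡ true → J′ w ≡ true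
      D⊆J′ w Dw = trans (J≗J′ w λ { refl → true≢false Dw v₀∉D }) (D⊆J w Dw)

      L : Fin n → Bool
      L w = I w ∧ adj v₁ w
      module P = Colouring v₁ I L
      module Q = Colouring v₀ J′ D

      leaves : P.# leaf ≡ Q.# leaf
      leaves = trans (P.#leaf (cong (_∧ adj v₁ v₁) v₁∉I) λ w → proj₁ ∘ ∧-true (I w) (adj v₁ w))
        (sym (trans (Q.#leaf v₀∉D D⊆J′) (proj₂ (proj₂ star))))
      rests : P.# rest ≡ Q.# rest
      rests = ℕ.+-cancelˡ-≡ (P.# leaf) _ _ (trans (P.#leaf+rest _ refl v₁∉I)
        (sym (trans (cong (ℕ._+ Q.# rest) leaves) (Q.#leaf+rest _ #J′ v₀∉J′))))
      centres : P.# centre ≡ Q.# centre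
      centres = trans P.#centre (sym Q.#centre)
      outers : P.# outer ≡ Q.# outer
      outers = ℕ.+-cancelˡ-≡ (P.# centre ℕ.+ P.# leaf ℕ.+ P.# rest) _ _ (trans (sym (count-4 P.c))
        (trans (count-4 Q.c) (cong (ℕ._+ Q.# outer) (sym (cong₂ ℕ._+_ (cong₂ ℕ._+_ centres leaves) rests)))))
      same : ∀ k → P.# k ≡ Q.# k
      same zero                   = centres
      same (suc zero)             = leaves
      same (suc (suc zero))       = rests
      same (suc (suc (suc zero))) = outers

      π : Permutation′ n
      π = proj₁ (recolour Fin._≟_ P.c Q.c same)
      πc : ∀ u → Q.c (π ⟨$⟩ʳ u) ≡ P.c u
      πc = proj₂ (recolour Fin._≟_ P.c Q.c same)

      -- H has no edge between I ∪ {v₁} and itself other than those of the star.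
      good : Fin 4 → Fin 4 → Bool
      good (suc (suc (suc zero))) _ = true
      good _ (suc (suc (suc zero))) = true
      good zero (suc zero) = true
      good (suc zero) zero = true
      good _ _ = false

      adj-false : ∀ {u v} → adj u v ≡ false → ¬ Adj H u v
      adj-false = false⇒ (adj? H _ _)

      edge-good : ∀ u v → Adj H u v → good (P.c u) (P.c v) ≡ true
      edge-good u v e with u Fin.≟ v₁ | v Fin.≟ v₁ | I u in Iu | I v in Iv | adj v₁ u in au | adj v₁ v in av
      ... | yes refl | yes refl | _ | _ | _ | _ = contradiction refl (Adj-irrefl {G = H} e)
      ... | yes refl | no _ | _ | true  | _ | true  = refl
      ... | yes refl | no _ | _ | true  | _ | false = contradiction e (adj-false av)
      ... | yes refl | no _ | _ | false | _ | _     = refl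
      ... | no _ | yes refl | true  | _ | true  | _ = refl
      ... | no _ | yes refl | true  | _ | false | _ = contradiction (Adj-sym {G = H} e) (adj-false au)
      ... | no _ | yes refl | false | _ | _ | _ = refl
      ... | no _ | no _ | true  | true  | _ | _ = contradiction e (I-indep u v Iu Iv)
      ... | no _ | no _ | false | _     | _ | _ = refl
      ... | no _ | no _ | true  | false | true  | _ = refl
      ... | no _ | no _ | true  | false | false | _ = refl

      outer-∉J : ∀ w → Q.c w ≡ outer → J w ≡ false
      outer-∉J w eq = step w (w Fin.≟ v₀) (J′ w) (D w) refl eq
        where
        step : ∀ w (w≟v : Dec (w ≡ v₀)) y z → J′ w ≡ y → colour (does w≟v) y z ≡ outer → J w ≡ false
        step w (yes _)   _     _     _   ()
        step w (no _)    true  true  _   ()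
        step w (no _)    true  false _   ()
        step w (no w≢v)  false _     J′w _  = trans (sym (J≗J′ w w≢v)) J′w
      centre-v₀ : ∀ w → Q.c w ≡ centre → w ≡ v₀
      centre-v₀ w eq = step (w Fin.≟ v₀) (J′ w) (D w) eq
        where
        step : (w≟v : Dec (w ≡ v₀)) → ∀ y z → colour (does w≟v) y z ≡ centre → w ≡ v₀
        step (yes w≡v) _     _     _ = w≡v
        step (no _)    true  true  ()
        step (no _)    true  false ()
        step (no _)    false _     ()
      leaf-D : ∀ w → Q.c w ≡ leaf → D w ≡ true
      leaf-D w eq = step (does (w Fin.≟ v₀)) (J′ w) (D w) eq
        where
        step : ∀ x y z → colour x y z ≡ leaf → z ≡ true
        step true  _     _     ()
        step false true  true  _ = refl
        step false true  false ()
        step false false _     ()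

      outer-E : ∀ u v → Q.c u ≡ outer → E u v ≡ true
      outer-E u v cu = full u v (cong (_∧ J v) (outer-∉J u cu))

      good-E : ∀ u v j k → Q.c u ≡ j → Q.c v ≡ k → good j k ≡ true → E u v ≡ true
      good-E u v (suc (suc (suc zero))) _ cu cv _ = outer-E u v cu
      good-E u v zero             (suc (suc (suc zero))) cu cv _ = trans (E-sym u v) (outer-E v u cv)
      good-E u v (suc zero)       (suc (suc (suc zero))) cu cv _ = trans (E-sym u v) (outer-E v u cv)
      good-E u v (suc (suc zero)) (suc (suc (suc zero))) cu cv _ = trans (E-sym u v) (outer-E v u cv)
      good-E u v zero (suc zero) cu cv _ = trans (cong (λ u → E u v) (centre-v₀ u cu)) (D⊆E v (leaf-D v cv))
      good-E u v (suc zero) zero cu cv _ = trans (E-sym u v) (trans (cong (λ v → E v u) (centre-v₀ v cv)) (D⊆E u (leaf-D u cu)))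
      good-E u v zero zero _ _ ()
      good-E u v zero (suc (suc zero)) _ _ ()
      good-E u v (suc zero) (suc zero) _ _ ()
      good-E u v (suc zero) (suc (suc zero)) _ _ ()
      good-E u v (suc (suc zero)) zero _ _ ()
      good-E u v (suc (suc zero)) (suc zero) _ _ ()
      good-E u v (suc (suc zero)) (suc (suc zero)) _ _ ()

    -- The classes of `H` and of the host have equal sizes, so some permutation matches them. An
    -- edge of `H` touches an outer vertex or joins the centre to a leaf, and the host has all edges
    -- of both sorts.
    star-embeds : H ⊑ graph (encode E)
    star-embeds = ⊑-intro {H = H} {graph (encode E)} π λ u v e → Adj-encode⁺ E E-sym
      (λ eq → Adj-irrefl {G = H} e (trans (sym (inverseˡ π)) (trans (cong (π ⟨$⟩ˡ_) eq) (inverseˡ π))))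
      (good-E _ _ (P.c u) (P.c v) (πc u) (πc v) (edge-good u v e))

-- Many vertices outside a maximum independent set

module VertexCube {n} (H : Graph n) (I : Fin n → Bool) (I-indep : IndependentSet H I) (#I : count I ≡ α H) (α<n : suc (α H) ≤ n) where

  -- z marks a set of vertices that is emptied of edges.
  E : Vec Bool n → Fin n → Fin n → Bool
  E z u v = not (lookup z u ∧ lookup z v)

  E-sym : ∀ z u v → E z u v ≡ E z v u
  E-sym z u v = cong not (Bool.∧-comm (lookup z u) (lookup z v))

  dep : Fin (n C 2) → Fin n → Bool
  dep k w = does (w Fin.≟ proj₁ (endpoints {n} k)) ∨ does (w Fin.≟ proj₂ (endpoints {n} k))

  ∨-false : ∀ c d → c ∨ d ≡ false → c ≡ false × d ≡ false
  ∨-false false d p = refl , p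

  ∨-true : ∀ c d → c ∨ d ≡ true → c ≡ true ⊎ d ≡ true
  ∨-true true  d _ = inj₁ refl
  ∨-true false d p = inj₂ p

  local : ∀ z w k → dep k w ≡ false → lookup (encode (E (toggle z w))) k ≡ lookup (encode (E z)) k
  local z w k indep = trans (lookup-encode (E (toggle z w)) k) (trans
    (cong₂ (λ c d → not (c ∧ d)) (same (proj₁ off)) (same (proj₂ off))) (sym (lookup-encode (E z) k)))
    where
    off : does (w Fin.≟ proj₁ (endpoints {n} k)) ≡ false × does (w Fin.≟ proj₂ (endpoints {n} k)) ≡ false
    off = ∨-false _ _ indep
    same : ∀ {u} → does (w Fin.≟ u) ≡ false → lookup (toggle z w) u ≡ lookup z u
    same {u} w≢u = lookup-toggle-≢ z λ u≡w → false⇒ (w Fin.≟ u) w≢u (sym u≡w)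

  -- The bit of a slot depends on the marks of its two endpoints; this is why the adversary bound
  -- admits two variables per bit.
  dep≤2 : ∀ k → count (dep k) ≤ 2
  dep≤2 k = ℕ.≤-trans (count-∪ {p = dep k} λ w → ∨-true _ _)
    (ℕ.≤-reflexive (cong₂ ℕ._+_ (count-≟ (proj₁ (endpoints {n} k))) (count-≟ (proj₂ (endpoints {n} k)))))

  X : Vec Bool n → Bool
  X z = does (count (lookup z) ℕ.≟ suc (α H))

  ∣x∣ : ∀ x → X x ≡ true → count (lookup x) ≡ suc (α H)
  ∣x∣ x = true⇒ (count (lookup x) ℕ.≟ suc (α H))

  f-X : ∀ x → X x ≡ true → f[ H ] (encode (E x)) ≡ false
  f-X x Xx = f-false H (encode (E x)) (large-independent H (graph (encode (E x))) (lookup x)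
    (λ u v xu xv e → true≢false (Adj-encode⁻ (E x) (E-sym x) e) (cong not (∧-intro xu xv)))
    (ℕ.≤-reflexive (sym (∣x∣ x Xx))))

  -- With one vertex unmarked, the emptied set has exactly α elements, so a permutation carries `I`
  -- onto it. No edge of `H` has both ends in `I`, so none is sent to a deleted slot.
  f-below : ∀ x w → X x ≡ true → lookup x w ≡ true → f[ H ] (encode (E (toggle x w))) ≡ true
  f-below x w Xx xw = f-true H (encode (E (toggle x w))) (⊑-intro {H = H} {graph (encode (E y))} π λ u v e → Adj-encode⁺ (E y) (E-sym y)
    (λ eq → Adj-irrefl {G = H} e (trans (sym (inverseˡ π)) (trans (cong (π ⟨$⟩ˡ_) eq) (inverseˡ π))))
    (trans (cong₂ (λ c d → not (c ∧ d)) (yπ u) (yπ v)) (not-both u v e)))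
    where
    y : Vec Bool n
    y = toggle x w
    #y : count (lookup y) ≡ count I
    #y = trans (ℕ.suc-injective (trans (sym (count-toggle-true x w xw)) (∣x∣ x Xx))) (sym #I)
    ≟-true : ∀ c → does (c Bool.≟ true) ≡ c
    ≟-true true  = refl
    ≟-true false = refl
    ≟-false : ∀ c → does (c Bool.≟ false) ≡ not c
    ≟-false true  = refl
    ≟-false false = refl
    same : ∀ k → count (λ i → does (I i Bool.≟ k)) ≡ count (λ i → does (lookup y i Bool.≟ k))
    same true  = trans (count-cong λ i → ≟-true (I i)) (trans (sym #y) (count-cong λ i → sym (≟-true (lookup y i))))
    same false = trans (count-cong λ i → ≟-false (I i)) (trans
      (ℕ.+-cancelˡ-≡ (count I) _ _ (trans (count-not I) (trans (sym (count-not (lookup y))) (cong (ℕ._+ count (not ∘ lookup y)) #y))))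
      (count-cong λ i → sym (≟-false (lookup y i))))
    π : Permutation′ n
    π = proj₁ (recolour Bool._≟_ I (lookup y) same)
    yπ : ∀ u → lookup y (π ⟨$⟩ʳ u) ≡ I u
    yπ = proj₂ (recolour Bool._≟_ I (lookup y) same)
    not-both : ∀ u v → Adj H u v → not (I u ∧ I v) ≡ true
    not-both u v e with I u in Iu | I v in Iv
    ... | true  | true  = contradiction e (I-indep u v Iu Iv)
    ... | true  | false = refl
    ... | false | _     = refl

  start : ∃[ x ] X x ≡ true
  start =
    let q , _ , #q = subset-of-size {n} (λ _ → true) (suc (α H)) (ℕ.≤-trans α<n (ℕ.≤-reflexive (sym (count-true n))))
    in tabulate q , dec-true (_ ℕ.≟ suc (α H)) (trans (count-cong (Vec.lookup∘tabulate q)) #q)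

  bound : ∀ {T} (A : Algorithm (n C 2) T) → A Computes f[ H ] → suc (α H) * (n ℕ.∸ α H) ≤ 72 * T * (72 * T)
  bound {T} A computes = cube-adversary {M = n} {T = T} {f = f[ H ]} A computes (λ z → encode (E z)) dep local dep≤2 X f-X f-below
    (proj₁ start) (proj₂ start) (suc (α H)) (n ℕ.∸ α H)
    (λ x Xx → ℕ.≤-reflexive (sym (∣x∣ x Xx)))
    Y-degree
    where
    -- A lower neighbour marks α vertices, and marking any of the other n - α leads back into `X`.
    Y-degree : ∀ y w → not (lookup y w) ∧ X (toggle y w) ≡ true →
               n ℕ.∸ α H ≤ count λ w′ → not (lookup y w′) ∧ X (toggle y w′)
    Y-degree y w yw = ℕ.≤-trans (ℕ.≤-reflexive free) (count-mono λ w′ y∌w′ → ∧-intro y∌w′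
      (dec-true (_ ℕ.≟ _) (trans (count-toggle-false y w′ (not-true y∌w′)) (cong suc #y))))
      where
      #y : count (lookup y) ≡ α H
      #y = ℕ.suc-injective (trans
        (sym (count-toggle-false y w (not-true (proj₁ (∧-true (not (lookup y w)) _ yw)))))
        (∣x∣ (toggle y w) (proj₂ (∧-true (not (lookup y w)) _ yw))))
      free : n ℕ.∸ α H ≡ count (not ∘ lookup y)
      free = trans (cong (n ℕ.∸_) (sym #y)) (trans (cong (ℕ._∸ count (lookup y)) (sym (count-not (lookup y))))
        (ℕ.m+n∸m≡n (count (lookup y)) _))

-- `true` entries are switched off one at a time while `F` stays `false`, and their number drops at
-- each step. In the edge cube, switching off restores an edge, so the result is a 0-input to which
-- no varying edge can be added without creating `H`.
minimal-false : ∀ {M} (F : Vec Bool M → Bool) z → F z ≡ false →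
  ∃[ x ] F x ≡ false × (∀ w → lookup x w ≡ true → F (toggle x w) ≡ true)
minimal-false {M} F z = go _ z refl
  where
  go : ∀ k z → count (lookup z) ≡ k → F z ≡ false →
       ∃[ x ] F x ≡ false × (∀ w → lookup x w ≡ true → F (toggle x w) ≡ true)
  go k z #z Fz with Fin.any? (λ w → (lookup z w Bool.≟ true) ×-dec (F (toggle z w) Bool.≟ false))
  go k z #z Fz       | no none = z , Fz , λ w zw → Bool.¬-not λ Fw → none (w , zw , Fw)
  go zero z #z Fz    | yes (w , zw , Fw) = contradiction (trans (sym #z) (count-toggle-true z w zw)) λ ()
  go (suc k) z #z Fz | yes (w , zw , Fw) = go k (toggle z w)
    (ℕ.suc-injective (trans (sym (count-toggle-true z w zw)) #z)) Fw

-- Few vertices outside a maximum independent set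

-- The vertices B ∪ A take the place of I ∪ {v₁}, and the remaining ones are
-- adjacent to everything; z i j = true deletes the edge between B i and A j.
module Kinds (b a r : ℕ) where

  private
    n : ℕ
    n = b ℕ.+ (a ℕ.+ r)

  data Kind : Set where
    inB : Fin b → Kind
    inA : Fin a → Kind
    inC : Fin r → Kind

  kind : Fin n → Kind
  kind v with splitAt b v
  ... | inj₁ i = inB i
  ... | inj₂ w with splitAt a w
  ...   | inj₁ j = inA j
  ...   | inj₂ k = inC k

  vertex : Kind → Fin n
  vertex (inB i) = i ↑ˡ (a ℕ.+ r)
  vertex (inA j) = b ↑ʳ (j ↑ˡ r)
  vertex (inC k) = b ↑ʳ (a ↑ʳ k)

  kind-vertex : ∀ κ → kind (vertex κ) ≡ κ
  kind-vertex (inB i) rewrite Fin.splitAt-↑ˡ b i (a ℕ.+ r) = refl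
  kind-vertex (inA j) rewrite Fin.splitAt-↑ʳ b (a ℕ.+ r) (j ↑ˡ r) | Fin.splitAt-↑ˡ a j r = refl
  kind-vertex (inC k) rewrite Fin.splitAt-↑ʳ b (a ℕ.+ r) (a ↑ʳ k) | Fin.splitAt-↑ʳ a r k = refl

  vertex-kind : ∀ v → vertex (kind v) ≡ v
  vertex-kind v with splitAt b v in eq
  ... | inj₁ i = Fin.splitAt⁻¹-↑ˡ eq
  ... | inj₂ w with splitAt a w in eq′
  ...   | inj₁ j = trans (cong (b ↑ʳ_) (Fin.splitAt⁻¹-↑ˡ eq′)) (Fin.splitAt⁻¹-↑ʳ eq)
  ...   | inj₂ k = trans (cong (b ↑ʳ_) (Fin.splitAt⁻¹-↑ʳ eq′)) (Fin.splitAt⁻¹-↑ʳ eq)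

  count-kinds : ∀ (p : Fin n → Bool) → count p ≡
    count (p ∘ vertex ∘ inB) ℕ.+ (count (p ∘ vertex ∘ inA) ℕ.+ count (p ∘ vertex ∘ inC))
  count-kinds p = trans (count-++ b p) (cong (count (p ∘ vertex ∘ inB) ℕ.+_) (count-++ a (λ w → p (b ↑ʳ w))))

  count-inA : ∀ (p : Fin n → Bool) → count (p ∘ vertex ∘ inA) ≤ count p
  count-inA p = begin
    #A                  ≤⟨ ℕ.m≤m+n #A #C ⟩
    #A ℕ.+ #C           ≤⟨ ℕ.m≤n+m (#A ℕ.+ #C) #B ⟩
    #B ℕ.+ (#A ℕ.+ #C)  ≡⟨ count-kinds p ⟨
    count p             ∎
    where
    open ℕ.≤-Reasoning
    #A #B #C : ℕ
    #A = count (p ∘ vertex ∘ inA)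
    #B = count (p ∘ vertex ∘ inB)
    #C = count (p ∘ vertex ∘ inC)

module EdgeCube (b a r : ℕ) (H : Graph (b ℕ.+ (a ℕ.+ r)))
  (I : Fin (b ℕ.+ (a ℕ.+ r)) → Bool) (I-indep : IndependentSet H I) (#I : count I ≡ α H)
  (v₁ : Fin (b ℕ.+ (a ℕ.+ r))) (v₁∉I : I v₁ ≡ false)
  (b+a : b ℕ.+ a ≡ suc (count I))
  where

  private
    n : ℕ
    n = b ℕ.+ (a ℕ.+ r)

  open Pattern H I I-indep v₁ v₁∉I
  open Kinds b a r

  isJ : Kind → Bool
  isJ (inC _) = false
  isJ _       = true

  J : Fin n → Bool
  J = isJ ∘ kind

  #J : count J ≡ suc (count I)
  #J = trans (count-kinds J) (trans (cong₂ ℕ._+_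
    (trans (count-cong λ i → cong isJ (kind-vertex (inB i))) (count-true b))
    (trans (cong₂ ℕ._+_ (trans (count-cong λ j → cong isJ (kind-vertex (inA j))) (count-true a))
                        (trans (count-cong λ k → cong isJ (kind-vertex (inC k))) (count-false r)))
           (ℕ.+-identityʳ a))) b+a)

  entry : Vec Bool (b * a) → Fin b → Fin a → Bool
  entry z i j = lookup z (combine i j)

  -- The two constructions differ only in whether `B` is a clique or independent, and in their
  -- choice of `X`.
  module _ (clique : Bool) where

    edge : (Fin b → Fin a → Bool) → Kind → Kind → Bool
    edge z (inB _) (inB _) = clique
    edge z (inB i) (inA j) = not (z i j)
    edge z (inA j) (inB i) = not (z i j)
    edge z (inA _) (inA _) = false
    edge z (inC _) _       = true
    edge z (inB _) (inC _) = true
    edge z (inA _) (inC _) = true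

    edge-sym : ∀ z κ μ → edge z κ μ ≡ edge z μ κ
    edge-sym z (inB _) (inB _) = refl
    edge-sym z (inB _) (inA _) = refl
    edge-sym z (inB _) (inC _) = refl
    edge-sym z (inA _) (inB _) = refl
    edge-sym z (inA _) (inA _) = refl
    edge-sym z (inA _) (inC _) = refl
    edge-sym z (inC _) (inB _) = refl
    edge-sym z (inC _) (inA _) = refl
    edge-sym z (inC _) (inC _) = refl

    E : Vec Bool (b * a) → Fin n → Fin n → Bool
    E z u v = edge (entry z) (kind u) (kind v)

    E-sym : ∀ z u v → E z u v ≡ E z v u
    E-sym z u v = edge-sym (entry z) (kind u) (kind v)

    host : Vec Bool (b * a) → Vec Bool (n C 2)
    host z = encode (E z)

    full : ∀ z u v → J u ∧ J v ≡ false → E z u v ≡ true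
    full z u v = step (kind u) (kind v)
      where
      step : ∀ κ μ → isJ κ ∧ isJ μ ≡ false → edge (entry z) κ μ ≡ true
      step (inC _) _       _ = refl
      step (inB _) (inC _) _ = refl
      step (inA _) (inC _) _ = refl
      step (inB _) (inB _) ()
      step (inB _) (inA _) ()
      step (inA _) (inB _) ()
      step (inA _) (inA _) ()

    variable-of : Kind → Kind → Fin (b * a) → Bool
    variable-of (inB i) (inA j) w = does (w Fin.≟ combine i j)
    variable-of (inA j) (inB i) w = does (w Fin.≟ combine i j)
    variable-of _       _       w = false

    dep : Fin (n C 2) → Fin (b * a) → Bool
    dep k = variable-of (kind (proj₁ (endpoints {n} k))) (kind (proj₂ (endpoints {n} k)))

    dep≤2 : ∀ k → count (dep k) ≤ 2
    dep≤2 k = step (kind (proj₁ (endpoints {n} k))) (kind (proj₂ (endpoints {n} k)))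
      where
      one : ∀ (w : Fin (b * a)) → count (λ v → does (v Fin.≟ w)) ≤ 2
      one w = ℕ.≤-trans (ℕ.≤-reflexive (count-≟ w)) (s≤s z≤n)
      none : count {b * a} (λ _ → false) ≤ 2
      none = ℕ.≤-trans (ℕ.≤-reflexive (count-false (b * a))) z≤n
      step : ∀ κ μ → count (variable-of κ μ) ≤ 2
      step (inB i) (inA j) = one (combine i j)
      step (inA j) (inB i) = one (combine i j)
      step (inB _) (inB _) = none
      step (inB _) (inC _) = none
      step (inA _) (inA _) = none
      step (inA _) (inC _) = none
      step (inC _) _       = none

    local : ∀ z w k → dep k w ≡ false → lookup (host (toggle z w)) k ≡ lookup (host z) k
    local z w k indep = trans (lookup-encode (E (toggle z w)) k)
      (trans (step (kind (proj₁ (endpoints {n} k))) (kind (proj₂ (endpoints {n} k))) indep) (sym (lookup-encode (E z) k)))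
      where
      same : ∀ i j → does (w Fin.≟ combine i j) ≡ false → not (entry (toggle z w) i j) ≡ not (entry z i j)
      same i j w≢ = cong not (lookup-toggle-≢ z λ eq → false⇒ (w Fin.≟ combine i j) w≢ (sym eq))
      step : ∀ κ μ → variable-of κ μ w ≡ false → edge (entry (toggle z w)) κ μ ≡ edge (entry z) κ μ
      step (inB i) (inA j) = same i j
      step (inA j) (inB i) = same i j
      step (inB _) (inB _) _ = refl
      step (inB _) (inC _) _ = refl
      step (inA _) (inA _) _ = refl
      step (inA _) (inC _) _ = refl
      step (inC _) _       _ = refl

    -- The vertex `B i` is taken as the centre in `star-embeds`; the two summands count its
    -- neighbours in `B` and in `A`.
    f-rich : ∀ z i → degree v₁ ≤ count (λ i′ → clique ∧ not (does (i′ Fin.≟ i))) ℕ.+ count (λ j → not (entry z i j)) →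
             f[ H ] (host z) ≡ true
    f-rich z i d≤ = f-true H (host z) (star-embeds (E z) (E-sym z) J #J (full z) v₀ (cong isJ (kind-vertex (inB i)))
      (ℕ.≤-trans d≤ (ℕ.≤-trans (ℕ.+-mono-≤ (ℕ.≤-reflexive (count-cong in-B))
        (ℕ.≤-trans (ℕ.≤-reflexive (count-cong in-A)) (ℕ.m≤m+n _ _))) (ℕ.≤-reflexive (sym (count-kinds near))))))
      where
      v₀ : Fin n
      v₀ = vertex (inB i)
      near : Fin n → Bool
      near w = J w ∧ (E z v₀ w ∧ not (does (w Fin.≟ v₀)))
      E-v₀ : ∀ κ → E z v₀ (vertex κ) ≡ edge (entry z) (inB i) κ
      E-v₀ κ = cong₂ (edge (entry z)) (kind-vertex (inB i)) (kind-vertex κ)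
      in-B : ∀ i′ → clique ∧ not (does (i′ Fin.≟ i)) ≡ near (vertex (inB i′))
      in-B i′ = sym (cong₂ _∧_ (cong isJ (kind-vertex (inB i′))) (cong₂ _∧_ (E-v₀ (inB i′)) (cong not eq)))
        where
        eq : does (vertex (inB i′) Fin.≟ v₀) ≡ does (i′ Fin.≟ i)
        eq with i′ Fin.≟ i
        ... | yes refl = dec-true (v₀ Fin.≟ v₀) refl
        ... | no i′≢i  = dec-false (vertex (inB i′) Fin.≟ v₀) λ e → i′≢i (Fin.↑ˡ-injective (a ℕ.+ r) i′ i e)
      in-A : ∀ j → not (entry z i j) ≡ near (vertex (inA j))
      in-A j = sym (cong₂ _∧_ (cong isJ (kind-vertex (inA j))) (trans (cong₂ _∧_ (E-v₀ (inA j)) (cong not eq)) (Bool.∧-identityʳ _)))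
        where
        kinds-≢ : inA j ≢ inB i
        kinds-≢ ()
        eq : does (vertex (inA j) Fin.≟ v₀) ≡ false
        eq = dec-false (vertex (inA j) Fin.≟ v₀) λ e →
          kinds-≢ (trans (sym (kind-vertex (inA j))) (trans (cong kind e) (kind-vertex (inB i))))

  -- B ∪ A starts as an independent set and is then filled greedily.
  greedy-bound : ∀ {T} (A : Algorithm (n C 2) T) → A Computes f[ H ] → ∀ q →
                 degree v₁ ℕ.+ q ≤ a → b * suc q * 1 ≤ 72 * T * (72 * T)
  greedy-bound {T} A computes q d+q≤a = cube-adversary {T = T} {f = f[ H ]} A computes
    (host false) (dep false) (local false) (dep≤2 false) X
    (λ x Xx → trans (cong F (is-x₀ x Xx)) F-x₀)
    (λ x w Xx xw → trans (cong (λ x → F (toggle x w)) (is-x₀ x Xx))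
      (x₀-minimal w (trans (cong (λ x → lookup x w) (sym (is-x₀ x Xx))) xw)))
    x₀ (dec-true (Vec.≡-dec Bool._≟_ x₀ x₀) refl) (b * suc q) 1
    (λ x Xx → subst (λ x → b * suc q ≤ count (lookup x)) (sym (is-x₀ x Xx)) degree-x₀)
    (λ y w → count-≥1 (λ w → not (lookup y w) ∧ X (toggle y w)) w)
    where
    F : Vec Bool (b * a) → Bool
    F z = f[ H ] (host false z)
    all : Vec Bool (b * a)
    all = Vec.replicate (b * a) true
    J-independent : IndependentSet (graph (host false all)) J
    J-independent u v Ju Jv e = true≢false (Adj-encode⁻ (E false all) (E-sym false all) e) (step (kind u) (kind v) Ju Jv)
      where
      step : ∀ κ μ → isJ κ ≡ true → isJ μ ≡ true → edge false (entry all) κ μ ≡ false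
      step (inB _) (inB _) _ _ = refl
      step (inB i) (inA j) _ _ = cong not (Vec.lookup-replicate (combine i j) true)
      step (inA j) (inB i) _ _ = cong not (Vec.lookup-replicate (combine i j) true)
      step (inA _) (inA _) _ _ = refl
      step (inC _) _       () _
      step (inB _) (inC _) _ ()
      step (inA _) (inC _) _ ()
    minimal : ∃[ x ] F x ≡ false × (∀ w → lookup x w ≡ true → F (toggle x w) ≡ true)
    minimal = minimal-false F all (f-false H (host false all)
      (large-independent H (graph (host false all)) J J-independent
        (ℕ.≤-reflexive (trans (cong suc (sym #I)) (sym #J)))))
    x₀ : Vec Bool (b * a)
    x₀ = proj₁ minimal
    F-x₀ : F x₀ ≡ false
    F-x₀ = proj₁ (proj₂ minimal)
    x₀-minimal : ∀ w → lookup x₀ w ≡ true → F (toggle x₀ w) ≡ true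
    x₀-minimal = proj₂ (proj₂ minimal)
    -- A single 0-input is enough here: its degree m is already quadratic in the intended sizes, so
    -- m′ = 1 is affordable.
    X : Vec Bool (b * a) → Bool
    X x = does (Vec.≡-dec Bool._≟_ x x₀)
    is-x₀ : ∀ x → X x ≡ true → x ≡ x₀
    is-x₀ x = true⇒ (Vec.≡-dec Bool._≟_ x x₀)
    poor : ∀ i → count (λ j → not (entry x₀ i j)) ℕ.< degree v₁
    poor i = ℕ.≰⇒> λ d≤ → true≢false (f-rich false x₀ i (ℕ.≤-trans d≤ (ℕ.m≤n+m _ _))) F-x₀
    -- Of the at least d + q possible edges from `B i` to `A` fewer than d are present, so more than
    -- q are deleted.
    row : ∀ i → suc q ≤ count (entry x₀ i)
    row i = ℕ.+-cancelʳ-≤ #0 (suc q) (count (entry x₀ i)) (begin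
      suc q ℕ.+ #0                     ≡⟨ ℕ.+-suc q #0 ⟨
      q ℕ.+ suc #0                     ≤⟨ ℕ.+-monoʳ-≤ q (poor i) ⟩
      q ℕ.+ degree v₁                  ≡⟨ ℕ.+-comm q (degree v₁) ⟩
      degree v₁ ℕ.+ q                  ≤⟨ d+q≤a ⟩
      a                                ≡⟨ count-not (entry x₀ i) ⟨
      count (entry x₀ i) ℕ.+ #0        ∎)
      where
      open ℕ.≤-Reasoning
      #0 : ℕ
      #0 = count (λ j → not (entry x₀ i j))
    degree-x₀ : b * suc q ≤ count (lookup x₀)
    degree-x₀ = ℕ.≤-trans (sum-const-≤ (λ i → count (entry x₀ i)) (suc q) row)
      (ℕ.≤-reflexive (sym (count-combine b (lookup x₀))))

  rowCount : Vec Bool (b * a) → Fin b → ℕ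
  rowCount z i = count (entry z i)

  entry-toggle-≢ : ∀ z i j {j′} → j′ ≢ j → entry (toggle z (combine i j)) i j′ ≡ entry z i j′
  entry-toggle-≢ z i j {j′} j′≢j = lookup-toggle-≢ z λ eq → j′≢j (Fin.combine-injectiveʳ i j′ i j eq)

  rowCount-≢ : ∀ z i j {i′} → i′ ≢ i → rowCount (toggle z (combine i j)) i′ ≡ rowCount z i′
  rowCount-≢ z i j {i′} i′≢i = count-cong λ j′ →
    lookup-toggle-≢ z λ eq → i′≢i (Fin.combine-injectiveˡ i′ j′ i j eq)

  rowCount-true : ∀ z i j → entry z i j ≡ true → rowCount z i ≡ suc (rowCount (toggle z (combine i j)) i)
  rowCount-true z i j zij = count-flip j zij (trans (lookup-toggle z (combine i j)) (cong not zij))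
    λ j′ → entry-toggle-≢ z i j

  rowCount-false : ∀ z i j → entry z i j ≡ false → rowCount (toggle z (combine i j)) i ≡ suc (rowCount z i)
  rowCount-false z i j zij = count-flip j (trans (lookup-toggle z (combine i j)) (cong not zij)) zij
    λ j′ j′≢j → sym (entry-toggle-≢ z i j j′≢j)

  -- B is a clique, and every vertex of B has one neighbour too few in A.
  module _ (s : ℕ) (d+s : degree v₁ ℕ.+ s ≡ count I)
    (minimal : ∀ u → I u ≡ false → degree v₁ ≤ degree u)
    (a-large : suc (s ℕ.+ count (not ∘ I)) ≤ a)
    where

    X : Vec Bool (b * a) → Bool
    X z = does (Fin.all? λ i → rowCount z i ℕ.≟ suc s)

    rows : ∀ x → X x ≡ true → ∀ i → rowCount x i ≡ suc s
    rows x = true⇒ (Fin.all? λ i → rowCount x i ℕ.≟ suc s)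

    -- Now `B i` is adjacent to all of B ∪ A except itself and s vertices of `A`. As B ∪ A has α + 1
    -- elements, that leaves α - s = d neighbours.
    f-below : ∀ x i j → X x ≡ true → entry x i j ≡ true → f[ H ] (host true (toggle x (combine i j))) ≡ true
    f-below x i j Xx xij = f-rich true y i (ℕ.≤-reflexive (ℕ.+-cancelʳ-≡ s (degree v₁) (#B ℕ.+ #0) (ℕ.suc-injective (begin
      suc (degree v₁ ℕ.+ s)            ≡⟨ cong suc d+s ⟩
      suc (count I)                    ≡⟨ b+a ⟨
      b ℕ.+ a                          ≡⟨ cong₂ ℕ._+_ (count-not (λ i′ → does (i′ Fin.≟ i))) (count-not (entry y i)) ⟨
      count (λ i′ → does (i′ Fin.≟ i)) ℕ.+ #B ℕ.+ (rowCount y i ℕ.+ #0)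
                                       ≡⟨ cong₂ (λ p q → p ℕ.+ #B ℕ.+ (q ℕ.+ #0)) (count-≟ i) #y ⟩
      suc #B ℕ.+ (s ℕ.+ #0)            ≡⟨ shuffle #B s #0 ⟩
      suc (#B ℕ.+ #0 ℕ.+ s)            ∎))))
      where
      open ≡-Reasoning
      y : Vec Bool (b * a)
      y = toggle x (combine i j)
      #B #0 : ℕ
      #B = count (λ i′ → not (does (i′ Fin.≟ i)))
      #0 = count (λ j → not (entry y i j))
      #y : rowCount y i ≡ s
      #y = ℕ.suc-injective (trans (sym (rowCount-true x i j xij)) (rows x Xx i))
      shuffle : ∀ p q r → suc p ℕ.+ (q ℕ.+ r) ≡ suc (p ℕ.+ r ℕ.+ q)
      shuffle = solve-∀

    -- B ∪ A is larger than I, but under an embedding π of H a vertex outside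
    -- π(I) misses at most s vertices of π(I), which forces B ∪ A ⊆ π(I).
    not-embedded : ∀ x → X x ≡ true → ¬ (H ⊑ graph (host true x))
    not-embedded x Xx H⊑G = absurd
      where
      π : Permutation′ n
      π = proj₁ (⊑-elim {H = H} {graph (host true x)} H⊑G)
      ρ : Fin n → Fin n
      ρ = π ⟨$⟩ˡ_
      embeds : ∀ u w → Adj H u w → E true x (π ⟨$⟩ʳ u) (π ⟨$⟩ʳ w) ≡ true
      embeds u w e = Adj-encode⁻ (E true x) (E-sym true x) (proj₂ (⊑-elim {H = H} {graph (host true x)} H⊑G) u w e)
      πI : Fin n → Bool
      πI w = I (ρ w)
      #πI : count πI ≡ count I
      #πI = count-permute I (Perm.flip π)
      missed : Fin n → Fin n → Bool
      missed v w = πI w ∧ not (E true x v w)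
      -- By the choice of `v₁`, the preimage of `v` has at least d = α - s neighbours in `I`, and
      -- the embedding keeps them.
      #missed : ∀ v → πI v ≡ false → count (missed v) ≤ s
      #missed v v∉πI = ℕ.+-cancelˡ-≤ (degree v₁) (count (missed v)) s (begin
        degree v₁ ℕ.+ count (missed v)
          ≤⟨ ℕ.+-mono-≤ (minimal (ρ v) v∉πI) (ℕ.≤-trans (count-mono missed⇒)
               (ℕ.≤-reflexive (count-permute (λ w → I w ∧ not (adj (ρ v) w)) (Perm.flip π)))) ⟩
        degree (ρ v) ℕ.+ count (λ w → I w ∧ not (adj (ρ v) w))     ≡⟨ count-split I (adj (ρ v)) ⟨
        count I                                                    ≡⟨ d+s ⟨
        degree v₁ ℕ.+ s                                            ∎)
        where
        open ℕ.≤-Reasoning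
        missed⇒ : ∀ w → missed v w ≡ true → I (ρ w) ∧ not (adj (ρ v) (ρ w)) ≡ true
        missed⇒ w mw = ∧-intro (proj₁ (∧-true (πI w) _ mw)) (cong not (dec-false (adj? H (ρ v) (ρ w)) λ e →
          true≢false (subst₂ (λ p q → E true x p q ≡ true) (inverseʳ π) (inverseʳ π) (embeds _ _ e))
            (not-true (proj₂ (∧-true (πI w) _ mw)))))
      on-A : ∀ v → πI v ≡ false → {p : Fin a → Bool} → (∀ j → p j ≡ true → missed v (vertex (inA j)) ≡ true) → count p ≤ s
      on-A v v∉πI {p} p⇒ = begin
        count p                          ≤⟨ count-mono p⇒ ⟩
        count (missed v ∘ vertex ∘ inA)  ≤⟨ count-inA (missed v) ⟩
        count (missed v)                 ≤⟨ #missed v v∉πI ⟩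
        s                                ∎
        where open ℕ.≤-Reasoning
      E-kinds : ∀ κ μ → E true x (vertex κ) (vertex μ) ≡ edge true (entry x) κ μ
      E-kinds κ μ = cong₂ (edge true (entry x)) (kind-vertex κ) (kind-vertex μ)
      -- A vertex of A outside π(I) would miss all of A ∩ π(I).
      A⊆πI : ∀ j → πI (vertex (inA j)) ≢ false
      A⊆πI j j∉πI = ℕ.<⇒≱ a-large (begin
        a                                            ≡⟨ count-not (λ j′ → πI (vertex (inA j′))) ⟨
        count (λ j′ → πI (vertex (inA j′))) ℕ.+ count (λ j′ → not (πI (vertex (inA j′))))
          ≤⟨ ℕ.+-mono-≤ (on-A (vertex (inA j)) j∉πI λ j′ p → ∧-intro p (cong not (E-kinds (inA j) (inA j′)))) not-πI ⟩
        s ℕ.+ count (not ∘ I)                        ∎)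
        where
        open ℕ.≤-Reasoning
        not-πI : count (λ j′ → not (πI (vertex (inA j′)))) ≤ count (not ∘ I)
        not-πI = ℕ.≤-trans (count-inA (not ∘ πI)) (ℕ.≤-reflexive (count-permute (not ∘ I) (Perm.flip π)))
      J⊆πI : ∀ κ → isJ κ ≡ true → πI (vertex κ) ≢ false
      J⊆πI (inA j) _ = A⊆πI j
      -- All s + 1 vertices of `A` missed by `B i` lie in π(I), one more than a vertex outside π(I)
      -- may miss.
      J⊆πI (inB i) _ i∉πI = ℕ.<⇒≱ (ℕ.≤-reflexive (sym (rows x Xx i)))
        (on-A (vertex (inB i)) i∉πI λ j xij → ∧-intro (Bool.¬-not (A⊆πI j))
          (cong not (trans (E-kinds (inB i) (inA j)) (cong not xij))))
      absurd : ⊥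
      absurd = ℕ.1+n≰n (begin
        suc (count I)      ≡⟨ #J ⟨
        count J            ≤⟨ (count-mono λ v Jv → Bool.¬-not λ v∉πI →
                                J⊆πI (kind v) Jv (trans (cong πI (vertex-kind v)) v∉πI)) ⟩
        count πI           ≡⟨ #πI ⟩
        count I            ∎)
        where open ℕ.≤-Reasoning

    -- A 0-input deletes s + 1 edges in each of `b` rows, and restoring any of them leads down. In a
    -- lower neighbour exactly one row is one deletion short, and deleting any of its a - s present
    -- edges leads back into `X`.
    rows-bound : ∀ {T} (A : Algorithm (n C 2) T) → A Computes f[ H ] →
                 b * suc s * (a ℕ.∸ s) ≤ 72 * T * (72 * T)
    rows-bound {T} A computes = cube-adversary {T = T} {f = f[ H ]} A computes
      (host true) (dep true) (local true) (dep≤2 true) X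
      (λ x Xx → f-false H (host true x) (not-embedded x Xx))
      (λ x w Xx xw → subst (λ w → f[ H ] (host true (toggle x w)) ≡ true) (split w)
        (f-below x _ _ Xx (trans (cong (lookup x) (split w)) xw)))
      (proj₁ start) (proj₂ start) (b * suc s) (a ℕ.∸ s)
      (λ x Xx → ℕ.≤-trans (sum-const-≤ (rowCount x) (suc s) (ℕ.≤-reflexive ∘ sym ∘ rows x Xx))
        (ℕ.≤-reflexive (sym (count-combine b (lookup x)))))
      (λ y w → subst (λ w → below y w ≡ true → a ℕ.∸ s ≤ count (below y)) (split w) (Y-degree y _ _))
      where
      split : ∀ w → combine (proj₁ (remQuot {b} a w)) (proj₂ (remQuot {b} a w)) ≡ w
      split = Fin.combine-remQuot {b} a
      below : Vec Bool (b * a) → Fin (b * a) → Bool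
      below y w = not (lookup y w) ∧ X (toggle y w)
      start : ∃[ x ] X x ≡ true
      start =
        -- To start, all rows delete the edges to the same s + 1 vertices of `A`.
        let q , _ , #q = subset-of-size {a} (λ _ → true) (suc s)
              (ℕ.≤-trans (s≤s (ℕ.m≤m+n s _)) (ℕ.≤-trans a-large (ℕ.≤-reflexive (sym (count-true a)))))
            p = λ w → q (proj₂ (remQuot {b} a w))
        in tabulate p , dec-true (Fin.all? λ i → rowCount (tabulate p) i ℕ.≟ suc s) λ i →
             trans (count-cong λ j → trans (Vec.lookup∘tabulate p (combine i j))
               (cong (q ∘ proj₂) (Fin.remQuot-combine {b} {a} i j))) #q
      Y-degree : ∀ y i j → below y (combine i j) ≡ true → a ℕ.∸ s ≤ count (below y)
      Y-degree y i j y<x = begin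
        a ℕ.∸ s                                  ≡⟨ cong₂ ℕ._∸_ (count-not (entry y i)) #y ⟨
        rowCount y i ℕ.+ #0 ℕ.∸ rowCount y i     ≡⟨ ℕ.m+n∸m≡n (rowCount y i) #0 ⟩
        #0                                       ≤⟨ count-mono free ⟩
        count (λ j′ → below y (combine i j′))    ≤⟨ sum-≥ (λ (i : Fin b) → count λ (j′ : Fin a) → below y (combine i j′)) i ⟩
        ℕΣ.sum (λ (i : Fin b) → count λ (j′ : Fin a) → below y (combine i j′))
                                                 ≡⟨ count-combine b (below y) ⟨
        count (below y)                          ∎
        where
        open ℕ.≤-Reasoning
        #0 : ℕ
        #0 = count (λ j′ → not (entry y i j′))
        yij : entry y i j ≡ false
        yij = not-true (proj₁ (∧-true (not (entry y i j)) _ y<x))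
        x-rows : ∀ i′ → rowCount (toggle y (combine i j)) i′ ≡ suc s
        x-rows = rows (toggle y (combine i j)) (proj₂ (∧-true (not (entry y i j)) _ y<x))
        #y : rowCount y i ≡ s
        #y = ℕ.suc-injective (trans (sym (rowCount-false y i j yij)) (x-rows i))
        free : ∀ j′ → not (entry y i j′) ≡ true → below y (combine i j′) ≡ true
        free j′ yij′ = ∧-intro yij′ (dec-true (Fin.all? λ i′ → rowCount (toggle y (combine i j′)) i′ ℕ.≟ suc s) row)
          where
          row : ∀ i′ → rowCount (toggle y (combine i j′)) i′ ≡ suc s
          row i′ with i′ Fin.≟ i
          ... | yes refl = trans (rowCount-false y i j′ (not-true yij′)) (cong suc #y)
          ... | no  i′≢i = trans (rowCount-≢ y i j′ i′≢i) (trans (sym (rowCount-≢ y i j i′≢i)) (x-rows i′))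

-- The lower bound

argmin : ∀ {n} (p : Fin n → Bool) (h : Fin n → ℕ) v → p v ≡ true →
         ∃[ u ] p u ≡ true × (∀ w → p w ≡ true → h u ≤ h w)
argmin {n} p h v pv = go (suc (h v)) v pv ℕ.≤-refl
  where
  go : ∀ k v → p v ≡ true → h v ℕ.< k → ∃[ u ] p u ≡ true × (∀ w → p w ≡ true → h u ≤ h w)
  go (suc k) v pv (s≤s hv≤k) with Fin.any? (λ w → (p w Bool.≟ true) ×-dec (h w ℕ.<? h v))
  ... | yes (w , pw , hw<hv) = go k w pw (ℕ.≤-trans hw<hv hv≤k)
  ... | no  none             = v , pv , λ w pw → ℕ.≮⇒≥ λ hw<hv → none (w , pw , hw<hv)

-- Since c ≤ a ≤ 16 (q + 1), the constant is 2 · 16² = 512, rounded up to a perfect square so that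
-- an integer factor can be moved inside the final square.
few-outside : ∀ a c q → 8 * c ≤ a → q * 16 ≤ a → a ℕ.< suc q * 16 → a * (a ℕ.+ c) ≤ 529 * (suc q * suc q)
few-outside a c q 8c≤a 16q≤a a<16q+16 = begin
  a * (a ℕ.+ c)                              ≤⟨ ℕ.*-monoʳ-≤ a (ℕ.+-monoʳ-≤ a (ℕ.≤-trans (ℕ.m≤n*m c 8) 8c≤a)) ⟩
  a * (a ℕ.+ a)                              ≤⟨ ℕ.*-mono-≤ a≤ (ℕ.+-mono-≤ a≤ a≤) ⟩
  suc q * 16 * (suc q * 16 ℕ.+ suc q * 16)   ≡⟨ square (suc q) 16 ⟩
  512 * (suc q * suc q)                      ≤⟨ ℕ.*-monoˡ-≤ (suc q * suc q) (ℕ.m≤m+n 512 17) ⟩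
  529 * (suc q * suc q)                      ∎
  where
  open ℕ.≤-Reasoning
  a≤ : a ≤ suc q * 16
  a≤ = ℕ.<⇒≤ a<16q+16
  square : ∀ x k → x * k * (x * k ℕ.+ x * k) ≡ (2 * (k * k)) * (x * x)
  square = solve-∀

-- The factor 9 would do; it is weakened to share the constant of `few-outside`.
many-outside : ∀ a c → a ≤ 8 * c → a * (a ℕ.+ c) ≤ 529 * (suc a * c)
many-outside a c a≤8c = begin
  a * (a ℕ.+ c)            ≤⟨ ℕ.*-mono-≤ (ℕ.n≤1+n a) (ℕ.+-monoˡ-≤ c a≤8c) ⟩
  suc a * (8 * c ℕ.+ c)    ≡⟨ regroup (suc a) c ⟩
  9 * (suc a * c)          ≤⟨ ℕ.*-monoˡ-≤ (suc a * c) (ℕ.m≤m+n 9 520) ⟩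
  529 * (suc a * c)        ∎
  where
  open ℕ.≤-Reasoning
  regroup : ∀ x c → x * (8 * c ℕ.+ c) ≡ 9 * (x * c)
  regroup = solve-∀

-- The counting conditions of the second cube construction for s < 2 q.
dense-conditions : ∀ a c q s → 8 * c ≤ a → q * 16 ≤ a → s ℕ.< q ℕ.+ q →
                   suc (s ℕ.+ c) ≤ a ℕ.∸ q × suc q ≤ a ℕ.∸ q ℕ.∸ s
dense-conditions a c q s 8c≤a 16q≤a s<2q =
    ℕ.m+n≤o⇒m≤o∸n (suc (s ℕ.+ c)) (ℕ.≤-trans (ℕ.+-monoˡ-≤ q (ℕ.+-monoˡ-≤ c s<2q)) 3q+c≤a)
  , ℕ.m+n≤o⇒m≤o∸n (suc q) (ℕ.m+n≤o⇒m≤o∸n (suc q ℕ.+ s) (begin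
      suc q ℕ.+ s ℕ.+ q            ≡⟨ swap q s ⟩
      suc s ℕ.+ (q ℕ.+ q)          ≤⟨ ℕ.+-monoˡ-≤ (q ℕ.+ q) s<2q ⟩
      q ℕ.+ q ℕ.+ (q ℕ.+ q)        ≡⟨ quadruple q ⟩
      q * 4                        ≤⟨ ℕ.*-monoʳ-≤ q (ℕ.m≤m+n 4 12) ⟩
      q * 16                       ≤⟨ 16q≤a ⟩
      a                            ∎))
  where
  open ℕ.≤-Reasoning
  swap : ∀ q s → suc q ℕ.+ s ℕ.+ q ≡ suc s ℕ.+ (q ℕ.+ q)
  swap = solve-∀
  quadruple : ∀ q → q ℕ.+ q ℕ.+ (q ℕ.+ q) ≡ q * 4
  quadruple = solve-∀
  expand : ∀ q c → 8 * (q ℕ.+ q ℕ.+ c ℕ.+ q) ≡ q * 24 ℕ.+ 8 * c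
  expand = solve-∀
  double : ∀ q → q * 32 ≡ q * 16 ℕ.+ q * 16
  double = solve-∀
  eight : ∀ a → a ℕ.+ a ℕ.+ a ℕ.+ 5 * a ≡ 8 * a
  eight = solve-∀
  -- Multiplied by 8, the left-hand side is 24 q + 8 c, where 24 q ≤ 32 q ≤ 2 a and 8 c ≤ a; the
  -- total 3 a leaves ample room below 8 a.
  3q+c≤a : q ℕ.+ q ℕ.+ c ℕ.+ q ≤ a
  3q+c≤a = ℕ.*-cancelˡ-≤ 8 (begin
    8 * (q ℕ.+ q ℕ.+ c ℕ.+ q)      ≡⟨ expand q c ⟩
    q * 24 ℕ.+ 8 * c               ≤⟨ ℕ.+-mono-≤ (ℕ.*-monoʳ-≤ q (ℕ.m≤m+n 24 8)) 8c≤a ⟩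
    q * 32 ℕ.+ a                   ≡⟨ cong (ℕ._+ a) (double q) ⟩
    q * 16 ℕ.+ q * 16 ℕ.+ a        ≤⟨ ℕ.+-monoˡ-≤ a (ℕ.+-mono-≤ 16q≤a 16q≤a) ⟩
    a ℕ.+ a ℕ.+ a                  ≤⟨ ℕ.m≤m+n _ (5 * a) ⟩
    a ℕ.+ a ℕ.+ a ℕ.+ 5 * a        ≡⟨ eight a ⟩
    8 * a                          ∎)

edge-bound : ∀ {n T} (H : Graph n) (A : Algorithm (n C 2) T) → A Computes f[ H ] →
  (I : Fin n → Bool) → IndependentSet H I → count I ≡ α H → ∀ v₁ (v₁∉I : I v₁ ≡ false) →
  (∀ u → I u ≡ false → (count λ w → I w ∧ does (adj? H v₁ w)) ≤ (count λ w → I w ∧ does (adj? H u w))) →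
  ∀ q r → n ≡ suc q ℕ.+ (count I ℕ.∸ q ℕ.+ r) → 8 * count (not ∘ I) ≤ count I → q * 16 ≤ count I →
  suc q * suc q ≤ 72 * T * (72 * T)
edge-bound {n} {T} H A computes I I-indep #I v₁ v₁∉I minimal q r n≡ 8c≤a 16q≤a =
  go n≡ H A computes I I-indep #I v₁ v₁∉I minimal refl 8c≤a 16q≤a
  where
  -- With `n` and the size of `I` generalised, the equation for `n` can be matched with `refl`,
  -- which makes the vertex set literally the sum of `B`, `A` and the remaining vertices.
  go : ∀ {n a} → n ≡ suc q ℕ.+ (a ℕ.∸ q ℕ.+ r) → (H : Graph n) (A : Algorithm (n C 2) T) → A Computes f[ H ] →
    (I : Fin n → Bool) → IndependentSet H I → count I ≡ α H → ∀ v₁ (v₁∉I : I v₁ ≡ false) →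
    (∀ u → I u ≡ false → (count λ w → I w ∧ does (adj? H v₁ w)) ≤ (count λ w → I w ∧ does (adj? H u w))) →
    a ≡ count I → 8 * count (not ∘ I) ≤ a → q * 16 ≤ a →
    suc q * suc q ≤ 72 * T * (72 * T)
  go {a = a} refl H A computes I I-indep #I v₁ v₁∉I minimal a≡ 8c≤a 16q≤a = cases (q ℕ.+ q ℕ.≤? s)
    where
    open ℕ.≤-Reasoning
    d s : ℕ
    d = count λ w → I w ∧ does (adj? H v₁ w)
    s = a ℕ.∸ d
    d≤a : d ≤ a
    d≤a = ℕ.≤-trans (count-mono {q = I} λ w → proj₁ ∘ ∧-true (I w) (does (adj? H v₁ w))) (ℕ.≤-reflexive (sym a≡))
    d+s : d ℕ.+ s ≡ a
    d+s = ℕ.m+[n∸m]≡n d≤a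
    q≤a : q ≤ a
    q≤a = ℕ.≤-trans (ℕ.m≤m*n q 16) 16q≤a
    module Cube = EdgeCube (suc q) (a ℕ.∸ q) r H I I-indep #I v₁ v₁∉I
      (cong suc (trans (ℕ.m+[n∸m]≡n q≤a) a≡))
    cases : Dec (q ℕ.+ q ≤ s) → suc q * suc q ≤ 72 * T * (72 * T)
    cases (yes 2q≤s) = subst (_≤ 72 * T * (72 * T)) (ℕ.*-identityʳ (suc q * suc q))
      (Cube.greedy-bound {T} A computes q (ℕ.m+n≤o⇒m≤o∸n (d ℕ.+ q) (begin
        d ℕ.+ q ℕ.+ q      ≡⟨ ℕ.+-assoc d q q ⟩
        d ℕ.+ (q ℕ.+ q)    ≤⟨ ℕ.+-monoʳ-≤ d 2q≤s ⟩
        d ℕ.+ s            ≡⟨ d+s ⟩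
        a                  ∎)))
    cases (no 2q≰s) =
      let a-large , rest-large = dense-conditions a (count (not ∘ I)) q s 8c≤a 16q≤a (ℕ.≰⇒> 2q≰s) in begin
      suc q * suc q                    ≤⟨ ℕ.*-mono-≤ (ℕ.m≤m*n (suc q) (suc s)) rest-large ⟩
      suc q * suc s * (a ℕ.∸ q ℕ.∸ s)  ≤⟨ Cube.rows-bound s (trans d+s a≡) minimal a-large {T} A computes ⟩
      72 * T * (72 * T)                ∎

scaled-square : ∀ j k t {l m} → j * j ≡ l → j * k ≡ m → l * (k * t * (k * t)) ≡ m * t * (m * t)
scaled-square j k t refl refl = square j k t
  where
  square : ∀ j k t → j * j * (k * t * (k * t)) ≡ j * k * t * (j * k * t)
  square = solve-∀

-- This is where the edge of `H` enters: it provides a candidate for v₁ and shows α < n.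
outside-independent : ∀ {n} (H : Graph n) I → IndependentSet H I → HasEdge H → ∃[ w ] not (I w) ≡ true
outside-independent H I I-indep (u , v , e) with I u in Iu | I v in Iv
... | true  | true  = contradiction e (I-indep u v Iu Iv)
... | true  | false = v , cong not Iv
... | false | _     = u , cong not Iu

-- 529 = 23², so that 1656 = 23 · 72 below.
maximum-bound : ∀ {n T} (H : Graph n) → HasEdge H → (A : Algorithm (n C 2) T) → A Computes f[ H ] →
  (I : Fin n → Bool) → IndependentSet H I → count I ≡ α H → α H * n ≤ 529 * (72 * T * (72 * T))
maximum-bound {n} {T} H (u , v , e) A computes I I-indep #I =
  subst₂ (λ x y → x * y ≤ 529 * (72 * T * (72 * T))) #I (count-not I)
    (cases (72 * T * (72 * T)) vertex-case edge-case (a ℕ.≤? 8 * c))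
  where
  open ℕ.≤-Reasoning
  a c : ℕ
  a = count I
  c = count (not ∘ I)
  escaped : ∃[ w ] not (I w) ≡ true
  escaped = outside-independent H I I-indep (u , v , e)
  least : ∃[ w ] not (I w) ≡ true × (∀ x → not (I x) ≡ true →
            (count λ y → I y ∧ does (adj? H w y)) ≤ (count λ y → I y ∧ does (adj? H x y)))
  least = argmin (not ∘ I) (λ w → count λ y → I y ∧ does (adj? H w y)) (proj₁ escaped) (proj₂ escaped)
  a<n : suc a ≤ n
  a<n = begin
    suc a      ≡⟨ ℕ.+-comm 1 a ⟩
    a ℕ.+ 1    ≤⟨ ℕ.+-monoʳ-≤ a (count-≥1 (not ∘ I) (proj₁ escaped) (proj₂ escaped)) ⟩
    a ℕ.+ c    ≡⟨ count-not I ⟩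
    n          ∎
  c≡ : n ℕ.∸ α H ≡ c
  c≡ = trans (cong (n ℕ.∸_) (sym #I)) (trans (cong (ℕ._∸ a) (sym (count-not I))) (ℕ.m+n∸m≡n a c))
  q r : ℕ
  q = a ℕ./ 16
  r = n ℕ.∸ suc a
  q*16≤a : q * 16 ≤ a
  q*16≤a = m/n*n≤m a 16
  a<q*16+16 : a ℕ.< suc q * 16
  a<q*16+16 = begin
    suc a                      ≡⟨ cong suc (m≡m%n+[m/n]*n a 16) ⟩
    suc (a ℕ.% 16) ℕ.+ q * 16  ≤⟨ ℕ.+-monoˡ-≤ (q * 16) (m%n<n a 16) ⟩
    16 ℕ.+ q * 16              ∎
  n≡ : n ≡ suc q ℕ.+ (a ℕ.∸ q ℕ.+ r)
  n≡ = sym (trans (sym (ℕ.+-assoc (suc q) (a ℕ.∸ q) r))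
    (trans (cong (λ x → suc x ℕ.+ r) (ℕ.m+[n∸m]≡n (ℕ.≤-trans (ℕ.m≤m*n q 16) q*16≤a))) (ℕ.m+[n∸m]≡n a<n)))
  vertex-case : suc a * c ≤ 72 * T * (72 * T)
  vertex-case = subst₂ (λ x y → suc x * y ≤ 72 * T * (72 * T)) (sym #I) c≡
    (VertexCube.bound H I I-indep #I (subst (λ x → suc x ≤ n) #I a<n) {T} A computes)
  edge-case : 8 * c ≤ a → suc q * suc q ≤ 72 * T * (72 * T)
  edge-case 8c≤a = edge-bound {T = T} H A computes I I-indep #I (proj₁ least) (not-true (proj₁ (proj₂ least)))
    (λ x x∉I → proj₂ (proj₂ least) x (cong not x∉I)) q r n≡ 8c≤a q*16≤a
  cases : ∀ Z → suc a * c ≤ Z → (8 * c ≤ a → suc q * suc q ≤ Z) → Dec (a ≤ 8 * c) → a * (a ℕ.+ c) ≤ 529 * Z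
  cases Z few many (yes a≤8c) = ℕ.≤-trans (many-outside a c a≤8c) (ℕ.*-monoʳ-≤ 529 few)
  cases Z few many (no a≰8c)  =
    let 8c≤a = ℕ.<⇒≤ (ℕ.≰⇒> a≰8c) in
    ℕ.≤-trans (few-outside a c q 8c≤a q*16≤a a<q*16+16) (ℕ.*-monoʳ-≤ 529 (many 8c≤a))

query-bound : ∀ {n T} (H : Graph n) → HasEdge H → (A : Algorithm (n C 2) T) → A Computes f[ H ] →
              α H * n ≤ 1656 * T * (1656 * T)
query-bound {n} {T} H edge A computes =
  let I , I-indep , #I = maximum-independent H in
  subst (α H * n ≤_) (scaled-square 23 72 T {529} {1656} refl refl) (maximum-bound {n} {T} H edge A computes I I-indep #I)

-- Passing from squares to real square roots

square-cancel-≤ : ∀ m n → m * m ≤ n * n → m ≤ n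
square-cancel-≤ m n m²≤n² = ℕ.≮⇒≥ λ n<m → ℕ.<⇒≱ (ℕ.*-mono-< n<m n<m) m²≤n²

-- The approximations are rounded down: with denominator d, the square of the numerator is at most m
-- d², hence at most (k d)². The comparison with `k` therefore holds termwise, with no error term.
√-seq-≤ : ∀ m k → m ≤ k * k → ∀ j → √-seq m j ℚ.≤ k /1
√-seq-≤ m k m≤k² j = ℚ.toℚᵘ-cancel-≤ (begin
  ℚ.toℚᵘ (√-seq m j)     ≃⟨ ℚ.toℚᵘ-fromℚᵘ (ℚᵘ.mkℚᵘ (+ root) j) ⟩
  ℚᵘ.mkℚᵘ (+ root) j     ≤⟨ ℚᵘ.*≤* (subst₂ ℤ._≤_ (ℤ.pos-* root 1) (ℤ.pos-* k (suc j))
                              (ℤ.+≤+ (ℕ.≤-trans (ℕ.≤-reflexive (ℕ.*-identityʳ root)) root≤))) ⟩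
  ℚᵘ.mkℚᵘ (+ k) 0        ≃⟨ ℚ.toℚᵘ-fromℚᵘ (ℚᵘ.mkℚᵘ (+ k) 0) ⟨
  ℚ.toℚᵘ (k /1)          ∎)
  where
  open ℚᵘ.≤-Reasoning
  root : ℕ
  root = isqrt (m * (suc j * suc j))
  interchange : ∀ k d → k * k * (d * d) ≡ k * d * (k * d)
  interchange = solve-∀
  root≤ : root ≤ k * suc j
  root≤ = square-cancel-≤ root (k * suc j) (ℕ.≤-trans (isqrt-lower (m * (suc j * suc j)))
    (ℕ.≤-trans (ℕ.*-monoˡ-≤ (suc j * suc j) m≤k²) (ℕ.≤-reflexive (interchange k (suc j)))))

scaled-√ : ∀ ι k {m t} → 0ℚ ℚ.≤ ι → ι ℚ.* k /1 ≡ 1ℚ → m ≤ k * t * (k * t) → fromℚ ι *ᵣ √ m ≲ fromℕ t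
scaled-√ ι k {m} {t} 0≤ι ιk≡1 m≤ = pointwise-≲ λ j → begin
  ι ℚ.* √-seq m j            ≤⟨ ℚ.*-monoˡ-≤-nonNeg ι {{ℚ.nonNegative 0≤ι}} (√-seq-≤ m (k * t) m≤ j) ⟩
  ι ℚ.* (k * t) /1           ≡⟨ cong (ι ℚ.*_) (/1-homo-* k t) ⟩
  ι ℚ.* (k /1 ℚ.* t /1)      ≡⟨ ℚ.*-assoc ι (k /1) (t /1) ⟨
  ι ℚ.* k /1 ℚ.* t /1        ≡⟨ cong (ℚ._* t /1) ιk≡1 ⟩
  1ℚ ℚ.* t /1                ≡⟨ ℚ.*-identityˡ (t /1) ⟩
  t /1                       ∎
  where open ℚ.≤-Reasoning

theorem1 : Σ[ c ∈ ℝ ] (0ᵣ <ᵣ c ×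
    (∀ (n : ℕ) → 2 ≤ n → (H : Graph n) → HasEdge H →
    Q f[ H ] ≥ c *ᵣ √ (α H * n)))
theorem1 = fromℚ (+ 1 / 1656)
  , (+ 1 / 1656 , ℚ.positive⁻¹ (+ 1 / 1656) , 0 , λ _ _ → ℚ.≤-reflexive (ℚ.+-identityˡ (+ 1 / 1656)))
  , λ n _ H edge T A computes → unwrap-≲
      (scaled-√ (+ 1 / 1656) 1656 {α H * n} {T} (ℚ.<⇒≤ (ℚ.positive⁻¹ (+ 1 / 1656))) refl (query-bound H edge A computes))
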